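{- Let $G=(V,E)$ be a finite connected simple graph on $n$ vertices, let $C\subseteq V$ with $|C|=r$, and let $2\le k<r$. Suppose that $$\frac{r-k}{r-1}\,\overline{\deg}(C)>\frac{n-k}{n-1}\,\overline{\deg}(V),$$ that $G$ has property $(*)$, and that $$\frac{|Y\cap C|}{r}<\frac{|Y|}{n},$$ where $Y$ is the set of vertices of minimum degree. Then $G$ (with central region $C$) exhibits the weak switchover phenomenon with seed size $k$.
   Context: For $0\le\beta\le1$, $G^\beta$ denotes the random spanning subgraph of $G$ obtained by keeping each edge independently with probability $\beta$. For $S\subseteq V$, $G^\beta(S)$ is the union of the connected components of $G^\beta$ meeting $S$, and $|G^\beta(S)|$ its number of vertices. $\mathbf{S}_C$ is a uniformly random $k$-subset of $C$, $\mathbf{S}_V$ a uniformly random $k$-subset of $V$, each independent of the percolation; $\mathbb{E}$ is expectation over both. $\overline{\deg}(K)=\frac{1}{|K|}\sum_{v\in K}\deg(v)$. Property $(*)$: $G$ has minimum degree $d$, is not $d$-regular, and the only edge-cuts with at most $d$ edges are the sets of edges incident to a single vertex of degree $d$. Weak switchover with seed size $k$: there exist $\beta_1,\beta_2\in(0,1)$ with $\mathbb{E}(|G^{\beta_1}(\mathbf{S}_C)|)>\mathbb{E}(|G^{\beta_1}(\mathbf{S}_V)|)$ and $\mathbb{E}(|G^{\beta_2}(\mathbf{S}_C)|)<\mathbb{E}(|G^{\beta_2}(\mathbf{S}_V)|)$. -}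

module Defs where

open import Data.Bool using (Bool; true; false; _∧_; _∨_; _xor_; if_then_else_)
open import Data.Nat as ℕ using (ℕ; zero; suc; _≤_; _<ᵇ_; _∸_; _≡ᵇ_)
open import Data.Fin using (Fin; toℕ; _≟_)
open import Data.Fin.Subset using (Subset; ∣_∣; ∁; Nonempty; ⊤)
open import Data.Vec using (Vec; []; _∷_; tabulate; lookup)
open import Data.List as List using (List; []; _∷_; length; filterᵇ; allFin; concatMap; map)
open import Data.Bool.ListAction using (any; all)
open import Data.Nat.ListAction using (sum)
open import Data.Integer using (+_)
open import Data.Rational using (ℚ; 0ℚ; 1ℚ; _+_; _*_; _-_; _/_; _<_)
open import Data.Product using (Σ; _×_; _,_; ∃; ∃-syntax)
open import Relation.Nullary using (¬_; does)
open import Relation.Binary.PropositionalEquality using (_≡_; _≢_)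
open import Relation.Binary.Construct.Closure.ReflexiveTransitive using (Star)

_∈ᵇ_ : ∀ {n} → Fin n → Subset n → Bool
v ∈ᵇ S = lookup S v

-- a/b as a rational number (0 when b = 0; all denominators used below
-- are nonzero under the hypotheses of the theorem)
frac : ℕ → ℕ → ℚ
frac a zero    = 0ℚ
frac a (suc b) = + a / suc b

ℕ→ℚ : ℕ → ℚ
ℕ→ℚ a = + a / 1

_^ℚ_ : ℚ → ℕ → ℚ
x ^ℚ zero  = 1ℚ
x ^ℚ suc m = x * (x ^ℚ m)

sumℚ : List ℚ → ℚ
sumℚ = List.foldr _+_ 0ℚ

mean : List ℚ → ℚ
mean []       = 0ℚ
mean (x ∷ xs) = sumℚ (x ∷ xs) * (+ 1 / suc (length xs))

countᵇ : ∀ {A : Set} → (A → Bool) → List A → ℕ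
countᵇ p xs = length (filterᵇ p xs)

sublists : ∀ {A : Set} → List A → List (List A)
sublists []       = [] ∷ []
sublists (x ∷ xs) = concatMap (λ ys → (x ∷ ys) ∷ ys ∷ []) (sublists xs)

allSubsets : ∀ n → List (Subset n)
allSubsets zero    = [] ∷ []
allSubsets (suc n) = concatMap (λ s → (true ∷ s) ∷ (false ∷ s) ∷ []) (allSubsets n)

_⊆ᵇ_ : ∀ {n} → Subset n → Subset n → Bool
_⊆ᵇ_ {n} S T = all (λ v → if v ∈ᵇ S then v ∈ᵇ T else true) (allFin n)

-- all k-subsets of C (the support of the uniform random k-subset S_C)
kSubsetsOf : ∀ {n} → ℕ → Subset n → List (Subset n)
kSubsetsOf {n} k C = filterᵇ (λ S → (∣ S ∣ ≡ᵇ k) ∧ (S ⊆ᵇ C)) (allSubsets n)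

record Graph (n : ℕ) : Set where
  field
    adj    : Fin n → Fin n → Bool
    sym    : ∀ u v → adj u v ≡ adj v u
    irrefl : ∀ v → adj v v ≡ false
open Graph public

module _ {n : ℕ} (G : Graph n) where

  Adj : Fin n → Fin n → Set
  Adj u v = adj G u v ≡ true

  Connected : Set
  Connected = ∀ u v → Star Adj u v

  nbhd : Fin n → Subset n
  nbhd v = tabulate (adj G v)

  deg : Fin n → ℕ
  deg v = ∣ nbhd v ∣

  degSum : Subset n → ℕ
  degSum K = sum (map (λ v → if v ∈ᵇ K then deg v else 0) (allFin n))

  avgDeg : Subset n → ℚ
  avgDeg K = frac (degSum K) ∣ K ∣

  -- the edge set E, each edge {u,v} listed once as (u , v) with u < v
  edges : List (Fin n × Fin n)
  edges = concatMap (λ u → map (λ v → (u , v))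
                                (filterᵇ (λ v → (toℕ u <ᵇ toℕ v) ∧ adj G u v) (allFin n)))
                    (allFin n)

  crosses : Subset n → Fin n → Fin n → Bool
  crosses S u v = (u ∈ᵇ S) xor (v ∈ᵇ S)

  cutSize : Subset n → ℕ
  cutSize S = countᵇ (λ { (u , v) → crosses S u v }) edges

  incident : Fin n → Fin n → Fin n → Bool
  incident w u v = does (u ≟ w) ∨ does (v ≟ w)

  IsMinDegree : ℕ → Set
  IsMinDegree d = (∀ v → d ≤ deg v) × (∃[ v ] deg v ≡ d)

  PropertyStar : ℕ → Set
  PropertyStar d =
      IsMinDegree d
    × ¬ (∀ v → deg v ≡ d)
    × (∀ (S : Subset n) → Nonempty S → Nonempty (∁ S) →
         cutSize S ≤ d →
         ∃[ w ] (deg w ≡ d ×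
                 (∀ u v → Adj u v → crosses S u v ≡ incident w u v)))

  minDegSet : ℕ → Subset n
  minDegSet d = tabulate (λ v → deg v ≡ᵇ d)

  keptAdj : List (Fin n × Fin n) → Fin n → Fin n → Bool
  keptAdj F u v = any (λ { (a , b) → (does (a ≟ u) ∧ does (b ≟ v)) ∨ (does (a ≟ v) ∧ does (b ≟ u)) }) F

  grow : List (Fin n × Fin n) → Subset n → Subset n
  grow F R = tabulate (λ v → (v ∈ᵇ R) ∨ any (λ u → (u ∈ᵇ R) ∧ keptAdj F u v) (allFin n))

  iter : ℕ → (Subset n → Subset n) → Subset n → Subset n
  iter zero    f R = R
  iter (suc m) f R = f (iter m f R)

  -- vertex set of the union of the components of (V,F) meeting S
  -- (n closure steps suffice to reach every vertex reachable from S)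
  reachFrom : List (Fin n × Fin n) → Subset n → Subset n
  reachFrom F S = iter n (grow F) S

  configProb : ℚ → List (Fin n × Fin n) → ℚ
  configProb β F = (β ^ℚ length F) * ((1ℚ - β) ^ℚ (length edges ∸ length F))

  expectedClusterSize : ℚ → Subset n → ℚ
  expectedClusterSize β S =
    sumℚ (map (λ F → configProb β F * ℕ→ℚ ∣ reachFrom F S ∣) (sublists edges))

  expectedSeedCluster : ℚ → ℕ → Subset n → ℚ
  expectedSeedCluster β k K = mean (map (expectedClusterSize β) (kSubsetsOf k K))

  InOpenUnit : ℚ → Set
  InOpenUnit β = (0ℚ < β) × (β < 1ℚ)

  WeakSwitchover : Subset n → ℕ → Set
  WeakSwitchover C k =
    ∃[ β₁ ] ∃[ β₂ ]
      ( InOpenUnit β₁ × InOpenUnit β₂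
      × (expectedSeedCluster β₁ k ⊤ < expectedSeedCluster β₁ k C)
      × (expectedSeedCluster β₂ k C < expectedSeedCluster β₂ k ⊤))

{-# OPTIONS --safe #-}
module Submission where

-- For a seed S of size k, E|G^β(S)| = k + β·cut(S) + O(β²) as β → 0: with at most one open edge
-- the cluster grows by one vertex exactly when that edge crosses the cut of S. Averaged over the
-- k-subsets of a set, the cut size is (r−k)/(r−1)·deg‾ times a binomial factor (exactly for V, at
-- least that for C), so the first hypothesis makes C win at small β.
-- As β → 1, with q = 1 − β, the expected number of vertices outside the cluster is
-- q^d·|Y ∖ S| + O(q^(d+1)): a missed vertex is either a vertex of Y ∖ S all of whose d edges are
-- closed, or it lies beyond a closed edge-cut which, by property (*), has more than d edges.
-- The second hypothesis says that k-subsets of C miss more vertices of Y on average, so V wins there.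

module NatCast where

  open import Data.Nat as ℕ using (ℕ; zero; suc)
  import Data.Nat.Properties as ℕP
  open import Data.Integer as ℤ using (+_)
  open import Data.Rational
  open import Data.Rational.Properties
  import Data.Rational.Unnormalised as U
  import Data.Rational.Unnormalised.Properties as UP
  open import Data.Rational.Solver using (module +-*-Solver)
  open import Relation.Binary.PropositionalEquality
  open import Relation.Binary.Definitions using (tri<; tri≈; tri>)
  open import Data.Empty using (⊥-elim)
  open import Data.Integer.Solver using () renaming (module +-*-Solver to ZS)
  open import Defs using (ℕ→ℚ; frac)

  fromℚᵘ-+ : ∀ p q → fromℚᵘ p + fromℚᵘ q ≡ fromℚᵘ (p U.+ q)
  fromℚᵘ-+ p q = toℚᵘ-injective (begin
      toℚᵘ (fromℚᵘ p + fromℚᵘ q)      ≈⟨ toℚᵘ-homo-+ (fromℚᵘ p) (fromℚᵘ q) ⟩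
      toℚᵘ (fromℚᵘ p) U.+ toℚᵘ (fromℚᵘ q) ≈⟨ UP.+-cong (toℚᵘ-fromℚᵘ p) (toℚᵘ-fromℚᵘ q) ⟩
      p U.+ q                          ≈⟨ UP.≃-sym (toℚᵘ-fromℚᵘ (p U.+ q)) ⟩
      toℚᵘ (fromℚᵘ (p U.+ q)) ∎)
    where open UP.≃-Reasoning

  fromℚᵘ-* : ∀ p q → fromℚᵘ p * fromℚᵘ q ≡ fromℚᵘ (p U.* q)
  fromℚᵘ-* p q = toℚᵘ-injective (begin
      toℚᵘ (fromℚᵘ p * fromℚᵘ q)      ≈⟨ toℚᵘ-homo-* (fromℚᵘ p) (fromℚᵘ q) ⟩
      toℚᵘ (fromℚᵘ p) U.* toℚᵘ (fromℚᵘ q) ≈⟨ UP.*-cong (toℚᵘ-fromℚᵘ p) (toℚᵘ-fromℚᵘ q) ⟩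
      p U.* q                          ≈⟨ UP.≃-sym (toℚᵘ-fromℚᵘ (p U.* q)) ⟩
      toℚᵘ (fromℚᵘ (p U.* q)) ∎)
    where open UP.≃-Reasoning

  ℕ→ℚ-suc : ∀ a → ℕ→ℚ (suc a) ≡ 1ℚ + ℕ→ℚ a
  ℕ→ℚ-suc a = trans (fromℚᵘ-cong {U.mkℚᵘ (+ suc a) 0} {U.mkℚᵘ (+ 1) 0 U.+ U.mkℚᵘ (+ a) 0} (U.*≡* eq)) (sym (fromℚᵘ-+ (U.mkℚᵘ (+ 1) 0) (U.mkℚᵘ (+ a) 0)))
    where
    eq : + suc a ℤ.* + 1 ≡ ((+ 1) ℤ.* (+ 1) ℤ.+ (+ a) ℤ.* (+ 1)) ℤ.* (+ 1)
    eq = ZS.solve 1 (λ i → (ZS.con (+ 1) ZS.:+ i) ZS.:* ZS.con (+ 1) ZS.:= (ZS.con (+ 1) ZS.:* ZS.con (+ 1) ZS.:+ i ZS.:* ZS.con (+ 1)) ZS.:* ZS.con (+ 1)) refl (+ a)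

  frac*denominator : ∀ a b → frac a (suc b) * ℕ→ℚ (suc b) ≡ ℕ→ℚ a
  frac*denominator a b = trans (fromℚᵘ-* (U.mkℚᵘ (+ a) b) (U.mkℚᵘ (+ suc b) 0)) (fromℚᵘ-cong {U.mkℚᵘ (+ a) b U.* U.mkℚᵘ (+ suc b) 0} {U.mkℚᵘ (+ a) 0} (U.*≡* eq))
    where
    eq : (+ a ℤ.* + suc b) ℤ.* + 1 ≡ + a ℤ.* + (suc b ℕ.* 1)
    eq = ZS.solve 2 (λ i j → (i ZS.:* j) ZS.:* ZS.con (+ 1) ZS.:= i ZS.:* (j ZS.:* ZS.con (+ 1))) refl (+ a) (+ suc b)

  open +-*-Solver

  ℕ→ℚ-+ : ∀ a b → ℕ→ℚ (a ℕ.+ b) ≡ ℕ→ℚ a + ℕ→ℚ b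
  ℕ→ℚ-+ zero b = sym (+-identityˡ (ℕ→ℚ b))
  ℕ→ℚ-+ (suc a) b = begin
    ℕ→ℚ (suc (a ℕ.+ b))        ≡⟨ ℕ→ℚ-suc (a ℕ.+ b) ⟩
    1ℚ + ℕ→ℚ (a ℕ.+ b)         ≡⟨ cong (λ z → 1ℚ + z) (ℕ→ℚ-+ a b) ⟩
    1ℚ + (ℕ→ℚ a + ℕ→ℚ b)       ≡⟨ sym (+-assoc 1ℚ (ℕ→ℚ a) (ℕ→ℚ b)) ⟩
    (1ℚ + ℕ→ℚ a) + ℕ→ℚ b       ≡⟨ cong (_+ ℕ→ℚ b) (sym (ℕ→ℚ-suc a)) ⟩
    ℕ→ℚ (suc a) + ℕ→ℚ b ∎
    where open ≡-Reasoning

  ℕ→ℚ-* : ∀ a b → ℕ→ℚ (a ℕ.* b) ≡ ℕ→ℚ a * ℕ→ℚ b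
  ℕ→ℚ-* zero b = sym (*-zeroˡ (ℕ→ℚ b))
  ℕ→ℚ-* (suc a) b = begin
    ℕ→ℚ (b ℕ.+ a ℕ.* b)        ≡⟨ ℕ→ℚ-+ b (a ℕ.* b) ⟩
    ℕ→ℚ b + ℕ→ℚ (a ℕ.* b)      ≡⟨ cong (λ z → ℕ→ℚ b + z) (ℕ→ℚ-* a b) ⟩
    ℕ→ℚ b + ℕ→ℚ a * ℕ→ℚ b      ≡⟨ solve 2 (λ x y → y :+ x :* y := (con 1ℚ :+ x) :* y) refl (ℕ→ℚ a) (ℕ→ℚ b) ⟩
    (1ℚ + ℕ→ℚ a) * ℕ→ℚ b       ≡⟨ cong (_* ℕ→ℚ b) (sym (ℕ→ℚ-suc a)) ⟩
    ℕ→ℚ (suc a) * ℕ→ℚ b ∎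
    where open ≡-Reasoning

  ℕ→ℚ-∸ : ∀ a b → b ℕ.≤ a → ℕ→ℚ (a ℕ.∸ b) ≡ ℕ→ℚ a - ℕ→ℚ b
  ℕ→ℚ-∸ a b b≤a = begin
    ℕ→ℚ (a ℕ.∸ b)  ≡⟨ solve 2 (λ x y → x := (x :+ y) :- y) refl (ℕ→ℚ (a ℕ.∸ b)) (ℕ→ℚ b) ⟩
    (ℕ→ℚ (a ℕ.∸ b) + ℕ→ℚ b) - ℕ→ℚ b  ≡⟨ cong (_- ℕ→ℚ b) (sym (ℕ→ℚ-+ (a ℕ.∸ b) b)) ⟩
    ℕ→ℚ (a ℕ.∸ b ℕ.+ b) - ℕ→ℚ b  ≡⟨ cong (λ z → ℕ→ℚ z - ℕ→ℚ b) (ℕP.m∸n+n≡m b≤a) ⟩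
    ℕ→ℚ a - ℕ→ℚ b ∎
    where open ≡-Reasoning

  0≤q-p⇒p≤q : ∀ p q → 0ℚ ≤ q - p → p ≤ q
  0≤q-p⇒p≤q p q h = subst₂ _≤_ (+-identityˡ p) (solve 2 (λ x y → (y :- x) :+ x := y) refl p q) (+-monoˡ-≤ p h)

  0<q-p⇒p<q : ∀ p q → 0ℚ < q - p → p < q
  0<q-p⇒p<q p q h = subst₂ _<_ (+-identityˡ p) (solve 2 (λ x y → (y :- x) :+ x := y) refl p q) (+-monoˡ-< p h)

  p≤q⇒0≤q-p : ∀ p q → p ≤ q → 0ℚ ≤ q - p
  p≤q⇒0≤q-p p q h = subst₂ _≤_ (+-inverseʳ p) refl (+-monoˡ-≤ (- p) h)

  p<q⇒0<q-p : ∀ p q → p < q → 0ℚ < q - p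
  p<q⇒0<q-p p q h = subst₂ _<_ (+-inverseʳ p) refl (+-monoˡ-< (- p) h)

  0≤1 : 0ℚ ≤ 1ℚ
  0≤1 = *≤* (ℤ.+≤+ ℕ.z≤n)

  0<1 : 0ℚ < 1ℚ
  0<1 = *<* (ℤ.+<+ (ℕ.s≤s ℕ.z≤n))

  ℕ→ℚ-nonNeg : ∀ a → 0ℚ ≤ ℕ→ℚ a
  ℕ→ℚ-nonNeg zero = ≤-refl
  ℕ→ℚ-nonNeg (suc a) = subst (0ℚ ≤_) (sym (ℕ→ℚ-suc a)) (+-mono-≤ 0≤1 (ℕ→ℚ-nonNeg a))

  ℕ→ℚ-suc-pos : ∀ a → 0ℚ < ℕ→ℚ (suc a)
  ℕ→ℚ-suc-pos a = subst (0ℚ <_) (sym (ℕ→ℚ-suc a)) (+-mono-<-≤ 0<1 (ℕ→ℚ-nonNeg a))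

  ℕ→ℚ-mono-≤ : ∀ {a b} → a ℕ.≤ b → ℕ→ℚ a ≤ ℕ→ℚ b
  ℕ→ℚ-mono-≤ {a} {b} a≤b = 0≤q-p⇒p≤q _ _ (subst (0ℚ ≤_) (ℕ→ℚ-∸ b a a≤b) (ℕ→ℚ-nonNeg (b ℕ.∸ a)))

  ℕ→ℚ-mono-< : ∀ {a b} → a ℕ.< b → ℕ→ℚ a < ℕ→ℚ b
  ℕ→ℚ-mono-< {a} {suc b} (ℕ.s≤s a≤b) = 0<q-p⇒p<q _ _ (subst (0ℚ <_) eq (ℕ→ℚ-suc-pos (b ℕ.∸ a)))
    where
    eq : ℕ→ℚ (suc (b ℕ.∸ a)) ≡ ℕ→ℚ (suc b) - ℕ→ℚ a
    eq = trans (cong ℕ→ℚ (sym (ℕP.+-∸-assoc 1 a≤b))) (ℕ→ℚ-∸ (suc b) a (ℕP.m≤n⇒m≤1+n a≤b))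

  ℕ→ℚ-cancel-< : ∀ {a b} → ℕ→ℚ a < ℕ→ℚ b → a ℕ.< b
  ℕ→ℚ-cancel-< {a} {b} h with ℕP.<-cmp a b
  ... | tri< lt _ _ = lt
  ... | tri≈ _ refl _ = ⊥-elim (<-irrefl refl h)
  ... | tri> _ _ gt = ⊥-elim (<-asym h (ℕ→ℚ-mono-< gt))



module Percolation where

  open import Data.Nat as ℕ using (ℕ; zero; suc)
  import Data.Nat.Properties as ℕP
  open import Data.Bool using (Bool; true; false; not; if_then_else_)
  open import Data.List using (List; []; _∷_; length; map; concatMap)
  open import Data.List.Relation.Unary.All as All using (All; []; _∷_)
  open import Data.Bool.ListAction using (any)
  open import Data.Rational
  open import Data.Rational.Properties
  open import Data.Rational.Solver using (module +-*-Solver)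
  open import Relation.Binary.PropositionalEquality
  open import Defs using (ℕ→ℚ; _^ℚ_; sumℚ; sublists; countᵇ)
  open NatCast
  import Data.Nat.Solver as NS
  module NSo = NS.+-*-Solver
  open +-*-Solver

  boolToℚ : Bool → ℚ
  boolToℚ true = 1ℚ
  boolToℚ false = 0ℚ

  closedProb : ℚ → ℚ
  closedProb β = 1ℚ - β

  module _ {A : Set} (β : ℚ) where
    private
      q : ℚ
      q = closedProb β

    configProbₘ : ℕ → List A → ℚ
    configProbₘ m F = (β ^ℚ length F) * (q ^ℚ (m ℕ.∸ length F))

    expectationOverSublists : ℕ → List A → (List A → ℚ) → ℚ
    expectationOverSublists m es g = sumℚ (map (λ F → configProbₘ m F * g F) (sublists es))

    -- The expectation of g over the random sublist keeping each entry with probability β,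
    -- computed by conditioning on the first entry.
    𝔼 : List A → (List A → ℚ) → ℚ
    𝔼 [] g = g []
    𝔼 (x ∷ xs) g = β * 𝔼 xs (λ ys → g (x ∷ ys)) + q * 𝔼 xs g

    sublists-length : ∀ (xs : List A) → All (λ ys → length ys ℕ.≤ length xs) (sublists xs)
    sublists-length [] = ℕ.z≤n ∷ []
    sublists-length (x ∷ xs) = go (sublists xs) (sublists-length xs)
      where
      go : ∀ L → All (λ ys → length ys ℕ.≤ length xs) L →
           All (λ ys → length ys ℕ.≤ suc (length xs)) (concatMap (λ ys → (x ∷ ys) ∷ ys ∷ []) L)
      go [] [] = []
      go (ys ∷ L) (p ∷ ps) = ℕ.s≤s p ∷ ℕP.m≤n⇒m≤1+n p ∷ go L ps

    sumℚ-branch : ∀ (h : List A → ℚ) (x : A) L →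
      sumℚ (map h (concatMap (λ ys → (x ∷ ys) ∷ ys ∷ []) L)) ≡ sumℚ (map (λ ys → h (x ∷ ys) + h ys) L)
    sumℚ-branch h x [] = refl
    sumℚ-branch h x (ys ∷ L) = trans (sym (+-assoc (h (x ∷ ys)) (h ys) _)) (cong (h (x ∷ ys) + h ys +_) (sumℚ-branch h x L))

    sumℚ-configProb-step : ∀ (m : ℕ) (a b : List A → ℚ) (x : A) L → All (λ ys → length ys ℕ.≤ m) L →
      sumℚ (map (λ ys → configProbₘ (suc m) (x ∷ ys) * a ys + configProbₘ (suc m) ys * b ys) L)
        ≡ β * sumℚ (map (λ ys → configProbₘ m ys * a ys) L) + q * sumℚ (map (λ ys → configProbₘ m ys * b ys) L)
    sumℚ-configProb-step m a b x [] [] = solve 2 (λ u v → con 0ℚ := u :* con 0ℚ :+ v :* con 0ℚ) refl β q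
    sumℚ-configProb-step m a b x (ys ∷ L) (p ∷ ps) = begin
        configProbₘ (suc m) (x ∷ ys) * a ys + configProbₘ (suc m) ys * b ys + rest
          ≡⟨ cong₂ (λ u v → u + v + rest) e1 e2 ⟩
        β * X + q * Y + rest
          ≡⟨ cong (λ z → β * X + q * Y + z) (sumℚ-configProb-step m a b x L ps) ⟩
        β * X + q * Y + (β * S1 + q * S2)
          ≡⟨ solve 6 (λ b' q' x' y' s1 s2 → b' :* x' :+ q' :* y' :+ (b' :* s1 :+ q' :* s2)
                   := b' :* (x' :+ s1) :+ q' :* (y' :+ s2)) refl β q X Y S1 S2 ⟩
        β * (X + S1) + q * (Y + S2) ∎
      where
      open ≡-Reasoning
      rest = sumℚ (map (λ ys → configProbₘ (suc m) (x ∷ ys) * a ys + configProbₘ (suc m) ys * b ys) L)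
      S1 = sumℚ (map (λ ys → configProbₘ m ys * a ys) L)
      S2 = sumℚ (map (λ ys → configProbₘ m ys * b ys) L)
      U = β ^ℚ length ys
      V = q ^ℚ (m ℕ.∸ length ys)
      X = configProbₘ m ys * a ys
      Y = configProbₘ m ys * b ys
      e1 : configProbₘ (suc m) (x ∷ ys) * a ys ≡ β * X
      e1 = solve 4 (λ b' u v w → ((b' :* u) :* v) :* w := b' :* ((u :* v) :* w)) refl β U V (a ys)
      e2 : configProbₘ (suc m) ys * b ys ≡ q * Y
      e2 = trans (cong (λ z → (U * (q ^ℚ z)) * b ys) (ℕP.+-∸-assoc 1 p))
              (solve 4 (λ u q' v w → (u :* (q' :* v)) :* w := q' :* ((u :* v) :* w)) refl U q V (b ys))

    expectationOverSublists-∷ : ∀ (x : A) xs g → expectationOverSublists (suc (length xs)) (x ∷ xs) g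
      ≡ β * expectationOverSublists (length xs) xs (λ ys → g (x ∷ ys)) + q * expectationOverSublists (length xs) xs g
    expectationOverSublists-∷ x xs g = trans (sumℚ-branch (λ F → configProbₘ (suc (length xs)) F * g F) x (sublists xs))
                          (sumℚ-configProb-step (length xs) (λ ys → g (x ∷ ys)) g x (sublists xs) (sublists-length xs))

    expectationOverSublists≡𝔼 : ∀ (es : List A) g → expectationOverSublists (length es) es g ≡ 𝔼 es g
    expectationOverSublists≡𝔼 [] g = solve 1 (λ z → (con 1ℚ :* con 1ℚ) :* z :+ con 0ℚ := z) refl (g [])
    expectationOverSublists≡𝔼 (x ∷ xs) g = trans (expectationOverSublists-∷ x xs g) (cong₂ (λ u v → β * u + q * v) (expectationOverSublists≡𝔼 xs _) (expectationOverSublists≡𝔼 xs g))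

    𝔼-cong : ∀ (es : List A) {g h : List A → ℚ} → (∀ F → g F ≡ h F) → 𝔼 es g ≡ 𝔼 es h
    𝔼-cong [] e = e []
    𝔼-cong (x ∷ xs) e = cong₂ (λ u v → β * u + q * v) (𝔼-cong xs (λ ys → e (x ∷ ys))) (𝔼-cong xs e)

    𝔼-const : ∀ (es : List A) c → 𝔼 es (λ _ → c) ≡ c
    𝔼-const [] c = refl
    𝔼-const (x ∷ xs) c = trans (cong₂ (λ u v → β * u + q * v) (𝔼-const xs c) (𝔼-const xs c))
                            (solve 2 (λ b' c' → b' :* c' :+ (con 1ℚ :- b') :* c' := c') refl β c)

    𝔼-+ : ∀ (es : List A) g h → 𝔼 es (λ F → g F + h F) ≡ 𝔼 es g + 𝔼 es h
    𝔼-+ [] g h = refl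
    𝔼-+ (x ∷ xs) g h = trans (cong₂ (λ u v → β * u + q * v) (𝔼-+ xs _ _) (𝔼-+ xs g h))
       (solve 6 (λ b' q' a1 a2 a3 a4 → b' :* (a1 :+ a2) :+ q' :* (a3 :+ a4) := (b' :* a1 :+ q' :* a3) :+ (b' :* a2 :+ q' :* a4))
          refl β q (𝔼 xs (λ ys → g (x ∷ ys))) (𝔼 xs (λ ys → h (x ∷ ys))) (𝔼 xs g) (𝔼 xs h))

    𝔼-scale : ∀ (es : List A) c g → 𝔼 es (λ F → c * g F) ≡ c * 𝔼 es g
    𝔼-scale [] c g = refl
    𝔼-scale (x ∷ xs) c g = trans (cong₂ (λ u v → β * u + q * v) (𝔼-scale xs c _) (𝔼-scale xs c g))
       (solve 5 (λ b' q' c' a1 a2 → b' :* (c' :* a1) :+ q' :* (c' :* a2) := c' :* (b' :* a1 :+ q' :* a2))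
          refl β q c (𝔼 xs (λ ys → g (x ∷ ys))) (𝔼 xs g))

    𝔼-sub : ∀ (es : List A) g h → 𝔼 es (λ F → g F - h F) ≡ 𝔼 es g - 𝔼 es h
    𝔼-sub es g h = begin
        𝔼 es (λ F → g F - h F)  ≡⟨ 𝔼-cong es (λ F → solve 2 (λ a b' → a :- b' := a :+ con (- 1ℚ) :* b') refl (g F) (h F)) ⟩
        𝔼 es (λ F → g F + (- 1ℚ) * h F)  ≡⟨ 𝔼-+ es g _ ⟩
        𝔼 es g + 𝔼 es (λ F → (- 1ℚ) * h F)  ≡⟨ cong (𝔼 es g +_) (𝔼-scale es (- 1ℚ) h) ⟩
        𝔼 es g + (- 1ℚ) * 𝔼 es h  ≡⟨ solve 2 (λ a b' → a :+ con (- 1ℚ) :* b' := a :- b') refl (𝔼 es g) (𝔼 es h) ⟩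
        𝔼 es g - 𝔼 es h ∎
      where open ≡-Reasoning

    𝔼-sumℚ : ∀ {T : Set} (es : List A) (h : T → List A → ℚ) (L : List T) →
      𝔼 es (λ F → sumℚ (map (λ t → h t F) L)) ≡ sumℚ (map (λ t → 𝔼 es (h t)) L)
    𝔼-sumℚ es h [] = 𝔼-const es 0ℚ
    𝔼-sumℚ es h (t ∷ L) = trans (𝔼-+ es (h t) _) (cong (𝔼 es (h t) +_) (𝔼-sumℚ es h L))

    module Monotone (0≤β : 0ℚ ≤ β) (β≤1 : β ≤ 1ℚ) where
      0≤q : 0ℚ ≤ q
      0≤q = p≤q⇒0≤q-p β 1ℚ β≤1

      𝔼-mono : ∀ (es : List A) {g h : List A → ℚ} → (∀ F → g F ≤ h F) → 𝔼 es g ≤ 𝔼 es h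
      𝔼-mono [] le = le []
      𝔼-mono (x ∷ xs) le = +-mono-≤ (*-monoˡ-≤-nonNeg β {{nonNegative 0≤β}} (𝔼-mono xs (λ ys → le (x ∷ ys))))
                                      (*-monoˡ-≤-nonNeg q {{nonNegative 0≤q}} (𝔼-mono xs le))

  countᵇ-∷ : ∀ {A : Set} (p : A → Bool) x ys → countᵇ p (x ∷ ys) ≡ (if p x then 1 else 0) ℕ.+ countᵇ p ys
  countᵇ-∷ p x ys with p x
  ... | true = refl
  ... | false = refl

  module _ {A : Set} (β : ℚ) where
    𝔼-countᵇ : ∀ (p : A → Bool) (es : List A) → 𝔼 β es (λ F → ℕ→ℚ (countᵇ p F)) ≡ β * ℕ→ℚ (countᵇ p es)
    𝔼-countᵇ p [] = solve 1 (λ b' → con 0ℚ := b' :* con 0ℚ) refl β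
    𝔼-countᵇ p (x ∷ xs) = begin
        β * 𝔼 β xs (λ ys → ℕ→ℚ (countᵇ p (x ∷ ys))) + closedProb β * 𝔼 β xs (λ F → ℕ→ℚ (countᵇ p F))
          ≡⟨ cong₂ (λ u v → β * u + closedProb β * v) step (𝔼-countᵇ p xs) ⟩
        β * (c + β * C) + closedProb β * (β * C)
          ≡⟨ solve 3 (λ b' c' C' → b' :* (c' :+ b' :* C') :+ (con 1ℚ :- b') :* (b' :* C') := b' :* (c' :+ C')) refl β c C ⟩
        β * (c + C)  ≡⟨ cong (β *_) (sym (trans (cong ℕ→ℚ (countᵇ-∷ p x xs)) (ℕ→ℚ-+ (if p x then 1 else 0) (countᵇ p xs)))) ⟩
        β * ℕ→ℚ (countᵇ p (x ∷ xs)) ∎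
      where
      open ≡-Reasoning
      c = ℕ→ℚ (if p x then 1 else 0)
      C = ℕ→ℚ (countᵇ p xs)
      step : 𝔼 β xs (λ ys → ℕ→ℚ (countᵇ p (x ∷ ys))) ≡ c + β * C
      step = begin
        𝔼 β xs (λ ys → ℕ→ℚ (countᵇ p (x ∷ ys)))
          ≡⟨ 𝔼-cong β xs (λ ys → trans (cong ℕ→ℚ (countᵇ-∷ p x ys)) (ℕ→ℚ-+ (if p x then 1 else 0) (countᵇ p ys))) ⟩
        𝔼 β xs (λ ys → c + ℕ→ℚ (countᵇ p ys))  ≡⟨ 𝔼-+ β xs (λ _ → c) _ ⟩
        𝔼 β xs (λ _ → c) + 𝔼 β xs (λ ys → ℕ→ℚ (countᵇ p ys))  ≡⟨ cong₂ _+_ (𝔼-const β xs c) (𝔼-countᵇ p xs) ⟩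
        c + β * C ∎

    𝔼-length : ∀ (es : List A) → 𝔼 β es (λ F → ℕ→ℚ (length F)) ≡ β * ℕ→ℚ (length es)
    𝔼-length [] = solve 1 (λ b' → con 0ℚ := b' :* con 0ℚ) refl β
    𝔼-length (x ∷ xs) = begin
        β * 𝔼 β xs (λ ys → ℕ→ℚ (suc (length ys))) + closedProb β * 𝔼 β xs (λ F → ℕ→ℚ (length F))
          ≡⟨ cong₂ (λ u v → β * u + closedProb β * v) step (𝔼-length xs) ⟩
        β * (1ℚ + β * C) + closedProb β * (β * C)
          ≡⟨ solve 2 (λ b' C' → b' :* (con 1ℚ :+ b' :* C') :+ (con 1ℚ :- b') :* (b' :* C') := b' :* (con 1ℚ :+ C')) refl β C ⟩
        β * (1ℚ + C)  ≡⟨ cong (β *_) (sym (ℕ→ℚ-suc (length xs))) ⟩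
        β * ℕ→ℚ (suc (length xs)) ∎
      where
      open ≡-Reasoning
      C = ℕ→ℚ (length xs)
      step : 𝔼 β xs (λ ys → ℕ→ℚ (suc (length ys))) ≡ 1ℚ + β * C
      step = begin
        𝔼 β xs (λ ys → ℕ→ℚ (suc (length ys)))  ≡⟨ 𝔼-cong β xs (λ ys → ℕ→ℚ-suc (length ys)) ⟩
        𝔼 β xs (λ ys → 1ℚ + ℕ→ℚ (length ys))  ≡⟨ 𝔼-+ β xs (λ _ → 1ℚ) _ ⟩
        𝔼 β xs (λ _ → 1ℚ) + 𝔼 β xs (λ ys → ℕ→ℚ (length ys))  ≡⟨ cong₂ _+_ (𝔼-const β xs 1ℚ) (𝔼-length xs) ⟩
        1ℚ + β * C ∎

  orderedPairs : ℕ → ℕ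
  orderedPairs y = y ℕ.* (y ℕ.∸ 1)

  orderedPairs-suc : ∀ y → orderedPairs (suc y) ≡ orderedPairs y ℕ.+ 2 ℕ.* y
  orderedPairs-suc zero = refl
  orderedPairs-suc (suc z) = solve' z
    where
    open NSo using () renaming (solve to nsolve; _:+_ to _⊕_; _:*_ to _⊗_; con to ncon; _:=_ to _≋_)
    solve' : ∀ z → suc (suc z) ℕ.* suc z ≡ suc z ℕ.* z ℕ.+ 2 ℕ.* suc z
    solve' = nsolve 1 (λ z → (ncon 2 ⊕ z) ⊗ (ncon 1 ⊕ z) ≋ (ncon 1 ⊕ z) ⊗ z ⊕ ncon 2 ⊗ (ncon 1 ⊕ z)) refl

  ℕ→ℚ-orderedPairs-suc : ∀ y → ℕ→ℚ (orderedPairs (suc y)) ≡ ℕ→ℚ (orderedPairs y) + ℕ→ℚ 2 * ℕ→ℚ y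
  ℕ→ℚ-orderedPairs-suc y =
    trans (cong ℕ→ℚ (orderedPairs-suc y)) (trans (ℕ→ℚ-+ (orderedPairs y) (2 ℕ.* y)) (cong (ℕ→ℚ (orderedPairs y) +_) (ℕ→ℚ-* 2 y)))

  module _ {A : Set} (β : ℚ) where
    𝔼-orderedPairs : ∀ (es : List A) → 𝔼 β es (λ F → ℕ→ℚ (orderedPairs (length F))) ≡ β * β * ℕ→ℚ (orderedPairs (length es))
    𝔼-orderedPairs [] = solve 1 (λ b' → con 0ℚ := b' :* b' :* con 0ℚ) refl β
    𝔼-orderedPairs (x ∷ xs) = begin
        β * 𝔼 β xs (λ ys → ℕ→ℚ (orderedPairs (suc (length ys)))) + closedProb β * 𝔼 β xs (λ F → ℕ→ℚ (orderedPairs (length F)))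
          ≡⟨ cong₂ (λ u v → β * u + closedProb β * v) step (𝔼-orderedPairs xs) ⟩
        β * (β * β * P + ℕ→ℚ 2 * (β * M)) + closedProb β * (β * β * P)
          ≡⟨ solve 4 (λ b' P' M' t → b' :* (b' :* b' :* P' :+ t :* (b' :* M')) :+ (con 1ℚ :- b') :* (b' :* b' :* P') := b' :* b' :* (P' :+ t :* M')) refl β P M (ℕ→ℚ 2) ⟩
        β * β * (P + ℕ→ℚ 2 * M)
          ≡⟨ cong (β * β *_) (sym (ℕ→ℚ-orderedPairs-suc (length xs))) ⟩
        β * β * ℕ→ℚ (orderedPairs (suc (length xs))) ∎
      where
      open ≡-Reasoning
      P = ℕ→ℚ (orderedPairs (length xs))
      M = ℕ→ℚ (length xs)
      step : 𝔼 β xs (λ ys → ℕ→ℚ (orderedPairs (suc (length ys)))) ≡ β * β * P + ℕ→ℚ 2 * (β * M)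
      step = begin
        𝔼 β xs (λ ys → ℕ→ℚ (orderedPairs (suc (length ys))))
          ≡⟨ 𝔼-cong β xs (λ ys → ℕ→ℚ-orderedPairs-suc (length ys)) ⟩
        𝔼 β xs (λ ys → ℕ→ℚ (orderedPairs (length ys)) + ℕ→ℚ 2 * ℕ→ℚ (length ys))  ≡⟨ 𝔼-+ β xs _ _ ⟩
        𝔼 β xs (λ ys → ℕ→ℚ (orderedPairs (length ys))) + 𝔼 β xs (λ ys → ℕ→ℚ 2 * ℕ→ℚ (length ys))
          ≡⟨ cong₂ _+_ (𝔼-orderedPairs xs) (trans (𝔼-scale β xs (ℕ→ℚ 2) _) (cong (ℕ→ℚ 2 *_) (𝔼-length β xs))) ⟩
        β * β * P + ℕ→ℚ 2 * (β * M) ∎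

    𝔼-noneKept : ∀ (p : A → Bool) (es : List A) → 𝔼 β es (λ F → boolToℚ (not (any p F))) ≡ closedProb β ^ℚ countᵇ p es
    𝔼-noneKept p [] = refl
    𝔼-noneKept p (x ∷ xs) with p x
    ... | true = trans (cong₂ (λ u v → β * u + closedProb β * v) (𝔼-const β xs 0ℚ) (𝔼-noneKept p xs))
                       (solve 2 (λ b' z → b' :* con 0ℚ :+ (con 1ℚ :- b') :* z := (con 1ℚ :- b') :* z) refl β (closedProb β ^ℚ countᵇ p xs))
    ... | false = trans (cong₂ (λ u v → β * u + closedProb β * v) (𝔼-noneKept p xs) (𝔼-noneKept p xs))
                       (solve 2 (λ b' z → b' :* z :+ (con 1ℚ :- b') :* z := z) refl β (closedProb β ^ℚ countᵇ p xs))


module NatSums where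

  open import Data.Nat as ℕ using (ℕ; zero; suc; _+_; _*_; _≤_)
  import Data.Nat.Properties as ℕP
  open import Algebra.Properties.CommutativeSemigroup ℕP.+-commutativeSemigroup using () renaming (interchange to +-interchange)
  open import Data.Nat.ListAction using (sum)
  import Data.Fin as Fin
  open Fin using (Fin)
  open import Data.List using (List; []; _∷_; map; length; allFin; concatMap; _++_)
  import Data.List.Properties as LP
  open import Data.List.Relation.Unary.All using (All; []; _∷_)
  open import Data.List.Membership.Propositional using (_∈_)
  open import Data.List.Relation.Unary.Any using (here; there)
  open import Data.Bool using (Bool; true; false)
  open import Relation.Binary.PropositionalEquality
  import Data.Rational as Q
  open import Defs using (ℕ→ℚ; sumℚ)
  open NatCast

  lsum : ∀ {X : Set} → List X → (X → ℕ) → ℕ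
  lsum L f = sum (map f L)

  ΣF : ∀ {n} → (Fin n → ℕ) → ℕ
  ΣF {n} f = lsum (allFin n) f

  boolToℕ : Bool → ℕ
  boolToℕ true = 1
  boolToℕ false = 0

  lsum-+ : ∀ {X : Set} (L : List X) f g → lsum L (λ x → f x + g x) ≡ lsum L f + lsum L g
  lsum-+ [] f g = refl
  lsum-+ (x ∷ L) f g = trans (cong (f x + g x +_) (lsum-+ L f g)) (+-interchange (f x) (g x) (lsum L f) (lsum L g))

  lsum-cong : ∀ {X : Set} (L : List X) {f g} → (∀ x → f x ≡ g x) → lsum L f ≡ lsum L g
  lsum-cong [] e = refl
  lsum-cong (x ∷ L) e = cong₂ _+_ (e x) (lsum-cong L e)

  lsum-cong-All : ∀ {X : Set} (L : List X) {f g} → All (λ x → f x ≡ g x) L → lsum L f ≡ lsum L g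
  lsum-cong-All [] [] = refl
  lsum-cong-All (x ∷ L) (e ∷ es) = cong₂ _+_ e (lsum-cong-All L es)

  lsum-mono : ∀ {X : Set} (L : List X) {f g} → (∀ x → f x ≤ g x) → lsum L f ≤ lsum L g
  lsum-mono [] e = ℕ.z≤n
  lsum-mono (x ∷ L) e = ℕP.+-mono-≤ (e x) (lsum-mono L e)

  lsum-mono-All : ∀ {X : Set} (L : List X) {f g} → All (λ x → f x ≤ g x) L → lsum L f ≤ lsum L g
  lsum-mono-All [] [] = ℕ.z≤n
  lsum-mono-All (x ∷ L) (e ∷ es) = ℕP.+-mono-≤ e (lsum-mono-All L es)

  lsum-const : ∀ {X : Set} (L : List X) c → lsum L (λ _ → c) ≡ length L * c
  lsum-const [] c = refl
  lsum-const (x ∷ L) c = cong (c +_) (lsum-const L c)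

  lsum-scale : ∀ {X : Set} (L : List X) c f → lsum L (λ x → c * f x) ≡ c * lsum L f
  lsum-scale [] c f = sym (ℕP.*-zeroʳ c)
  lsum-scale (x ∷ L) c f = trans (cong (c * f x +_) (lsum-scale L c f)) (sym (ℕP.*-distribˡ-+ c (f x) (lsum L f)))

  lsum-swap : ∀ {X Y : Set} (L : List X) (M : List Y) (f : X → Y → ℕ) → lsum L (λ x → lsum M (λ y → f x y)) ≡ lsum M (λ y → lsum L (λ x → f x y))
  lsum-swap [] M f = sym (trans (lsum-const M 0) (ℕP.*-zeroʳ (length M)))
  lsum-swap (x ∷ L) M f = trans (cong (lsum M (f x) +_) (lsum-swap L M f)) (sym (lsum-+ M (f x) (λ y → lsum L (λ x' → f x' y))))

  lsum-++ : ∀ {X : Set} (L M : List X) f → lsum (L ++ M) f ≡ lsum L f + lsum M f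
  lsum-++ [] M f = refl
  lsum-++ (x ∷ L) M f = trans (cong (f x +_) (lsum-++ L M f)) (sym (ℕP.+-assoc (f x) (lsum L f) (lsum M f)))

  lsum-concatMap : ∀ {X Y : Set} (g : X → List Y) (L : List X) f → lsum (concatMap g L) f ≡ lsum L (λ x → lsum (g x) f)
  lsum-concatMap g [] f = refl
  lsum-concatMap g (x ∷ L) f = trans (lsum-++ (g x) (concatMap g L) f) (cong (lsum (g x) f +_) (lsum-concatMap g L f))

  lsum-map : ∀ {X Y : Set} (g : X → Y) (L : List X) f → lsum (map g L) f ≡ lsum L (λ x → f (g x))
  lsum-map g [] f = refl
  lsum-map g (x ∷ L) f = cong (f (g x) +_) (lsum-map g L f)

  ∈⇒≤lsum : ∀ {X : Set} (L : List X) f {x} → x ∈ L → f x ≤ lsum L f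
  ∈⇒≤lsum (y ∷ L) f (here refl) = ℕP.m≤m+n (f y) (lsum L f)
  ∈⇒≤lsum (y ∷ L) f (there p) = ℕP.≤-trans (∈⇒≤lsum L f p) (ℕP.m≤n+m (lsum L f) (f y))

  ΣF-suc : ∀ {n} (f : Fin (suc n) → ℕ) → ΣF f ≡ f Fin.zero + ΣF (λ i → f (Fin.suc i))
  ΣF-suc {n} f = cong (f Fin.zero +_) (cong sum (trans (LP.map-tabulate Fin.suc f) (sym (LP.map-tabulate (λ i → i) (λ i → f (Fin.suc i))))))

  ℕ→ℚ-lsum : ∀ {X : Set} (L : List X) f → ℕ→ℚ (lsum L f) ≡ sumℚ (map (λ x → ℕ→ℚ (f x)) L)
  ℕ→ℚ-lsum [] f = refl
  ℕ→ℚ-lsum (x ∷ L) f = trans (ℕ→ℚ-+ (f x) (lsum L f)) (cong (ℕ→ℚ (f x) Q.+_) (ℕ→ℚ-lsum L f))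


module FractionArithmetic where

  open import Data.Nat as ℕ using (ℕ; suc)
  open import Data.Rational
  open import Data.Rational.Properties
  open import Data.Rational.Solver using (module +-*-Solver)
  open import Relation.Binary.PropositionalEquality
  open import Defs using (ℕ→ℚ; frac)
  open NatCast
  open +-*-Solver

  pos*pos : ∀ {x y} → 0ℚ < x → 0ℚ < y → 0ℚ < x * y
  pos*pos {x} {y} hx hy = positive⁻¹ (x * y) {{pos*pos⇒pos x {{positive hx}} y {{positive hy}}}}

  nonNeg*nonNeg : ∀ {x y} → 0ℚ ≤ x → 0ℚ ≤ y → 0ℚ ≤ x * y
  nonNeg*nonNeg {x} {y} hx hy = nonNegative⁻¹ (x * y) {{nonNeg*nonNeg⇒nonNeg x {{nonNegative hx}} y {{nonNegative hy}}}}

  *-mono-<-pos : ∀ P {x y} → 0ℚ < P → x < y → x * P < y * P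
  *-mono-<-pos P hP h = *-monoˡ-<-pos P {{positive hP}} h

  *-cancel-<-pos : ∀ P {x y} → 0ℚ < P → x * P < y * P → x < y
  *-cancel-<-pos P hP h = *-cancelʳ-<-nonNeg P {{pos⇒nonNeg P {{positive hP}}}} h

  *-monoˡ-≤-nonNeg′ : ∀ P {x y} → 0ℚ ≤ P → x ≤ y → x * P ≤ y * P
  *-monoˡ-≤-nonNeg′ P hP h = *-monoʳ-≤-nonNeg P {{nonNegative hP}} h

  frac-cross : ∀ a b c d → 0 ℕ.< b → 0 ℕ.< d → frac a b < frac c d → a ℕ.* d ℕ.< c ℕ.* b
  frac-cross a (suc b) c (suc d) _ _ h = ℕ→ℚ-cancel-< (subst₂ _<_ e1 e2 (*-mono-<-pos P (ℕ→ℚ-mono-< {0} {suc b ℕ.* suc d} (ℕ.s≤s ℕ.z≤n)) h))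
    where
    P = ℕ→ℚ (suc b ℕ.* suc d)
    e1 : frac a (suc b) * P ≡ ℕ→ℚ (a ℕ.* suc d)
    e1 = begin
      frac a (suc b) * P  ≡⟨ cong (frac a (suc b) *_) (ℕ→ℚ-* (suc b) (suc d)) ⟩
      frac a (suc b) * (ℕ→ℚ (suc b) * ℕ→ℚ (suc d))  ≡⟨ sym (*-assoc (frac a (suc b)) (ℕ→ℚ (suc b)) (ℕ→ℚ (suc d))) ⟩
      (frac a (suc b) * ℕ→ℚ (suc b)) * ℕ→ℚ (suc d)  ≡⟨ cong (_* ℕ→ℚ (suc d)) (frac*denominator a b) ⟩
      ℕ→ℚ a * ℕ→ℚ (suc d)  ≡⟨ sym (ℕ→ℚ-* a (suc d)) ⟩
      ℕ→ℚ (a ℕ.* suc d) ∎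
      where open ≡-Reasoning
    e2 : frac c (suc d) * P ≡ ℕ→ℚ (c ℕ.* suc b)
    e2 = begin
      frac c (suc d) * P  ≡⟨ cong (frac c (suc d) *_) (trans (ℕ→ℚ-* (suc b) (suc d)) (*-comm (ℕ→ℚ (suc b)) (ℕ→ℚ (suc d)))) ⟩
      frac c (suc d) * (ℕ→ℚ (suc d) * ℕ→ℚ (suc b))  ≡⟨ sym (*-assoc (frac c (suc d)) (ℕ→ℚ (suc d)) (ℕ→ℚ (suc b))) ⟩
      (frac c (suc d) * ℕ→ℚ (suc d)) * ℕ→ℚ (suc b)  ≡⟨ cong (_* ℕ→ℚ (suc b)) (frac*denominator c d) ⟩
      ℕ→ℚ c * ℕ→ℚ (suc b)  ≡⟨ sym (ℕ→ℚ-* c (suc b)) ⟩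
      ℕ→ℚ (c ℕ.* suc b) ∎
      where open ≡-Reasoning

  frac*frac-cross : ∀ a b c d e f g h → 0 ℕ.< b → 0 ℕ.< d → 0 ℕ.< f → 0 ℕ.< h →
    frac a b * frac c d < frac e f * frac g h → a ℕ.* c ℕ.* (f ℕ.* h) ℕ.< e ℕ.* g ℕ.* (b ℕ.* d)
  frac*frac-cross a (suc b) c (suc d) e (suc f) g (suc h) _ _ _ _ lt =
    ℕ→ℚ-cancel-< (subst₂ _<_ eL eR (*-mono-<-pos P (pos*pos (ℕ→ℚ-mono-< {0} {suc b ℕ.* suc d} (ℕ.s≤s ℕ.z≤n))
                                                           (ℕ→ℚ-mono-< {0} {suc f ℕ.* suc h} (ℕ.s≤s ℕ.z≤n))) lt))
    where
    Pl = ℕ→ℚ (suc b ℕ.* suc d)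
    Pr = ℕ→ℚ (suc f ℕ.* suc h)
    P = Pl * Pr
    X = frac a (suc b) ; Y = frac c (suc d) ; Z = frac e (suc f) ; T = frac g (suc h)
    B = ℕ→ℚ (suc b) ; D = ℕ→ℚ (suc d) ; F = ℕ→ℚ (suc f) ; H = ℕ→ℚ (suc h)
    eL : X * Y * P ≡ ℕ→ℚ (a ℕ.* c ℕ.* (suc f ℕ.* suc h))
    eL = begin
      X * Y * (Pl * Pr)  ≡⟨ cong₂ (λ u v → X * Y * (u * v)) (ℕ→ℚ-* (suc b) (suc d)) (ℕ→ℚ-* (suc f) (suc h)) ⟩
      X * Y * ((B * D) * (F * H))  ≡⟨ solve 8 (λ x y z t b' d' f' h' → x :* y :* ((b' :* d') :* (f' :* h')) := (x :* b') :* (y :* d') :* (f' :* h')) refl X Y Z T B D F H ⟩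
      (X * B) * (Y * D) * (F * H)  ≡⟨ cong₂ (λ u v → u * v * (F * H)) (frac*denominator a b) (frac*denominator c d) ⟩
      ℕ→ℚ a * ℕ→ℚ c * (F * H)  ≡⟨ cong₂ (λ u v → u * v) (sym (ℕ→ℚ-* a c)) (sym (ℕ→ℚ-* (suc f) (suc h))) ⟩
      ℕ→ℚ (a ℕ.* c) * ℕ→ℚ (suc f ℕ.* suc h)  ≡⟨ sym (ℕ→ℚ-* (a ℕ.* c) (suc f ℕ.* suc h)) ⟩
      ℕ→ℚ (a ℕ.* c ℕ.* (suc f ℕ.* suc h)) ∎
      where open ≡-Reasoning
    eR : Z * T * P ≡ ℕ→ℚ (e ℕ.* g ℕ.* (suc b ℕ.* suc d))
    eR = begin
      Z * T * (Pl * Pr)  ≡⟨ cong₂ (λ u v → Z * T * (u * v)) (ℕ→ℚ-* (suc b) (suc d)) (ℕ→ℚ-* (suc f) (suc h)) ⟩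
      Z * T * ((B * D) * (F * H))  ≡⟨ solve 8 (λ x y z t b' d' f' h' → z :* t :* ((b' :* d') :* (f' :* h')) := (z :* f') :* (t :* h') :* (b' :* d')) refl X Y Z T B D F H ⟩
      (Z * F) * (T * H) * (B * D)  ≡⟨ cong₂ (λ u v → u * v * (B * D)) (frac*denominator e f) (frac*denominator g h) ⟩
      ℕ→ℚ e * ℕ→ℚ g * (B * D)  ≡⟨ cong₂ (λ u v → u * v) (sym (ℕ→ℚ-* e g)) (sym (ℕ→ℚ-* (suc b) (suc d))) ⟩
      ℕ→ℚ (e ℕ.* g) * ℕ→ℚ (suc b ℕ.* suc d)  ≡⟨ sym (ℕ→ℚ-* (e ℕ.* g) (suc b ℕ.* suc d)) ⟩
      ℕ→ℚ (e ℕ.* g ℕ.* (suc b ℕ.* suc d)) ∎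
      where open ≡-Reasoning


module MeansAndGaps where

  open import Data.Nat as ℕ using (ℕ; zero; suc; z≤n; s≤s) renaming (_≤_ to _≤ₙ_; _<_ to _<ₙ_; _+_ to _+ₙ_; _*_ to _*ₙ_)
  import Data.Nat.Properties as ℕP
  open import Data.Product using (_,_; _×_; ∃)
  open import Data.List using (List; []; _∷_; map; length)
  import Data.List.Properties as LP
  open import Data.List.Relation.Unary.All using (All; []; _∷_)
  open import Data.Rational
  open import Data.Rational.Properties
  open import Data.Rational.Solver using (module +-*-Solver)
  open import Relation.Binary.PropositionalEquality
  open import Defs using (ℕ→ℚ; frac; _^ℚ_; mean; sumℚ)
  open NatCast
  open Percolation using (closedProb)
  open NatSums using (lsum; ℕ→ℚ-lsum)
  open FractionArithmetic
  open +-*-Solver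

  ℕ→ℚ-*³ : ∀ a b c → ℕ→ℚ (a *ₙ b *ₙ c) ≡ ℕ→ℚ a * ℕ→ℚ b * ℕ→ℚ c
  ℕ→ℚ-*³ a b c = trans (ℕ→ℚ-* (a *ₙ b) c) (cong (_* ℕ→ℚ c) (ℕ→ℚ-* a b))

  ℕ→ℚ-*⁴ : ∀ a b c d → ℕ→ℚ (a *ₙ b *ₙ c *ₙ d) ≡ ℕ→ℚ a * ℕ→ℚ b * ℕ→ℚ c * ℕ→ℚ d
  ℕ→ℚ-*⁴ a b c d = trans (ℕ→ℚ-* (a *ₙ b *ₙ c) d) (cong (_* ℕ→ℚ d) (ℕ→ℚ-*³ a b c))

  closedProb-involutive : ∀ x → closedProb (1ℚ - x) ≡ x
  closedProb-involutive x = solve 1 (λ z → con 1ℚ :- (con 1ℚ :- z) := z) refl x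

  ^ℚ-pos : ∀ x d → 0ℚ < x → 0ℚ < x ^ℚ d
  ^ℚ-pos x zero h = 0<1
  ^ℚ-pos x (suc d) h = pos*pos h (^ℚ-pos x d h)

  1/suc-pos : ∀ N → 0ℚ < frac 1 (suc N)
  1/suc-pos N = positive⁻¹ (frac 1 (suc N)) {{normalize-pos 1 (suc N)}}

  1/suc*suc : ∀ N → frac 1 (suc N) * ℕ→ℚ (suc N) ≡ 1ℚ
  1/suc*suc N = frac*denominator 1 N

  1/suc∈01 : ∀ N → 1 ≤ₙ N → 0ℚ < frac 1 (suc N) × frac 1 (suc N) < 1ℚ
  1/suc∈01 N 1≤N = 1/suc-pos N , *-cancel-<-pos (ℕ→ℚ (suc N)) (ℕ→ℚ-suc-pos N)
     (subst₂ _<_ (sym (1/suc*suc N)) (sym (*-identityˡ (ℕ→ℚ (suc N)))) (ℕ→ℚ-mono-< {1} {suc N} (s≤s 1≤N)))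

  ∃-scaled-gap : ∀ (a b c : ℕ) → a <ₙ b → ∃ λ N → a *ₙ suc N +ₙ c <ₙ b *ₙ suc N × 1 ≤ₙ N
  ∃-scaled-gap a b c a<b = suc c , lt , s≤s z≤n
    where
    N = suc c
    lt : a *ₙ suc N +ₙ c <ₙ b *ₙ suc N
    lt = ℕP.<-≤-trans (ℕP.+-monoʳ-< (a *ₙ suc N) (ℕP.≤-trans (ℕP.n<1+n c) (ℕP.n≤1+n (suc c))))
           (ℕP.≤-trans (ℕP.≤-reflexive (ℕP.+-comm (a *ₙ suc N) (suc N))) (ℕP.*-monoˡ-≤ (suc N) a<b))

  pos-cancelʳ : ∀ D X → 0ℚ < X → 0ℚ < D * X → 0ℚ < D
  pos-cancelʳ D X hX h = *-cancel-<-pos X hX (subst (_< D * X) (sym (*-zeroˡ X)) h)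

  smallβ-bounds-separate : ∀ (k n M SC SV NC NV N : ℕ) → SV *ₙ suc NC *ₙ suc N +ₙ suc n *ₙ M *ₙ suc NC *ₙ suc NV <ₙ SC *ₙ suc NV *ₙ suc N →
         (ℕ→ℚ k + ℕ→ℚ n * (frac 1 (suc N) * frac 1 (suc N) * ℕ→ℚ M)) + frac 1 (suc N) * (ℕ→ℚ SV * frac 1 (suc NV))
           < (ℕ→ℚ k - frac 1 (suc N) * frac 1 (suc N) * ℕ→ℚ M) + frac 1 (suc N) * (ℕ→ℚ SC * frac 1 (suc NC))
  smallβ-bounds-separate k n M SC SV NC NV N hyp = 0<q-p⇒p<q L R (pos-cancelʳ D X Xpos DXpos)
    where
    β = frac 1 (suc N) ; u = frac 1 (suc NV) ; v = frac 1 (suc NC)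
    K = ℕ→ℚ k ; nq = ℕ→ℚ n ; Mq = ℕ→ℚ M ; SCq = ℕ→ℚ SC ; SVq = ℕ→ℚ SV
    Nq = ℕ→ℚ (suc N) ; Cq = ℕ→ℚ (suc NC) ; Vq = ℕ→ℚ (suc NV)
    L = (K + nq * (β * β * Mq)) + β * (SVq * u)
    R = (K - β * β * Mq) + β * (SCq * v)
    D = R - L
    X = Nq * Nq * Cq * Vq
    Xpos : 0ℚ < X
    Xpos = pos*pos (pos*pos (pos*pos (ℕ→ℚ-suc-pos N) (ℕ→ℚ-suc-pos N)) (ℕ→ℚ-suc-pos NC)) (ℕ→ℚ-suc-pos NV)
    F : ℚ → ℚ → ℚ → ℚ
    F a b c = a * b * SCq * Vq * Nq - (a * c * SVq * Cq * Nq + a * a * Mq * Cq * Vq + nq * (a * a) * Mq * Cq * Vq)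
    e1 : D * X ≡ F (β * Nq) (v * Cq) (u * Vq)
    e1 = solve 11 (λ β' u' v' N' C' V' sc sv m nn kk →
          ((kk :- β' :* β' :* m) :+ β' :* (sc :* v') :- ((kk :+ nn :* (β' :* β' :* m)) :+ β' :* (sv :* u'))) :* (N' :* N' :* C' :* V')
          := (β' :* N') :* (v' :* C') :* sc :* V' :* N' :- ((β' :* N') :* (u' :* V') :* sv :* C' :* N' :+ (β' :* N') :* (β' :* N') :* m :* C' :* V' :+ nn :* ((β' :* N') :* (β' :* N')) :* m :* C' :* V'))
          refl β u v Nq Cq Vq SCq SVq Mq nq K
    e2 : F (β * Nq) (v * Cq) (u * Vq) ≡ F 1ℚ 1ℚ 1ℚ
    e2 = trans (cong₂ (λ a b → F a b (u * Vq)) (1/suc*suc N) (1/suc*suc NC)) (cong (F 1ℚ 1ℚ) (1/suc*suc NV))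
    e3 : F 1ℚ 1ℚ 1ℚ ≡ ℕ→ℚ (SC *ₙ suc NV *ₙ suc N) - ℕ→ℚ (SV *ₙ suc NC *ₙ suc N +ₙ suc n *ₙ M *ₙ suc NC *ₙ suc NV)
    e3 = trans (solve 7 (λ sc sv m nn N' C' V' →
                con 1ℚ :* con 1ℚ :* sc :* V' :* N' :- (con 1ℚ :* con 1ℚ :* sv :* C' :* N' :+ con 1ℚ :* con 1ℚ :* m :* C' :* V' :+ nn :* (con 1ℚ :* con 1ℚ) :* m :* C' :* V')
                := sc :* V' :* N' :- (sv :* C' :* N' :+ (con 1ℚ :+ nn) :* m :* C' :* V')) refl SCq SVq Mq nq Nq Cq Vq)
           (sym (cong₂ _-_ (ℕ→ℚ-*³ SC (suc NV) (suc N))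
                   (trans (ℕ→ℚ-+ (SV *ₙ suc NC *ₙ suc N) (suc n *ₙ M *ₙ suc NC *ₙ suc NV))
                      (cong₂ _+_ (ℕ→ℚ-*³ SV (suc NC) (suc N)) (trans (ℕ→ℚ-*⁴ (suc n) M (suc NC) (suc NV)) (cong (λ z → z * Mq * Cq * Vq) (ℕ→ℚ-suc n)))))))
    DXpos : 0ℚ < D * X
    DXpos = subst (0ℚ <_) (sym (trans e1 (trans e2 e3))) (p<q⇒0<q-p _ _ (ℕ→ℚ-mono-< hyp))

  largeβ-bounds-separate : ∀ (n SC SV NC NV N P : ℕ) (Qd : ℚ) → 0ℚ < Qd →
         SV *ₙ suc NC *ₙ suc N +ₙ n *ₙ P *ₙ suc NC *ₙ suc NV <ₙ SC *ₙ suc NV *ₙ suc N →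
         ℕ→ℚ n + (- Qd) * (ℕ→ℚ SC * frac 1 (suc NC))
           < (ℕ→ℚ n - ℕ→ℚ n * (ℕ→ℚ P * (frac 1 (suc N) * Qd))) + (- Qd) * (ℕ→ℚ SV * frac 1 (suc NV))
  largeβ-bounds-separate n SC SV NC NV N P Qd Qpos hyp = 0<q-p⇒p<q L R (pos-cancelʳ D X Xpos DXpos)
    where
    q = frac 1 (suc N) ; u = frac 1 (suc NV) ; v = frac 1 (suc NC)
    nq = ℕ→ℚ n ; Pq = ℕ→ℚ P ; SCq = ℕ→ℚ SC ; SVq = ℕ→ℚ SV
    Nq = ℕ→ℚ (suc N) ; Cq = ℕ→ℚ (suc NC) ; Vq = ℕ→ℚ (suc NV)
    L = nq + (- Qd) * (SCq * v)
    R = (nq - nq * (Pq * (q * Qd))) + (- Qd) * (SVq * u)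
    D = R - L
    X = Nq * Cq * Vq
    Xpos : 0ℚ < X
    Xpos = pos*pos (pos*pos (ℕ→ℚ-suc-pos N) (ℕ→ℚ-suc-pos NC)) (ℕ→ℚ-suc-pos NV)
    F : ℚ → ℚ → ℚ → ℚ
    F a b c = Qd * (b * SCq * Vq * Nq - (c * SVq * Cq * Nq + a * nq * Pq * Cq * Vq))
    e1 : D * X ≡ F (q * Nq) (v * Cq) (u * Vq)
    e1 = solve 11 (λ q' u' v' N' C' V' sc sv p nn qd →
          (((nn :- nn :* (p :* (q' :* qd))) :+ (:- qd) :* (sv :* u')) :- (nn :+ (:- qd) :* (sc :* v'))) :* (N' :* C' :* V')
          := qd :* ((v' :* C') :* sc :* V' :* N' :- ((u' :* V') :* sv :* C' :* N' :+ (q' :* N') :* nn :* p :* C' :* V')))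
          refl q u v Nq Cq Vq SCq SVq Pq nq Qd
    e2 : F (q * Nq) (v * Cq) (u * Vq) ≡ F 1ℚ 1ℚ 1ℚ
    e2 = trans (cong₂ (λ a b → F a b (u * Vq)) (1/suc*suc N) (1/suc*suc NC)) (cong (F 1ℚ 1ℚ) (1/suc*suc NV))
    e3 : F 1ℚ 1ℚ 1ℚ ≡ Qd * (ℕ→ℚ (SC *ₙ suc NV *ₙ suc N) - ℕ→ℚ (SV *ₙ suc NC *ₙ suc N +ₙ n *ₙ P *ₙ suc NC *ₙ suc NV))
    e3 = trans (solve 8 (λ qd sc sv p nn N' C' V' →
                qd :* (con 1ℚ :* sc :* V' :* N' :- (con 1ℚ :* sv :* C' :* N' :+ con 1ℚ :* nn :* p :* C' :* V'))
                := qd :* (sc :* V' :* N' :- (sv :* C' :* N' :+ nn :* p :* C' :* V'))) refl Qd SCq SVq Pq nq Nq Cq Vq)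
           (sym (cong (Qd *_) (cong₂ _-_ (ℕ→ℚ-*³ SC (suc NV) (suc N))
                   (trans (ℕ→ℚ-+ (SV *ₙ suc NC *ₙ suc N) (n *ₙ P *ₙ suc NC *ₙ suc NV))
                      (cong₂ _+_ (ℕ→ℚ-*³ SV (suc NC) (suc N)) (ℕ→ℚ-*⁴ n P (suc NC) (suc NV)))))))
    DXpos : 0ℚ < D * X
    DXpos = subst (0ℚ <_) (sym (trans e1 (trans e2 e3))) (pos*pos Qpos (p<q⇒0<q-p _ _ (ℕ→ℚ-mono-< hyp)))

  sumℚ-mono-All : ∀ {X : Set} (L : List X) (lo f : X → ℚ) → All (λ x → lo x ≤ f x) L → sumℚ (map lo L) ≤ sumℚ (map f L)
  sumℚ-mono-All [] lo f [] = ≤-refl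
  sumℚ-mono-All (x ∷ L) lo f (h ∷ hs) = +-mono-≤ h (sumℚ-mono-All L lo f hs)

  mean-map : ∀ {X : Set} (f : X → ℚ) x xs → mean (map f (x ∷ xs)) ≡ sumℚ (map f (x ∷ xs)) * frac 1 (suc (length xs))
  mean-map f x xs = cong (λ z → sumℚ (map f (x ∷ xs)) * frac 1 (suc z)) (LP.length-map f xs)

  mean-mono-All : ∀ {X : Set} (L : List X) (lo f : X → ℚ) → All (λ x → lo x ≤ f x) L → mean (map lo L) ≤ mean (map f L)
  mean-mono-All [] lo f [] = ≤-refl
  mean-mono-All (x ∷ xs) lo f hs = subst₂ _≤_ (sym (mean-map lo x xs)) (sym (mean-map f x xs))
     (*-monoˡ-≤-nonNeg′ (frac 1 (suc (length xs))) (<⇒≤ (1/suc-pos (length xs))) (sumℚ-mono-All (x ∷ xs) lo f hs))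

  sumℚ-affine : ∀ {X : Set} (L : List X) a b (g : X → ℕ) → sumℚ (map (λ x → a + b * ℕ→ℚ (g x)) L) ≡ ℕ→ℚ (length L) * a + b * ℕ→ℚ (lsum L g)
  sumℚ-affine [] a b g = solve 2 (λ a' b' → con 0ℚ := con 0ℚ :* a' :+ b' :* con 0ℚ) refl a b
  sumℚ-affine (x ∷ L) a b g = begin
      (a + b * ℕ→ℚ (g x)) + sumℚ (map (λ x → a + b * ℕ→ℚ (g x)) L)
        ≡⟨ cong ((a + b * ℕ→ℚ (g x)) +_) (sumℚ-affine L a b g) ⟩
      (a + b * ℕ→ℚ (g x)) + (ℕ→ℚ (length L) * a + b * ℕ→ℚ (lsum L g))
        ≡⟨ solve 5 (λ a' b' gx l s → (a' :+ b' :* gx) :+ (l :* a' :+ b' :* s) := (con 1ℚ :+ l) :* a' :+ b' :* (gx :+ s)) refl a b (ℕ→ℚ (g x)) (ℕ→ℚ (length L)) (ℕ→ℚ (lsum L g)) ⟩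
      (1ℚ + ℕ→ℚ (length L)) * a + b * (ℕ→ℚ (g x) + ℕ→ℚ (lsum L g))
        ≡⟨ cong₂ (λ u w → u * a + b * w) (sym (ℕ→ℚ-suc (length L))) (sym (ℕ→ℚ-+ (g x) (lsum L g))) ⟩
      ℕ→ℚ (suc (length L)) * a + b * ℕ→ℚ (g x +ₙ lsum L g) ∎
    where open ≡-Reasoning

  mean-affine : ∀ {X : Set} (x : X) xs a b (g : X → ℕ) →
         mean (map (λ y → a + b * ℕ→ℚ (g y)) (x ∷ xs)) ≡ a + b * (ℕ→ℚ (lsum (x ∷ xs) g) * frac 1 (suc (length xs)))
  mean-affine x xs a b g = begin
      mean (map (λ x → a + b * ℕ→ℚ (g x)) (x ∷ xs))
        ≡⟨ mean-map (λ x → a + b * ℕ→ℚ (g x)) x xs ⟩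
      sumℚ (map (λ x → a + b * ℕ→ℚ (g x)) (x ∷ xs)) * w
        ≡⟨ cong (_* w) (sumℚ-affine (x ∷ xs) a b g) ⟩
      (Nl * a + b * T) * w
        ≡⟨ solve 5 (λ nl a' b' t w' → (nl :* a' :+ b' :* t) :* w' := a' :* (w' :* nl) :+ b' :* (t :* w')) refl Nl a b T w ⟩
      a * (w * Nl) + b * (T * w)
        ≡⟨ cong (λ z → a * z + b * (T * w)) (1/suc*suc (length xs)) ⟩
      a * 1ℚ + b * (T * w)
        ≡⟨ cong (_+ b * (T * w)) (*-identityʳ a) ⟩
      a + b * (T * w) ∎
    where
    open ≡-Reasoning
    w = frac 1 (suc (length xs))
    Nl = ℕ→ℚ (suc (length xs))
    T = ℕ→ℚ (lsum (x ∷ xs) g)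

  mean-≤-affine : ∀ {X : Set} (x : X) xs (f : X → ℚ) a b (g : X → ℕ) →
    All (λ y → f y ≤ a + b * ℕ→ℚ (g y)) (x ∷ xs) →
    mean (map f (x ∷ xs)) ≤ a + b * (ℕ→ℚ (lsum (x ∷ xs) g) * frac 1 (suc (length xs)))
  mean-≤-affine x xs f a b g h = ≤-trans (mean-mono-All (x ∷ xs) f _ h) (≤-reflexive (mean-affine x xs a b g))

  mean-≥-affine : ∀ {X : Set} (x : X) xs (f : X → ℚ) a b (g : X → ℕ) →
    All (λ y → a + b * ℕ→ℚ (g y) ≤ f y) (x ∷ xs) →
    a + b * (ℕ→ℚ (lsum (x ∷ xs) g) * frac 1 (suc (length xs))) ≤ mean (map f (x ∷ xs))
  mean-≥-affine x xs f a b g h = ≤-trans (≤-reflexive (sym (mean-affine x xs a b g))) (mean-mono-All (x ∷ xs) _ f h)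


module Binomial where

  open import Data.Nat as ℕ using (ℕ; zero; suc; _+_; _*_; _∸_; _≤_; _<_; z≤n; s≤s)
  import Data.Nat.Properties as ℕP
  open import Data.Product using (_,_)
  open import Relation.Binary.PropositionalEquality
  open import Data.Sum using (inj₁; inj₂)
  import Data.Nat.Solver as NS
  open NS.+-*-Solver

  binom : ℕ → ℕ → ℕ
  binom n zero = 1
  binom zero (suc k) = 0
  binom (suc n) (suc k) = binom n k + binom n (suc k)

  binom-< : ∀ n k → n < k → binom n k ≡ 0
  binom-< zero (suc k) _ = refl
  binom-< (suc n) (suc k) (s≤s lt) = cong₂ _+_ (binom-< n k lt) (binom-< n (suc k) (ℕP.m≤n⇒m≤1+n lt))

  binom-pos : ∀ n k → k ≤ n → 0 < binom n k
  binom-pos n zero _ = s≤s z≤n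
  binom-pos (suc n) (suc k) (s≤s le) = ℕP.<-≤-trans (binom-pos n k le) (ℕP.m≤m+n (binom n k) (binom n (suc k)))

  binom-absorption : ∀ n k → binom (suc n) (suc k) * suc k ≡ suc n * binom n k
  binom-absorption zero zero = refl
  binom-absorption zero (suc k) = refl
  binom-absorption (suc m) k = begin
      (binom (suc m) k + binom (suc m) (suc k)) * suc k
        ≡⟨ ℕP.*-distribʳ-+ (suc k) (binom (suc m) k) (binom (suc m) (suc k)) ⟩
      binom (suc m) k * suc k + binom (suc m) (suc k) * suc k
        ≡⟨ cong (binom (suc m) k * suc k +_) (binom-absorption m k) ⟩
      binom (suc m) k * suc k + suc m * binom m k
        ≡⟨ t1 k ⟩
      suc (suc m) * binom (suc m) k ∎
    where
    open ≡-Reasoning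
    t1 : ∀ k → binom (suc m) k * suc k + suc m * binom m k ≡ suc (suc m) * binom (suc m) k
    t1 zero = solve 1 (λ m' → con 1 :* con 1 :+ m' :* con 1 := (con 1 :+ m') :* con 1) refl (suc m)
    t1 (suc k') = begin
        binom (suc m) (suc k') * suc (suc k') + suc m * binom m (suc k')
          ≡⟨ cong (_+ suc m * binom m (suc k')) (trans (ℕP.*-suc (binom (suc m) (suc k')) (suc k')) (ℕP.+-comm (binom (suc m) (suc k')) _)) ⟩
        binom (suc m) (suc k') * suc k' + binom (suc m) (suc k') + suc m * binom m (suc k')
          ≡⟨ cong (λ z → z + binom (suc m) (suc k') + suc m * binom m (suc k')) (binom-absorption m k') ⟩
        suc m * binom m k' + (binom m k' + binom m (suc k')) + suc m * binom m (suc k')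
          ≡⟨ solve 3 (λ m' a b → m' :* a :+ (a :+ b) :+ m' :* b := (con 1 :+ m') :* (a :+ b)) refl (suc m) (binom m k') (binom m (suc k')) ⟩
        suc (suc m) * (binom m k' + binom m (suc k')) ∎

  binom-absorption-∸ : ∀ m j → binom (suc m) j * (suc m ∸ j) ≡ suc m * binom m j
  binom-absorption-∸ m zero = trans (ℕP.+-identityʳ (suc m)) (sym (ℕP.*-identityʳ (suc m)))
  binom-absorption-∸ zero (suc j) = trans (cong (binom 1 (suc j) *_) (ℕP.0∸n≡0 j)) (ℕP.*-zeroʳ (binom 1 (suc j)))
  binom-absorption-∸ (suc p) (suc j) with ℕP.≤-<-connex j p
  ... | inj₁ j≤p = begin
      (binom (suc p) j + binom (suc p) (suc j)) * (suc p ∸ j)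
        ≡⟨ ℕP.*-distribʳ-+ (suc p ∸ j) (binom (suc p) j) (binom (suc p) (suc j)) ⟩
      binom (suc p) j * (suc p ∸ j) + binom (suc p) (suc j) * (suc p ∸ j)
        ≡⟨ cong₂ _+_ (binom-absorption-∸ p j) (cong (binom (suc p) (suc j) *_) (ℕP.+-∸-assoc 1 j≤p)) ⟩
      suc p * binom p j + binom (suc p) (suc j) * suc (p ∸ j)
        ≡⟨ cong (suc p * binom p j +_) (trans (ℕP.*-suc (binom (suc p) (suc j)) (p ∸ j)) (cong (binom (suc p) (suc j) +_) (binom-absorption-∸ p (suc j)))) ⟩
      suc p * binom p j + (binom (suc p) (suc j) + suc p * binom p (suc j))
        ≡⟨ solve 3 (λ m' a b → m' :* a :+ ((a :+ b) :+ m' :* b) := (con 1 :+ m') :* (a :+ b)) refl (suc p) (binom p j) (binom p (suc j)) ⟩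
      suc (suc p) * (binom p j + binom p (suc j)) ∎
    where open ≡-Reasoning
  ... | inj₂ p<j = begin
      (binom (suc p) j + binom (suc p) (suc j)) * (suc p ∸ j)
        ≡⟨ cong ((binom (suc p) j + binom (suc p) (suc j)) *_) (ℕP.m≤n⇒m∸n≡0 p<j) ⟩
      (binom (suc p) j + binom (suc p) (suc j)) * 0  ≡⟨ ℕP.*-zeroʳ (binom (suc p) j + binom (suc p) (suc j)) ⟩
      0  ≡⟨ sym (ℕP.*-zeroʳ (suc (suc p))) ⟩
      suc (suc p) * 0  ≡⟨ cong (suc (suc p) *_) (sym (cong₂ _+_ (binom-< p j p<j) (binom-< p (suc j) (ℕP.m≤n⇒m≤1+n p<j)))) ⟩
      suc (suc p) * (binom p j + binom p (suc j)) ∎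
    where open ≡-Reasoning

  binom-pred : ∀ r k → k ≤ r → binom (r ∸ 1) k * r ≡ binom r k * (r ∸ k)
  binom-pred zero zero _ = refl
  binom-pred (suc m) k _ = trans (ℕP.*-comm (binom m k) (suc m)) (sym (binom-absorption-∸ m k))

  binom-pred-pred : ∀ r k → 1 ≤ k → k < r → binom (r ∸ 2) (k ∸ 1) * (r * (r ∸ 1)) ≡ binom r k * (k * (r ∸ k))
  binom-pred-pred (suc zero) (suc j) _ (s≤s ())
  binom-pred-pred (suc (suc p)) (suc j) _ _ = begin
      binom p j * (R * suc p)
        ≡⟨ solve 3 (λ a r' s → a :* (r' :* s) := r' :* (s :* a)) refl (binom p j) R (suc p) ⟩
      R * (suc p * binom p j)  ≡⟨ cong (R *_) (sym (binom-absorption-∸ p j)) ⟩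
      R * (binom (suc p) j * (suc p ∸ j))
        ≡⟨ solve 3 (λ r' a t → r' :* (a :* t) := (r' :* a) :* t) refl R (binom (suc p) j) (suc p ∸ j) ⟩
      (R * binom (suc p) j) * (suc p ∸ j)  ≡⟨ cong (_* (suc p ∸ j)) (sym (binom-absorption (suc p) j)) ⟩
      (binom R (suc j) * suc j) * (suc p ∸ j)  ≡⟨ ℕP.*-assoc (binom R (suc j)) (suc j) (suc p ∸ j) ⟩
      binom R (suc j) * (suc j * (suc p ∸ j)) ∎
    where
    open ≡-Reasoning
    R = suc (suc p)


  binom-step : ∀ m k → binom m k ≤ binom (suc m) k
  binom-step m zero = ℕP.≤-refl
  binom-step m (suc k) = ℕP.m≤n+m (binom m (suc k)) (binom m k)

  binom-mono : ∀ {m m'} k → m ≤ m' → binom m k ≤ binom m' k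
  binom-mono {m} {m'} k le with ℕP.m≤n⇒∃[o]m+o≡n le
  ... | d , refl = go d
    where
    go : ∀ d → binom m k ≤ binom (m + d) k
    go zero = ℕP.≤-reflexive (cong (λ z → binom z k) (sym (ℕP.+-identityʳ m)))
    go (suc d) = ℕP.≤-trans (go d) (ℕP.≤-trans (binom-step (m + d) k) (ℕP.≤-reflexive (cong (λ z → binom z k) (sym (ℕP.+-suc m d)))))

module NatInequalities where

  open import Data.Nat as ℕ
  import Data.Nat.Properties as ℕP
  open import Data.Product using (proj₁; proj₂)
  open import Relation.Binary.PropositionalEquality
  import Data.Nat.Solver as NS
  open NS.+-*-Solver
  open Binomial

  *-pos : ∀ {a b} → 0 < a → 0 < b → 0 < a * b
  *-pos {suc a} {suc b} _ _ = s≤s z≤n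

  averageCut-comparison : ∀ n r k DC DV SC SV → 1 ≤ k → k < r → r ≤ n →
         SV ≡ binom (n ∸ 2) (k ∸ 1) * DV → binom (r ∸ 2) (k ∸ 1) * DC ≤ SC →
         (n ∸ k) * DV * ((r ∸ 1) * r) < (r ∸ k) * DC * ((n ∸ 1) * n) →
         SV * binom r k < SC * binom n k
  averageCut-comparison n r k DC DV SC SV 1≤k k<r r≤n eSV hSC h =
    ℕP.<-≤-trans (subst (_< A * DC * NV) (cong (_* NC) (sym eSV)) core) (ℕP.*-monoˡ-≤ NV hSC)
    where
    A = binom (r ∸ 2) (k ∸ 1)
    B = binom (n ∸ 2) (k ∸ 1)
    NC = binom r k
    NV = binom n k
    k<n = ℕP.<-≤-trans k<r r≤n
    Bpos : 0 < B
    Bpos = binom-pos (n ∸ 2) (k ∸ 1) (ℕP.∸-monoˡ-≤ 2 k<n)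
    W = NC * k * B
    Wpos : 0 < W
    Wpos = *-pos (*-pos (binom-pos r k (ℕP.<⇒≤ k<r)) 1≤k) Bpos
    K = (r * (r ∸ 1)) * (k * (n ∸ k))
    e1 : A * DC * NV * K ≡ W * ((r ∸ k) * DC * ((n ∸ 1) * n))
    e1 = begin
      A * DC * NV * K
        ≡⟨ solve 7 (λ a dc nv r rm1 kk nk → a :* dc :* nv :* ((r :* rm1) :* (kk :* nk)) := (a :* (r :* rm1)) :* dc :* (nv :* (kk :* nk))) refl A DC NV r (r ∸ 1) k (n ∸ k) ⟩
      (A * (r * (r ∸ 1))) * DC * (NV * (k * (n ∸ k)))
        ≡⟨ cong₂ (λ x y → x * DC * y) (binom-pred-pred r k 1≤k k<r) (sym (binom-pred-pred n k 1≤k k<n)) ⟩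
      (NC * (k * (r ∸ k))) * DC * (B * (n * (n ∸ 1)))
        ≡⟨ solve 7 (λ nc kk rk dc b nn nm1 → (nc :* (kk :* rk)) :* dc :* (b :* (nn :* nm1)) := nc :* kk :* b :* (rk :* dc :* (nm1 :* nn))) refl NC k (r ∸ k) DC B n (n ∸ 1) ⟩
      W * ((r ∸ k) * DC * ((n ∸ 1) * n)) ∎
      where open ≡-Reasoning
    e2 : B * DV * NC * K ≡ W * ((n ∸ k) * DV * ((r ∸ 1) * r))
    e2 = solve 8 (λ b dv nc r rm1 kk nk _ → b :* dv :* nc :* ((r :* rm1) :* (kk :* nk)) := nc :* kk :* b :* (nk :* dv :* (rm1 :* r))) refl B DV NC r (r ∸ 1) k (n ∸ k) 0
    core : B * DV * NC < A * DC * NV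
    core = ℕP.*-cancelʳ-< K (B * DV * NC) (A * DC * NV)
             (subst₂ _<_ (sym e2) (sym e1) (ℕP.*-monoʳ-< W {{>-nonZero Wpos}} h))

  missed-core : ∀ k n' r' yc y' → 1 ≤ k → yc * (k + n') < (yc + y') * (k + r') →
          (yc + y') * n' * (k + r') < (k + n') * (yc * r' + y' * (k + r'))
  missed-core k n' r' yc y' 1≤k h = res
    where
    T = yc * r' + y' * (k + r')
    h' : yc * k + yc * n' < yc * k + T
    h' = subst₂ _<_ (ℕP.*-distribˡ-+ yc k n')
           (solve 5 (λ yc y' k r' _ → (yc :+ y') :* (k :+ r') := yc :* k :+ (yc :* r' :+ y' :* (k :+ r'))) refl yc y' k r' 0) h
    lt : yc * n' < T
    lt = ℕP.+-cancelˡ-< (yc * k) (yc * n') T h'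
    o = proj₁ (ℕP.m≤n⇒∃[o]m+o≡n lt)
    eo : suc (yc * n') + o ≡ T
    eo = proj₂ (ℕP.m≤n⇒∃[o]m+o≡n lt)
    XL = (yc + y') * n' * (k + r')
    XR = (k + n') * T
    iden : XR + k * (yc * n') ≡ XL + k * T
    iden = solve 5 (λ k n' r' yc y' → (k :+ n') :* (yc :* r' :+ y' :* (k :+ r')) :+ k :* (yc :* n')
                       := (yc :+ y') :* n' :* (k :+ r') :+ k :* (yc :* r' :+ y' :* (k :+ r'))) refl k n' r' yc y'
    iden2 : XR + k * (yc * n') ≡ (XL + k * suc o) + k * (yc * n')
    iden2 = trans iden (trans (cong (λ z → XL + k * z) (sym eo))
              (solve 4 (λ xl k a o → xl :+ k :* ((con 1 :+ a) :+ o) := (xl :+ k :* (con 1 :+ o)) :+ k :* a) refl XL k (yc * n') o))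
    eqR : XR ≡ XL + k * suc o
    eqR = ℕP.+-cancelʳ-≡ (k * (yc * n')) XR (XL + k * suc o) iden2
    res : XL < XR
    res = subst (XL <_) (sym eqR) (ℕP.m<m+n XL (*-pos 1≤k (s≤s z≤n)))

  scaled-missed-all : ∀ n r k y SV → k ≤ n → SV ≡ y * binom (n ∸ 1) k →
    SV * binom r k * (r * n) ≡ binom r k * binom n k * (y * (n ∸ k) * r)
  scaled-missed-all n r k y SV k≤n eSV = begin
      SV * NC * (r * n)       ≡⟨ cong (λ z → z * NC * (r * n)) eSV ⟩
      y * b * NC * (r * n)    ≡⟨ solve 5 (λ y b nc r n → y :* b :* nc :* (r :* n) := y :* (b :* n) :* nc :* r) refl y b NC r n ⟩
      y * (b * n) * NC * r    ≡⟨ cong (λ z → y * z * NC * r) (binom-pred n k k≤n) ⟩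
      y * (NV * (n ∸ k)) * NC * r
        ≡⟨ solve 5 (λ y nv n' nc r → y :* (nv :* n') :* nc :* r := nc :* nv :* (y :* n' :* r)) refl y NV (n ∸ k) NC r ⟩
      NC * NV * (y * (n ∸ k) * r) ∎
    where
    open ≡-Reasoning
    NC = binom r k
    NV = binom n k
    b = binom (n ∸ 1) k

  scaled-missed-part : ∀ n r k yc y' SC → k ≤ r → SC ≡ yc * binom (r ∸ 1) k + y' * binom r k →
    SC * binom n k * (r * n) ≡ binom r k * binom n k * (n * (yc * (r ∸ k) + y' * r))
  scaled-missed-part n r k yc y' SC k≤r eSC = begin
      SC * NV * (r * n)                       ≡⟨ cong (λ z → z * NV * (r * n)) eSC ⟩
      (yc * a + y' * NC) * NV * (r * n)
        ≡⟨ solve 7 (λ yc a y' nc nv r n → (yc :* a :+ y' :* nc) :* nv :* (r :* n) := (yc :* (a :* r) :+ y' :* nc :* r) :* nv :* n) refl yc a y' NC NV r n ⟩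
      (yc * (a * r) + y' * NC * r) * NV * n   ≡⟨ cong (λ z → (yc * z + y' * NC * r) * NV * n) (binom-pred r k k≤r) ⟩
      (yc * (NC * (r ∸ k)) + y' * NC * r) * NV * n
        ≡⟨ solve 7 (λ yc nc r' y' r nv n → (yc :* (nc :* r') :+ y' :* nc :* r) :* nv :* n := nc :* nv :* (n :* (yc :* r' :+ y' :* r))) refl yc NC (r ∸ k) y' r NV n ⟩
      NC * NV * (n * (yc * (r ∸ k) + y' * r)) ∎
    where
    open ≡-Reasoning
    NC = binom r k
    NV = binom n k
    a = binom (r ∸ 1) k

  averageMissed-comparison : ∀ n r k y yc SC SV → 1 ≤ k → k < r → r ≤ n → yc ≤ y →
         SC ≡ yc * binom (r ∸ 1) k + (y ∸ yc) * binom r k → SV ≡ y * binom (n ∸ 1) k →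
         yc * n < y * r → SV * binom r k < SC * binom n k
  averageMissed-comparison n r k y yc SC SV 1≤k k<r r≤n yc≤y eSC eSV h =
    ℕP.*-cancelʳ-< (r * n) (SV * binom r k) (SC * binom n k)
      (subst₂ _<_ (sym (scaled-missed-all n r k y SV (ℕP.<⇒≤ k<n) eSV)) (sym (scaled-missed-part n r k yc y' SC (ℕP.<⇒≤ k<r) eSC))
        (ℕP.*-monoʳ-< W {{>-nonZero Wpos}} core))
    where
    k<n = ℕP.<-≤-trans k<r r≤n
    n' = n ∸ k
    r' = r ∸ k
    y' = y ∸ yc
    en : k + n' ≡ n
    en = ℕP.m+[n∸m]≡n (ℕP.<⇒≤ k<n)
    er : k + r' ≡ r
    er = ℕP.m+[n∸m]≡n (ℕP.<⇒≤ k<r)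
    ey : yc + y' ≡ y
    ey = ℕP.m+[n∸m]≡n yc≤y
    core : y * n' * r < n * (yc * r' + y' * r)
    core = subst₂ (λ yy rr → yy * n' * rr < n * (yc * r' + y' * rr)) ey er
            (subst (λ nn → (yc + y') * n' * (k + r') < nn * (yc * r' + y' * (k + r'))) en
              (missed-core k n' r' yc y' 1≤k (subst₂ (λ nn z → yc * nn < z) (sym en) (sym (cong₂ _*_ ey er)) h)))
    W = binom r k * binom n k
    Wpos : 0 < W
    Wpos = *-pos (binom-pos r k (ℕP.<⇒≤ k<r)) (binom-pos n k (ℕP.<⇒≤ k<n))

module SubsetCounting where

  open import Data.Nat as ℕ using (ℕ; zero; suc; _+_; _*_; _∸_; _≤_; _<_; _≡ᵇ_)
  import Data.Nat.Properties as ℕP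
  open import Data.Bool using (Bool; true; false; not; _∧_; if_then_else_)
  open import Data.Fin as Fin using (Fin; _≟_)
  open import Data.Fin.Subset using (Subset; ∣_∣)
  open import Data.Vec using ([]; _∷_; lookup)
  open import Data.List as List using (List; []; _∷_; length; filterᵇ; allFin)
  import Data.List.Properties as LP
  open import Data.List.Relation.Unary.All using (All; []; _∷_)
  open import Data.List.Membership.Propositional using (_∈_)
  open import Data.List.Membership.Propositional.Properties using (∈-allFin)
  open import Data.List.Relation.Unary.Any using (here; there)
  open import Data.Bool.ListAction using (all)
  open import Data.Product using (_,_; _×_; proj₁)
  open import Data.Empty using (⊥-elim)
  open import Relation.Nullary using (yes; no; does; ¬_)
  import Data.Bool.Properties as BP
  open import Relation.Binary.PropositionalEquality
  open import Defs hiding (sym)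
  open NatSums
  open Binomial

  lsum-filter : ∀ {X : Set} (p : X → Bool) (L : List X) h → lsum (filterᵇ p L) h ≡ lsum L (λ x → if p x then h x else 0)
  lsum-filter p [] h = refl
  lsum-filter p (x ∷ L) h with p x
  ... | true = cong (h x +_) (lsum-filter p L h)
  ... | false = lsum-filter p L h

  all-filter : ∀ {X : Set} (p : X → Bool) (L : List X) → All (λ x → p x ≡ true) (filterᵇ p L)
  all-filter p [] = []
  all-filter p (x ∷ L) with p x in eq
  ... | true = eq ∷ all-filter p L
  ... | false = all-filter p L

  length-lsum : ∀ {X : Set} (L : List X) → length L ≡ lsum L (λ _ → 1)
  length-lsum [] = refl
  length-lsum (x ∷ L) = cong suc (length-lsum L)

  countᵇ-lsum : ∀ {X : Set} (p : X → Bool) (L : List X) → countᵇ p L ≡ lsum L (λ x → boolToℕ (p x))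
  countᵇ-lsum p [] = refl
  countᵇ-lsum p (x ∷ L) with p x
  ... | true = cong suc (countᵇ-lsum p L)
  ... | false = countᵇ-lsum p L

  ∣∣≡ΣF : ∀ {n} (S : Subset n) → ∣ S ∣ ≡ ΣF (λ v → boolToℕ (lookup S v))
  ∣∣≡ΣF [] = refl
  ∣∣≡ΣF {suc n} (true ∷ S) = trans (cong suc (∣∣≡ΣF S)) (sym (ΣF-suc (λ v → boolToℕ (lookup (true ∷ S) v))))
  ∣∣≡ΣF {suc n} (false ∷ S) = trans (∣∣≡ΣF S) (sym (ΣF-suc (λ v → boolToℕ (lookup (false ∷ S) v))))

  all-true : ∀ {X : Set} (f : X → Bool) (L : List X) → (∀ x → x ∈ L → f x ≡ true) → all f L ≡ true
  all-true f [] h = refl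
  all-true f (x ∷ L) h rewrite h x (here refl) = all-true f L (λ y m → h y (there m))

  all-false : ∀ {X : Set} (f : X → Bool) (L : List X) x → x ∈ L → f x ≡ false → all f L ≡ false
  all-false f (y ∷ L) x (here refl) e rewrite e = refl
  all-false f (y ∷ L) x (there m) e with f y
  ... | true = all-false f L x m e
  ... | false = refl

  all-elim : ∀ {X : Set} (f : X → Bool) (L : List X) → all f L ≡ true → ∀ x → x ∈ L → f x ≡ true
  all-elim f L h x m with f x in e
  ... | true = refl
  ... | false = trans (sym (all-false f L x m e)) h

  allF : ∀ {n} → (Fin n → Bool) → Bool
  allF {n} f = all f (allFin n)

  allF-true : ∀ {n} (f : Fin n → Bool) → (∀ i → f i ≡ true) → allF f ≡ true
  allF-true {n} f h = all-true f (allFin n) (λ x _ → h x)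

  allF-elim : ∀ {n} (f : Fin n → Bool) → allF f ≡ true → ∀ i → f i ≡ true
  allF-elim {n} f h i = all-elim f (allFin n) h i (∈-allFin i)

  allF-suc : ∀ {n} (f : Fin (suc n) → Bool) → allF f ≡ f Fin.zero ∧ allF (λ i → f (Fin.suc i))
  allF-suc {n} f = cong (f Fin.zero ∧_) (cong Data.Bool.ListAction.and (trans (LP.map-tabulate Fin.suc f) (sym (LP.map-tabulate (λ i → i) (λ i → f (Fin.suc i))))))

  data Role : Set where
    required forbidden free : Role

  allows : Role → Bool → Bool
  allows required  b = b
  allows forbidden b = not b
  allows free      b = true

  isRequired isFree : Role → ℕ
  isRequired required = 1
  isRequired _        = 0
  isFree free = 1
  isFree _    = 0

  module _ {n : ℕ} (roles : Fin n → Role) where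
    matches : Subset n → Bool
    matches S = allF (λ i → allows (roles i) (lookup S i))

    nRequired nFree : ℕ
    nRequired = ΣF (λ i → isRequired (roles i))
    nFree = ΣF (λ i → isFree (roles i))

    countMatching : ℕ → ℕ
    countMatching K = lsum (allSubsets n) (λ S → boolToℕ ((∣ S ∣ ≡ᵇ K) ∧ matches S))

    CountFormula : Set
    CountFormula = (∀ k → countMatching (k + nRequired) ≡ binom nFree k)
                 × (∀ j → j < nRequired → countMatching j ≡ 0)

  module Step {n : ℕ} (roles : Fin (suc n) → Role) where
    open ≡-Reasoning
    roles′ : Fin n → Role
    roles′ i = roles (Fin.suc i)

    matches-∷ : ∀ b s → matches roles (b ∷ s) ≡ allows (roles Fin.zero) b ∧ matches roles′ s
    matches-∷ b s = allF-suc (λ i → allows (roles i) (lookup (b ∷ s) i))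

    countMatching-split : ∀ K → countMatching roles K
      ≡ lsum (allSubsets n) (λ s → boolToℕ ((suc ∣ s ∣ ≡ᵇ K) ∧ (allows (roles Fin.zero) true ∧ matches roles′ s))
                                  + (boolToℕ ((∣ s ∣ ≡ᵇ K) ∧ (allows (roles Fin.zero) false ∧ matches roles′ s)) + 0))
    countMatching-split K = trans (lsum-concatMap (λ s → (true ∷ s) ∷ (false ∷ s) ∷ []) (allSubsets n) _)
      (lsum-cong (allSubsets n) (λ s → cong₂ (λ u v → boolToℕ ((suc ∣ s ∣ ≡ᵇ K) ∧ u) + (boolToℕ ((∣ s ∣ ≡ᵇ K) ∧ v) + 0))
                                              (matches-∷ true s) (matches-∷ false s)))

    countMatching-required-0 : roles Fin.zero ≡ required → countMatching roles 0 ≡ 0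
    countMatching-required-0 e = trans (countMatching-split 0)
      (trans (lsum-cong (allSubsets n) f) (trans (lsum-const (allSubsets n) 0) (ℕP.*-zeroʳ (length (allSubsets n)))))
      where
      f : ∀ s → boolToℕ ((suc ∣ s ∣ ≡ᵇ 0) ∧ (allows (roles Fin.zero) true ∧ matches roles′ s))
                  + (boolToℕ ((∣ s ∣ ≡ᵇ 0) ∧ (allows (roles Fin.zero) false ∧ matches roles′ s)) + 0) ≡ 0
      f s rewrite e | BP.∧-zeroʳ (∣ s ∣ ≡ᵇ 0) = refl

    countMatching-required : roles Fin.zero ≡ required → ∀ K → countMatching roles (suc K) ≡ countMatching roles′ K
    countMatching-required e K = trans (countMatching-split (suc K)) (lsum-cong (allSubsets n) f)
      where
      f : ∀ s → boolToℕ ((suc ∣ s ∣ ≡ᵇ suc K) ∧ (allows (roles Fin.zero) true ∧ matches roles′ s))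
                  + (boolToℕ ((∣ s ∣ ≡ᵇ suc K) ∧ (allows (roles Fin.zero) false ∧ matches roles′ s)) + 0)
            ≡ boolToℕ ((∣ s ∣ ≡ᵇ K) ∧ matches roles′ s)
      f s rewrite e | BP.∧-zeroʳ (∣ s ∣ ≡ᵇ suc K) = ℕP.+-identityʳ _

    countMatching-forbidden : roles Fin.zero ≡ forbidden → ∀ K → countMatching roles K ≡ countMatching roles′ K
    countMatching-forbidden e K = trans (countMatching-split K) (lsum-cong (allSubsets n) f)
      where
      f : ∀ s → boolToℕ ((suc ∣ s ∣ ≡ᵇ K) ∧ (allows (roles Fin.zero) true ∧ matches roles′ s))
                  + (boolToℕ ((∣ s ∣ ≡ᵇ K) ∧ (allows (roles Fin.zero) false ∧ matches roles′ s)) + 0)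
            ≡ boolToℕ ((∣ s ∣ ≡ᵇ K) ∧ matches roles′ s)
      f s rewrite e | BP.∧-zeroʳ (suc ∣ s ∣ ≡ᵇ K) = ℕP.+-identityʳ _

    countMatching-free-0 : roles Fin.zero ≡ free → countMatching roles 0 ≡ countMatching roles′ 0
    countMatching-free-0 e = trans (countMatching-split 0) (lsum-cong (allSubsets n) f)
      where
      f : ∀ s → boolToℕ ((suc ∣ s ∣ ≡ᵇ 0) ∧ (allows (roles Fin.zero) true ∧ matches roles′ s))
                  + (boolToℕ ((∣ s ∣ ≡ᵇ 0) ∧ (allows (roles Fin.zero) false ∧ matches roles′ s)) + 0)
            ≡ boolToℕ ((∣ s ∣ ≡ᵇ 0) ∧ matches roles′ s)
      f s rewrite e = ℕP.+-identityʳ _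

    countMatching-free : roles Fin.zero ≡ free → ∀ K →
      countMatching roles (suc K) ≡ countMatching roles′ K + countMatching roles′ (suc K)
    countMatching-free e K = trans (countMatching-split (suc K)) (trans (lsum-cong (allSubsets n) f) (lsum-+ (allSubsets n) _ _))
      where
      f : ∀ s → boolToℕ ((suc ∣ s ∣ ≡ᵇ suc K) ∧ (allows (roles Fin.zero) true ∧ matches roles′ s))
                  + (boolToℕ ((∣ s ∣ ≡ᵇ suc K) ∧ (allows (roles Fin.zero) false ∧ matches roles′ s)) + 0)
            ≡ boolToℕ ((∣ s ∣ ≡ᵇ K) ∧ matches roles′ s) + boolToℕ ((∣ s ∣ ≡ᵇ suc K) ∧ matches roles′ s)
      f s rewrite e = cong (boolToℕ ((∣ s ∣ ≡ᵇ K) ∧ matches roles′ s) +_) (ℕP.+-identityʳ _)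

    nRequired-∷ : ∀ ρ → roles Fin.zero ≡ ρ → nRequired roles ≡ isRequired ρ + nRequired roles′
    nRequired-∷ ρ e = trans (ΣF-suc (λ i → isRequired (roles i))) (cong (λ z → isRequired z + nRequired roles′) e)

    nFree-∷ : ∀ ρ → roles Fin.zero ≡ ρ → nFree roles ≡ isFree ρ + nFree roles′
    nFree-∷ ρ e = trans (ΣF-suc (λ i → isFree (roles i))) (cong (λ z → isFree z + nFree roles′) e)

    CountFormula-required : roles Fin.zero ≡ required → CountFormula roles′ → CountFormula roles
    CountFormula-required e (T′ , Z′) = T , Z
      where
      eR = nRequired-∷ required e
      T : ∀ k → countMatching roles (k + nRequired roles) ≡ binom (nFree roles) k
      T k = begin
        countMatching roles (k + nRequired roles)    ≡⟨ cong (countMatching roles) (trans (cong (k +_) eR) (ℕP.+-suc k _)) ⟩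
        countMatching roles (suc (k + nRequired roles′)) ≡⟨ countMatching-required e _ ⟩
        countMatching roles′ (k + nRequired roles′)  ≡⟨ T′ k ⟩
        binom (nFree roles′) k                       ≡⟨ cong (λ z → binom z k) (nFree-∷ required e) ⟨
        binom (nFree roles) k                        ∎
      Z : ∀ j → j < nRequired roles → countMatching roles j ≡ 0
      Z zero    _  = countMatching-required-0 e
      Z (suc j) lt = trans (countMatching-required e j) (Z′ j (ℕP.≤-pred (subst (suc j <_) eR lt)))

    CountFormula-forbidden : roles Fin.zero ≡ forbidden → CountFormula roles′ → CountFormula roles
    CountFormula-forbidden e (T′ , Z′) = T , Z
      where
      eR = nRequired-∷ forbidden e
      T : ∀ k → countMatching roles (k + nRequired roles) ≡ binom (nFree roles) k
      T k = begin
        countMatching roles (k + nRequired roles)   ≡⟨ cong (λ z → countMatching roles (k + z)) eR ⟩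
        countMatching roles (k + nRequired roles′)  ≡⟨ countMatching-forbidden e _ ⟩
        countMatching roles′ (k + nRequired roles′) ≡⟨ T′ k ⟩
        binom (nFree roles′) k                      ≡⟨ cong (λ z → binom z k) (nFree-∷ forbidden e) ⟨
        binom (nFree roles) k                       ∎
      Z : ∀ j → j < nRequired roles → countMatching roles j ≡ 0
      Z j lt = trans (countMatching-forbidden e j) (Z′ j (subst (j <_) eR lt))

    CountFormula-free : roles Fin.zero ≡ free → CountFormula roles′ → CountFormula roles
    CountFormula-free e (T′ , Z′) = T , Z
      where
      eR = nRequired-∷ free e
      m = nRequired roles′
      Z : ∀ j → j < nRequired roles → countMatching roles j ≡ 0
      Z zero    lt = trans (countMatching-free-0 e) (Z′ 0 (subst (0 <_) eR lt))
      Z (suc j) lt = trans (countMatching-free e j) (cong₂ _+_ (Z′ j (ℕP.<-trans (ℕP.n<1+n j) lt′)) (Z′ (suc j) lt′))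
        where lt′ = subst (suc j <_) eR lt
      T₀ : ∀ j → j ≡ m → countMatching roles j ≡ 1
      T₀ zero    j≡m = trans (countMatching-free-0 e) (subst (λ z → countMatching roles′ z ≡ 1) (sym j≡m) (T′ 0))
      T₀ (suc j) j≡m = trans (countMatching-free e j)
        (cong₂ _+_ (Z′ j (subst (j <_) j≡m (ℕP.n<1+n j))) (subst (λ z → countMatching roles′ z ≡ 1) (sym j≡m) (T′ 0)))
      T : ∀ k → countMatching roles (k + nRequired roles) ≡ binom (nFree roles) k
      T zero = trans (cong (countMatching roles) eR) (trans (T₀ m refl) (sym (cong (λ z → binom z 0) (nFree-∷ free e))))
      T (suc k) = begin
        countMatching roles (suc k + nRequired roles)                 ≡⟨ cong (λ z → countMatching roles (suc k + z)) eR ⟩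
        countMatching roles (suc (k + m))                             ≡⟨ countMatching-free e (k + m) ⟩
        countMatching roles′ (k + m) + countMatching roles′ (suc k + m) ≡⟨ cong₂ _+_ (T′ k) (T′ (suc k)) ⟩
        binom (suc (nFree roles′)) (suc k)                            ≡⟨ cong (λ z → binom z (suc k)) (nFree-∷ free e) ⟨
        binom (nFree roles) (suc k)                                   ∎

  countFormula : ∀ n (roles : Fin n → Role) → CountFormula roles
  countFormula zero roles = T , (λ _ ())
    where
    T : ∀ k → countMatching roles (k + 0) ≡ binom 0 k
    T k rewrite ℕP.+-identityʳ k with k
    ... | zero = refl
    ... | suc _ = refl
  countFormula (suc n) roles = byFirstRole (roles Fin.zero) refl
    where
    byFirstRole : ∀ ρ → roles Fin.zero ≡ ρ → CountFormula roles
    byFirstRole required  e = Step.CountFormula-required roles e (countFormula n _)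
    byFirstRole forbidden e = Step.CountFormula-forbidden roles e (countFormula n _)
    byFirstRole free      e = Step.CountFormula-free roles e (countFormula n _)

  eqᵇ : ∀ {n} → Fin n → Fin n → Bool
  eqᵇ i a = does (i ≟ a)

  eqᵇ-refl : ∀ {n} (a : Fin n) → eqᵇ a a ≡ true
  eqᵇ-refl Fin.zero = refl
  eqᵇ-refl (Fin.suc a) = eqᵇ-refl a

  eqᵇ⇒≡ : ∀ {n} (i a : Fin n) → eqᵇ i a ≡ true → i ≡ a
  eqᵇ⇒≡ i a e with i ≟ a
  ... | yes p = p
  eqᵇ⇒≡ i a () | no _

  ≢⇒eqᵇ-false : ∀ {n} (i a : Fin n) → ¬ (i ≡ a) → eqᵇ i a ≡ false
  ≢⇒eqᵇ-false i a ne with i ≟ a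
  ... | yes p = ⊥-elim (ne p)
  ... | no _ = refl

  ΣF-extract : ∀ {n} (f : Fin n → ℕ) a → ΣF f ≡ f a + ΣF (λ i → if eqᵇ i a then 0 else f i)
  ΣF-extract {suc n} f Fin.zero = trans (ΣF-suc f) (cong (f Fin.zero +_) (sym (ΣF-suc (λ i → if eqᵇ i Fin.zero then 0 else f i))))
  ΣF-extract {suc n} f (Fin.suc a) = begin
      ΣF f  ≡⟨ ΣF-suc f ⟩
      f Fin.zero + ΣF (λ i → f (Fin.suc i))  ≡⟨ cong (f Fin.zero +_) (ΣF-extract (λ i → f (Fin.suc i)) a) ⟩
      f Fin.zero + (f (Fin.suc a) + ΣF (λ i → if eqᵇ i a then 0 else f (Fin.suc i)))
        ≡⟨ trans (sym (ℕP.+-assoc (f Fin.zero) (f (Fin.suc a)) R)) (trans (cong (_+ R) (ℕP.+-comm (f Fin.zero) (f (Fin.suc a)))) (ℕP.+-assoc (f (Fin.suc a)) (f Fin.zero) R)) ⟩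
      f (Fin.suc a) + (f Fin.zero + ΣF (λ i → if eqᵇ i a then 0 else f (Fin.suc i)))
        ≡⟨ cong (f (Fin.suc a) +_) (sym (ΣF-suc (λ i → if eqᵇ i (Fin.suc a) then 0 else f i))) ⟩
      f (Fin.suc a) + ΣF (λ i → if eqᵇ i (Fin.suc a) then 0 else f i) ∎
    where
    open ≡-Reasoning
    R = ΣF (λ i → if eqᵇ i a then 0 else f (Fin.suc i))

  ΣF-zero : ∀ {n} → ΣF {n} (λ _ → 0) ≡ 0
  ΣF-zero {n} = trans (lsum-const (allFin n) 0) (ℕP.*-zeroʳ (length (allFin n)))

  ΣF-cong : ∀ {n} {f g : Fin n → ℕ} → (∀ i → f i ≡ g i) → ΣF f ≡ ΣF g
  ΣF-cong {n} e = lsum-cong (allFin n) e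

  ΣF-indicator : ∀ {n} (a : Fin n) → ΣF (λ i → if eqᵇ i a then 1 else 0) ≡ 1
  ΣF-indicator {n} a = trans (ΣF-extract _ a) (cong₂ _+_ (cong (λ z → if z then 1 else 0) (eqᵇ-refl a))
                   (trans (ΣF-cong (λ i → f i)) (ΣF-zero {n})))
    where
    f : ∀ i → (if eqᵇ i a then 0 else (if eqᵇ i a then 1 else 0)) ≡ 0
    f i with eqᵇ i a
    ... | true = refl
    ... | false = refl

  all-∧ : ∀ {X : Set} (f g : X → Bool) (L : List X) → all (λ x → f x ∧ g x) L ≡ all f L ∧ all g L
  all-∧ f g [] = refl
  all-∧ f g (x ∷ L) with f x | g x
  ... | true | true = all-∧ f g L
  ... | true | false = sym (BP.∧-zeroʳ (all f L))
  ... | false | _ = refl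

  allF-cong : ∀ {n} {f g : Fin n → Bool} → (∀ i → f i ≡ g i) → allF f ≡ allF g
  allF-cong {n} e = cong Data.Bool.ListAction.and (LP.map-cong e (allFin n))

  allF-pt : ∀ {n} (a : Fin n) (x : Bool) → allF (λ i → if eqᵇ i a then x else true) ≡ x
  allF-pt a true = allF-true _ (λ i → f i)
    where
    f : ∀ i → (if eqᵇ i a then true else true) ≡ true
    f i with eqᵇ i a
    ... | true = refl
    ... | false = refl
  allF-pt {n} a false = all-false _ (allFin n) a (∈-allFin a) (cong (λ z → if z then false else true) (eqᵇ-refl a))

  allF-const : ∀ {n} → allF {n} (λ _ → true) ≡ true
  allF-const {n} = allF-true {n} (λ _ → true) (λ _ → refl)

  roleOf : ∀ {n} → Subset n → (Fin n → Bool) → (Fin n → Bool) → Fin n → Role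
  roleOf C I O i = if I i then required else (if O i then forbidden else (if lookup C i then free else forbidden))

  allows-roleOf : ∀ (I O c s : Bool) → (I ≡ true → c ≡ true) → (I ≡ true → O ≡ false) →
     allows (if I then required else (if O then forbidden else (if c then free else forbidden))) s ≡ (if s then c else true) ∧ ((if I then s else true) ∧ (if O then not s else true))
  allows-roleOf true O c s hc ho rewrite hc refl | ho refl with s
  ... | true = refl
  ... | false = refl
  allows-roleOf false true c true hc ho = sym (BP.∧-zeroʳ c)
  allows-roleOf false true c false hc ho = refl
  allows-roleOf false false true true hc ho = refl
  allows-roleOf false false true false hc ho = refl
  allows-roleOf false false false true hc ho = refl
  allows-roleOf false false false false hc ho = refl

  matches-roleOf : ∀ {n} (C : Subset n) (I O : Fin n → Bool) → (∀ i → I i ≡ true → lookup C i ≡ true) → (∀ i → I i ≡ true → O i ≡ false) →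
    ∀ S → matches (roleOf C I O) S ≡ (S ⊆ᵇ C) ∧ (allF (λ i → if I i then lookup S i else true) ∧ allF (λ i → if O i then not (lookup S i) else true))
  matches-roleOf {n} C I O hc ho S = begin
      allF (λ i → allows (roleOf C I O i) (lookup S i))
        ≡⟨ allF-cong (λ i → allows-roleOf (I i) (O i) (lookup C i) (lookup S i) (hc i) (ho i)) ⟩
      allF (λ i → f1 i ∧ (f2 i ∧ f3 i))  ≡⟨ all-∧ f1 (λ i → f2 i ∧ f3 i) (allFin n) ⟩
      allF f1 ∧ allF (λ i → f2 i ∧ f3 i)  ≡⟨ cong (allF f1 ∧_) (all-∧ f2 f3 (allFin n)) ⟩
      allF f1 ∧ (allF f2 ∧ allF f3) ∎
    where
    open ≡-Reasoning
    f1 = λ i → if lookup S i then lookup C i else true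
    f2 = λ i → if I i then lookup S i else true
    f3 = λ i → if O i then not (lookup S i) else true

  allF-at : ∀ {n} (a : Fin n) (h : Fin n → Bool) → allF (λ i → if eqᵇ i a then h i else true) ≡ h a
  allF-at a h = trans (allF-cong f) (allF-pt a (h a))
    where
    f : ∀ i → (if eqᵇ i a then h i else true) ≡ (if eqᵇ i a then h a else true)
    f i with eqᵇ i a in e
    ... | true = cong h (eqᵇ⇒≡ i a e)
    ... | false = refl

  lsum-kSubsetsOf : ∀ {n} k (C : Subset n) (P : Subset n → Bool) →
    lsum (kSubsetsOf k C) (λ S → boolToℕ (P S)) ≡ lsum (allSubsets n) (λ S → boolToℕ ((∣ S ∣ ≡ᵇ k) ∧ ((S ⊆ᵇ C) ∧ P S)))
  lsum-kSubsetsOf {n} k C P = trans (lsum-filter _ (allSubsets n) (λ S → boolToℕ (P S))) (lsum-cong (allSubsets n) (λ S → f (∣ S ∣ ≡ᵇ k) (S ⊆ᵇ C) (P S)))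
    where
    f : ∀ a b p → (if a ∧ b then boolToℕ p else 0) ≡ boolToℕ (a ∧ (b ∧ p))
    f true true p = refl
    f true false p = refl
    f false b p = refl

  lsum-kSubsetsOf≡countMatching : ∀ {n} k (C : Subset n) (P : Subset n → Bool) (lab : Fin n → Role) → (∀ S → (S ⊆ᵇ C) ∧ P S ≡ matches lab S) →
    lsum (kSubsetsOf k C) (λ S → boolToℕ (P S)) ≡ countMatching lab k
  lsum-kSubsetsOf≡countMatching {n} k C P lab e = trans (lsum-kSubsetsOf k C P) (lsum-cong (allSubsets n) (λ S → cong (λ z → boolToℕ ((∣ S ∣ ≡ᵇ k) ∧ z)) (e S)))

  length-kSubsetsOf′ : ∀ {n} k (C : Subset n) → length (kSubsetsOf k C) ≡ binom ∣ C ∣ k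
  length-kSubsetsOf′ {n} k C = begin
      length (kSubsetsOf k C)  ≡⟨ length-lsum (kSubsetsOf k C) ⟩
      lsum (kSubsetsOf k C) (λ S → boolToℕ true)  ≡⟨ lsum-kSubsetsOf≡countMatching k C (λ _ → true) lab me ⟩
      countMatching lab k  ≡⟨ cong (countMatching lab) (sym (trans (cong (k +_) eI) (ℕP.+-identityʳ k))) ⟩
      countMatching lab (k + nRequired lab)  ≡⟨ proj₁ (countFormula n lab) k ⟩
      binom (nFree lab) k  ≡⟨ cong (λ z → binom z k) eF ⟩
      binom ∣ C ∣ k ∎
    where
    open ≡-Reasoning
    lab = roleOf C (λ _ → false) (λ _ → false)
    me : ∀ S → (S ⊆ᵇ C) ∧ true ≡ matches lab S
    me S = sym (trans (matches-roleOf C (λ _ → false) (λ _ → false) (λ _ ()) (λ _ ()) S)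
              (cong ((S ⊆ᵇ C) ∧_) (cong₂ _∧_ (allF-const {n}) (allF-const {n}))))
    pI : ∀ c → isRequired (if c then free else forbidden) ≡ 0
    pI true = refl
    pI false = refl
    pF : ∀ c → isFree (if c then free else forbidden) ≡ boolToℕ c
    pF true = refl
    pF false = refl
    eI : nRequired lab ≡ 0
    eI = trans (ΣF-cong (λ i → pI (lookup C i))) (ΣF-zero {n})
    eF : nFree lab ≡ ∣ C ∣
    eF = trans (ΣF-cong (λ i → pF (lookup C i))) (sym (∣∣≡ΣF C))

  #kSubsetsOf-avoiding : ∀ {n} k (C : Subset n) v → lsum (kSubsetsOf k C) (λ S → boolToℕ (not (lookup S v))) ≡ binom (∣ C ∣ ∸ boolToℕ (lookup C v)) k
  #kSubsetsOf-avoiding {n} k C v = begin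
      lsum (kSubsetsOf k C) (λ S → boolToℕ (not (lookup S v)))  ≡⟨ lsum-kSubsetsOf≡countMatching k C (λ S → not (lookup S v)) lab me ⟩
      countMatching lab k  ≡⟨ cong (countMatching lab) (sym (trans (cong (k +_) eI) (ℕP.+-identityʳ k))) ⟩
      countMatching lab (k + nRequired lab)  ≡⟨ proj₁ (countFormula n lab) k ⟩
      binom (nFree lab) k  ≡⟨ cong (λ z → binom z k) eF ⟩
      binom (∣ C ∣ ∸ boolToℕ (lookup C v)) k ∎
    where
    open ≡-Reasoning
    O = λ i → eqᵇ i v
    lab = roleOf C (λ _ → false) O
    me : ∀ S → (S ⊆ᵇ C) ∧ not (lookup S v) ≡ matches lab S
    me S = sym (trans (matches-roleOf C (λ _ → false) O (λ _ ()) (λ _ ()) S)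
              (cong ((S ⊆ᵇ C) ∧_) (cong₂ _∧_ (allF-const {n}) (allF-at v (λ i → not (lookup S i))))))
    pI : ∀ o c → isRequired (if o then forbidden else (if c then free else forbidden)) ≡ 0
    pI true c = refl
    pI false true = refl
    pI false false = refl
    pF : ∀ o c → isFree (if o then forbidden else (if c then free else forbidden)) ≡ (if o then 0 else boolToℕ c)
    pF true c = refl
    pF false true = refl
    pF false false = refl
    eI : nRequired lab ≡ 0
    eI = trans (ΣF-cong (λ i → pI (O i) (lookup C i))) (ΣF-zero {n})
    eF0 : nFree lab ≡ ΣF (λ i → if eqᵇ i v then 0 else boolToℕ (lookup C i))
    eF0 = ΣF-cong (λ i → pF (O i) (lookup C i))
    eF : nFree lab ≡ ∣ C ∣ ∸ boolToℕ (lookup C v)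
    eF = trans eF0 (sym (trans (cong (_∸ boolToℕ (lookup C v)) (trans (∣∣≡ΣF C) (ΣF-extract (λ i → boolToℕ (lookup C i)) v)))
                            (ℕP.m+n∸m≡n (boolToℕ (lookup C v)) _)))

  kSubsetsOf-∌ : ∀ {n} k (C : Subset n) a (P : Subset n → Bool) → lookup C a ≡ false →
    lsum (kSubsetsOf k C) (λ S → boolToℕ (lookup S a ∧ P S)) ≡ 0
  kSubsetsOf-∌ {n} k C a P a∉C = trans (lsum-kSubsetsOf k C (λ S → lookup S a ∧ P S))
    (trans (lsum-cong (allSubsets n) z) (trans (lsum-const (allSubsets n) 0) (ℕP.*-zeroʳ (length (allSubsets n)))))
    where
    z : ∀ S → boolToℕ ((∣ S ∣ ≡ᵇ k) ∧ ((S ⊆ᵇ C) ∧ (lookup S a ∧ P S))) ≡ 0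
    z S with S ⊆ᵇ C in S⊆C | lookup S a in a∈S
    ... | false | _     = cong boolToℕ (BP.∧-zeroʳ (∣ S ∣ ≡ᵇ k))
    ... | true  | false = cong boolToℕ (BP.∧-zeroʳ (∣ S ∣ ≡ᵇ k))
    ... | true  | true  with () ← trans (sym a∉C) (subst (λ x → (if x then lookup C a else true) ≡ true) a∈S
                                   (allF-elim (λ v → if lookup S v then lookup C v else true) S⊆C a))

  ∣∣-extract₂ : ∀ {n} (C : Subset n) a b → ¬ (a ≡ b) → lookup C a ≡ true →
    ∣ C ∣ ≡ 1 + (boolToℕ (lookup C b) + ΣF (λ i → if eqᵇ i a then 0 else (if eqᵇ i b then 0 else boolToℕ (lookup C i))))
  ∣∣-extract₂ C a b a≢b a∈C = begin
      ∣ C ∣                                              ≡⟨ ∣∣≡ΣF C ⟩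
      ΣF (λ i → boolToℕ (lookup C i))                    ≡⟨ ΣF-extract (λ i → boolToℕ (lookup C i)) a ⟩
      boolToℕ (lookup C a) + ΣF g                        ≡⟨ cong₂ _+_ (cong boolToℕ a∈C) (ΣF-extract g b) ⟩
      1 + (g b + ΣF (λ i → if eqᵇ i b then 0 else g i))  ≡⟨ cong₂ (λ u w → 1 + (u + w)) gb (ΣF-cong sw) ⟩
      1 + (boolToℕ (lookup C b) + ΣF (λ i → if eqᵇ i a then 0 else (if eqᵇ i b then 0 else boolToℕ (lookup C i)))) ∎
    where
    open ≡-Reasoning
    g = λ i → if eqᵇ i a then 0 else boolToℕ (lookup C i)
    sw : ∀ i → (if eqᵇ i b then 0 else g i) ≡ (if eqᵇ i a then 0 else (if eqᵇ i b then 0 else boolToℕ (lookup C i)))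
    sw i with eqᵇ i a | eqᵇ i b
    ... | true  | true  = refl
    ... | true  | false = refl
    ... | false | true  = refl
    ... | false | false = refl
    gb : g b ≡ boolToℕ (lookup C b)
    gb = cong (λ z → if z then 0 else boolToℕ (lookup C b)) (≢⇒eqᵇ-false b a (λ e → a≢b (sym e)))

  #kSubsetsOf-containing-avoiding : ∀ {n} k (C : Subset n) a b → ¬ (a ≡ b) → 1 ≤ k →
    lsum (kSubsetsOf k C) (λ S → boolToℕ (lookup S a ∧ not (lookup S b))) ≡ boolToℕ (lookup C a) * binom (∣ C ∣ ∸ (1 + boolToℕ (lookup C b))) (k ∸ 1)
  #kSubsetsOf-containing-avoiding {n} k C a b a≢b 1≤k with lookup C a in eCa
  ... | false = kSubsetsOf-∌ k C a (λ S → not (lookup S b)) eCa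
  ... | true = begin
      lsum (kSubsetsOf k C) (λ S → boolToℕ (P S))  ≡⟨ lsum-kSubsetsOf≡countMatching k C P lab me ⟩
      countMatching lab k  ≡⟨ cong (countMatching lab) (sym (trans (cong ((k ∸ 1) +_) eI) (trans (ℕP.+-comm (k ∸ 1) 1) (ℕP.m+[n∸m]≡n 1≤k)))) ⟩
      countMatching lab ((k ∸ 1) + nRequired lab)  ≡⟨ proj₁ (countFormula n lab) (k ∸ 1) ⟩
      binom (nFree lab) (k ∸ 1)  ≡⟨ cong (λ z → binom z (k ∸ 1)) eF ⟩
      binom (∣ C ∣ ∸ (1 + boolToℕ (lookup C b))) (k ∸ 1)  ≡⟨ sym (ℕP.+-identityʳ _) ⟩
      1 * binom (∣ C ∣ ∸ (1 + boolToℕ (lookup C b))) (k ∸ 1) ∎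
    where
    open ≡-Reasoning
    P = λ S → lookup S a ∧ not (lookup S b)
    I = λ i → eqᵇ i a
    O = λ i → eqᵇ i b
    hc : ∀ i → I i ≡ true → lookup C i ≡ true
    hc i e = trans (cong (lookup C) (eqᵇ⇒≡ i a e)) eCa
    ho : ∀ i → I i ≡ true → O i ≡ false
    ho i e = ≢⇒eqᵇ-false i b (λ i≡b → a≢b (trans (sym (eqᵇ⇒≡ i a e)) i≡b))
    lab = roleOf C I O
    me : ∀ S → (S ⊆ᵇ C) ∧ P S ≡ matches lab S
    me S = sym (trans (matches-roleOf C I O hc ho S)
              (cong ((S ⊆ᵇ C) ∧_) (cong₂ _∧_ (allF-at a (lookup S)) (allF-at b (λ i → not (lookup S i))))))
    pI : ∀ x o c → isRequired (if x then required else (if o then forbidden else (if c then free else forbidden))) ≡ (if x then 1 else 0)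
    pI true o c = refl
    pI false true c = refl
    pI false false true = refl
    pI false false false = refl
    pF : ∀ x o c → isFree (if x then required else (if o then forbidden else (if c then free else forbidden))) ≡ (if x then 0 else (if o then 0 else boolToℕ c))
    pF true o c = refl
    pF false true c = refl
    pF false false true = refl
    pF false false false = refl
    eI : nRequired lab ≡ 1
    eI = trans (ΣF-cong (λ i → pI (I i) (O i) (lookup C i))) (ΣF-indicator a)
    eC : ∣ C ∣ ≡ 1 + (boolToℕ (lookup C b) + nFree lab)
    eC = trans (∣∣-extract₂ C a b a≢b eCa)
               (cong (λ z → 1 + (boolToℕ (lookup C b) + z)) (sym (ΣF-cong (λ i → pF (I i) (O i) (lookup C i)))))
    eF : nFree lab ≡ ∣ C ∣ ∸ (1 + boolToℕ (lookup C b))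
    eF = sym (trans (cong (_∸ (1 + boolToℕ (lookup C b))) (trans eC (sym (ℕP.+-assoc 1 (boolToℕ (lookup C b)) (nFree lab)))))
               (ℕP.m+n∸m≡n (1 + boolToℕ (lookup C b)) (nFree lab)))


module Handshake where

  open import Data.Nat as ℕ using (ℕ; _+_; _*_; _≤_; _<_; _<ᵇ_)
  import Data.Nat.Properties as ℕP
  open import Data.Bool using (Bool; true; false; _∧_; if_then_else_; T)
  open import Data.Fin as Fin using (Fin; toℕ)
  import Data.Fin.Properties as FP
  open import Data.Vec using ([]; _∷_)
  import Data.Vec.Properties as VP
  open import Data.List as List using ([]; _∷_; map; filterᵇ; allFin)
  open import Data.List.Relation.Unary.All as All using (All; []; _∷_)
  import Data.List.Relation.Unary.All.Properties as AllP
  open import Data.Product using (_,_; _×_; proj₁; proj₂)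
  open import Data.Empty using (⊥-elim)
  open import Relation.Nullary using (¬_)
  open import Relation.Binary.PropositionalEquality
  open import Defs hiding (sym)
  open NatSums
  open SubsetCounting

  ltᵇ : ∀ {n} → Fin n → Fin n → Bool
  ltᵇ u v = toℕ u <ᵇ toℕ v

  ltᵇ-false : ∀ m n → (m <ᵇ n) ≡ false → n ≤ m
  ltᵇ-false m n e = ℕP.≮⇒≥ (λ m<n → subst T e (ℕP.<⇒<ᵇ m<n))

  ltᵇ-true : ∀ m n → (m <ᵇ n) ≡ true → m < n
  ltᵇ-true m n e = ℕP.<ᵇ⇒< m n (subst T (sym e) _)

  ltᵇ⇒≢ : ∀ {n} (u v : Fin n) → ltᵇ u v ≡ true → ¬ (u ≡ v)
  ltᵇ⇒≢ u v e refl = ℕP.<-irrefl refl (ltᵇ-true (toℕ u) (toℕ u) e)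

  boolToℕ-∧ : ∀ a b → boolToℕ (a ∧ b) ≡ boolToℕ a * boolToℕ b
  boolToℕ-∧ true true = refl
  boolToℕ-∧ true false = refl
  boolToℕ-∧ false b = refl

  boolToℕ-if : ∀ c x → (if c then x else 0) ≡ boolToℕ c * x
  boolToℕ-if true x = sym (ℕP.+-identityʳ x)
  boolToℕ-if false x = refl

  module _ {n : ℕ} (G : Graph n) where
    listed : Fin n → Fin n → Bool
    listed u v = ltᵇ u v ∧ adj G u v

    lsum-edges : ∀ (h : Fin n × Fin n → ℕ) → lsum (edges G) h ≡ ΣF (λ u → ΣF (λ v → boolToℕ (listed u v) * h (u , v)))
    lsum-edges h = trans (lsum-concatMap _ (allFin n) h) (ΣF-cong (λ u →
        trans (lsum-map (λ v → (u , v)) (filterᵇ (listed u) (allFin n)) h)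
          (trans (lsum-filter (listed u) (allFin n) (λ v → h (u , v))) (ΣF-cong (λ v → boolToℕ-if (listed u v) (h (u , v)))))))

    edges-listed : All (λ e → listed (proj₁ e) (proj₂ e) ≡ true) (edges G)
    edges-listed = AllP.concat⁺ (AllP.map⁺ (all-u (allFin n)))
      where
      all-u : ∀ L → All (λ u → All (λ e → listed (proj₁ e) (proj₂ e) ≡ true) (map (λ v → (u , v)) (filterᵇ (listed u) (allFin n)))) L
      all-u [] = []
      all-u (u ∷ L) = AllP.map⁺ (all-filter-map (allFin n)) ∷ all-u L
        where
        all-filter-map : ∀ M → All (λ v → listed u v ≡ true) (filterᵇ (listed u) M)
        all-filter-map M = all-filter (listed u) M

    edges-distinct : All (λ e → ¬ (proj₁ e ≡ proj₂ e)) (edges G)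
    edges-distinct = All.map (λ {e} e-listed → ltᵇ⇒≢ (proj₁ e) (proj₂ e) (∧-true⇒ˡ e-listed)) edges-listed
      where
      ∧-true⇒ˡ : ∀ {x y} → x ∧ y ≡ true → x ≡ true
      ∧-true⇒ˡ {true} _ = refl

    adj-split : ∀ u v → boolToℕ (adj G u v) ≡ boolToℕ (listed u v) + boolToℕ (listed v u)
    adj-split u v with ltᵇ u v in e1 | ltᵇ v u in e2
    ... | true | true = ⊥-elim (ℕP.<-asym (ltᵇ-true (toℕ u) (toℕ v) e1) (ltᵇ-true (toℕ v) (toℕ u) e2))
    ... | true | false = sym (ℕP.+-identityʳ _)
    ... | false | true = cong boolToℕ (Graph.sym G u v)
    ... | false | false = subst (λ w → boolToℕ (adj G u w) ≡ 0) uv (cong boolToℕ (Graph.irrefl G u))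
      where
      uv : u ≡ v
      uv = FP.toℕ-injective (ℕP.≤-antisym (ltᵇ-false (toℕ v) (toℕ u) e2) (ltᵇ-false (toℕ u) (toℕ v) e1))

    deg≡ΣF : ∀ u → deg G u ≡ ΣF (λ v → boolToℕ (adj G u v))
    deg≡ΣF u = trans (∣∣≡ΣF (nbhd G u)) (ΣF-cong (λ v → cong boolToℕ (VP.lookup∘tabulate (adj G u) v)))

    handshake : ∀ (c : Fin n → Bool) → ΣF (λ u → boolToℕ (c u) * deg G u) ≡ lsum (edges G) (λ e → boolToℕ (c (proj₁ e)) + boolToℕ (c (proj₂ e)))
    handshake c = begin
        ΣF (λ u → boolToℕ (c u) * deg G u)
          ≡⟨ ΣF-cong (λ u → trans (cong (boolToℕ (c u) *_) (deg≡ΣF u)) (sym (lsum-scale (allFin n) (boolToℕ (c u)) (λ v → boolToℕ (adj G u v))))) ⟩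
        ΣF (λ u → ΣF (λ v → boolToℕ (c u) * boolToℕ (adj G u v)))
          ≡⟨ ΣF-cong (λ u → ΣF-cong (λ v → trans (cong (boolToℕ (c u) *_) (adj-split u v)) (ℕP.*-distribˡ-+ (boolToℕ (c u)) (boolToℕ (listed u v)) (boolToℕ (listed v u))))) ⟩
        ΣF (λ u → ΣF (λ v → boolToℕ (c u) * boolToℕ (listed u v) + boolToℕ (c u) * boolToℕ (listed v u)))
          ≡⟨ ΣF-cong (λ u → lsum-+ (allFin n) (λ v → boolToℕ (c u) * boolToℕ (listed u v)) (λ v → boolToℕ (c u) * boolToℕ (listed v u))) ⟩
        ΣF (λ u → ΣF (λ v → boolToℕ (c u) * boolToℕ (listed u v)) + ΣF (λ v → boolToℕ (c u) * boolToℕ (listed v u)))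
          ≡⟨ lsum-+ (allFin n) (λ u → ΣF (λ v → boolToℕ (c u) * boolToℕ (listed u v))) (λ u → ΣF (λ v → boolToℕ (c u) * boolToℕ (listed v u))) ⟩
        ΣF (λ u → ΣF (λ v → boolToℕ (c u) * boolToℕ (listed u v))) + ΣF (λ u → ΣF (λ v → boolToℕ (c u) * boolToℕ (listed v u)))
          ≡⟨ cong (ΣF (λ u → ΣF (λ v → boolToℕ (c u) * boolToℕ (listed u v))) +_) (lsum-swap (allFin n) (allFin n) (λ u v → boolToℕ (c u) * boolToℕ (listed v u))) ⟩
        ΣF (λ u → ΣF (λ v → boolToℕ (c u) * boolToℕ (listed u v))) + ΣF (λ v → ΣF (λ u → boolToℕ (c u) * boolToℕ (listed v u)))
          ≡⟨ sym (lsum-+ (allFin n) (λ u → ΣF (λ v → boolToℕ (c u) * boolToℕ (listed u v))) (λ u → ΣF (λ v → boolToℕ (c v) * boolToℕ (listed u v)))) ⟩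
        ΣF (λ u → ΣF (λ v → boolToℕ (c u) * boolToℕ (listed u v)) + ΣF (λ v → boolToℕ (c v) * boolToℕ (listed u v)))
          ≡⟨ ΣF-cong (λ u → trans (sym (lsum-+ (allFin n) (λ v → boolToℕ (c u) * boolToℕ (listed u v)) (λ v → boolToℕ (c v) * boolToℕ (listed u v)))) (ΣF-cong (λ v → f u v))) ⟩
        ΣF (λ u → ΣF (λ v → boolToℕ (listed u v) * (boolToℕ (c u) + boolToℕ (c v))))
          ≡⟨ sym (lsum-edges (λ e → boolToℕ (c (proj₁ e)) + boolToℕ (c (proj₂ e)))) ⟩
        lsum (edges G) (λ e → boolToℕ (c (proj₁ e)) + boolToℕ (c (proj₂ e))) ∎
      where
      open ≡-Reasoning
      f : ∀ u v → boolToℕ (c u) * boolToℕ (listed u v) + boolToℕ (c v) * boolToℕ (listed u v) ≡ boolToℕ (listed u v) * (boolToℕ (c u) + boolToℕ (c v))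
      f u v = trans (sym (ℕP.*-distribʳ-+ (boolToℕ (listed u v)) (boolToℕ (c u)) (boolToℕ (c v)))) (ℕP.*-comm _ (boolToℕ (listed u v)))


module SeedAverages where

  open import Data.Nat as ℕ using (ℕ; zero; suc; _+_; _*_; _∸_; _≤_; _<_; z≤n; s≤s)
  import Data.Nat.Properties as ℕP
  open import Data.Bool using (Bool; true; false; not; _∧_; _xor_)
  open import Data.Fin as Fin using (Fin)
  open import Data.Fin.Subset using (Subset; ∣_∣; _∩_; ⊤)
  import Data.Fin.Subset.Properties as SP
  open import Data.Vec using ([]; _∷_; lookup)
  import Data.Vec.Properties as VP
  open import Data.List as List using ([]; _∷_; length; allFin)
  open import Data.List.Relation.Unary.All as All using (All; []; _∷_)
  open import Data.Product using (_×_; proj₁; proj₂)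
  open import Relation.Binary.PropositionalEquality
  open import Relation.Nullary using (¬_)
  open import Defs hiding (sym)
  open NatSums
  open SubsetCounting
  open Handshake
  open Binomial

  xor-split : ∀ x y → boolToℕ (x xor y) ≡ boolToℕ (x ∧ not y) + boolToℕ (y ∧ not x)
  xor-split true true = refl
  xor-split true false = refl
  xor-split false true = refl
  xor-split false false = refl

  degSum-handshake : ∀ {n} (G : Graph n) (C : Subset n) → degSum G C ≡ lsum (edges G) (λ e → boolToℕ (lookup C (proj₁ e)) + boolToℕ (lookup C (proj₂ e)))
  degSum-handshake {n} G C = trans (ΣF-cong (λ u → boolToℕ-if (lookup C u) (deg G u))) (handshake G (lookup C))

  lsum-cutSize-swap : ∀ {n} (G : Graph n) k (C : Subset n) →
    lsum (kSubsetsOf k C) (cutSize G) ≡ lsum (edges G) (λ e → lsum (kSubsetsOf k C) (λ S → boolToℕ (lookup S (proj₁ e) xor lookup S (proj₂ e))))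
  lsum-cutSize-swap {n} G k C = trans (lsum-cong (kSubsetsOf k C) (λ S → countᵇ-lsum _ (edges G)))
                          (lsum-swap (kSubsetsOf k C) (edges G) (λ S e → boolToℕ (lookup S (proj₁ e) xor lookup S (proj₂ e))))

  #kSubsetsOf-separating : ∀ {n} k (C : Subset n) (a b : Fin n) → ¬ (a ≡ b) → 1 ≤ k →
    lsum (kSubsetsOf k C) (λ S → boolToℕ (lookup S a xor lookup S b))
      ≡ boolToℕ (lookup C a) * binom (∣ C ∣ ∸ (1 + boolToℕ (lookup C b))) (k ∸ 1) + boolToℕ (lookup C b) * binom (∣ C ∣ ∸ (1 + boolToℕ (lookup C a))) (k ∸ 1)
  #kSubsetsOf-separating k C a b a≢b 1≤k = trans (lsum-cong (kSubsetsOf k C) (λ S → xor-split (lookup S a) (lookup S b)))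
     (trans (lsum-+ (kSubsetsOf k C) (λ S → boolToℕ (lookup S a ∧ not (lookup S b))) (λ S → boolToℕ (lookup S b ∧ not (lookup S a))))
       (cong₂ _+_ (#kSubsetsOf-containing-avoiding k C a b a≢b 1≤k) (#kSubsetsOf-containing-avoiding k C b a (λ e → a≢b (sym e)) 1≤k)))

  r∸2≤r∸[1+x] : ∀ r x → x ≤ 1 → r ∸ 2 ≤ r ∸ (1 + x)
  r∸2≤r∸[1+x] r zero _ = ℕP.∸-monoʳ-≤ r (s≤s z≤n)
  r∸2≤r∸[1+x] r (suc zero) _ = ℕP.≤-refl
  r∸2≤r∸[1+x] r (suc (suc x)) (s≤s ())

  boolToℕ≤1 : ∀ b → boolToℕ b ≤ 1
  boolToℕ≤1 true = ℕP.≤-refl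
  boolToℕ≤1 false = z≤n

  binom*degSum≤lsum-cutSize : ∀ {n} (G : Graph n) (C : Subset n) r k → ∣ C ∣ ≡ r → 1 ≤ k → k < r →
         binom (r ∸ 2) (k ∸ 1) * degSum G C ≤ lsum (kSubsetsOf k C) (cutSize G)
  binom*degSum≤lsum-cutSize {n} G C r k Cr 1≤k k<r = begin
      B * degSum G C  ≡⟨ cong (B *_) (degSum-handshake G C) ⟩
      B * lsum (edges G) (λ e → ca e + cb e)  ≡⟨ sym (lsum-scale (edges G) B (λ e → ca e + cb e)) ⟩
      lsum (edges G) (λ e → B * (ca e + cb e))  ≤⟨ lsum-mono-All (edges G) (All.map (λ {e} → one (proj₁ e) (proj₂ e)) (edges-distinct G)) ⟩
      lsum (edges G) (λ e → lsum (kSubsetsOf k C) (λ S → boolToℕ (lookup S (proj₁ e) xor lookup S (proj₂ e))))  ≡⟨ sym (lsum-cutSize-swap G k C) ⟩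
      lsum (kSubsetsOf k C) (cutSize G) ∎
    where
    open ℕP.≤-Reasoning
    B = binom (r ∸ 2) (k ∸ 1)
    ca = λ (e : Fin n × Fin n) → boolToℕ (lookup C (proj₁ e))
    cb = λ (e : Fin n × Fin n) → boolToℕ (lookup C (proj₂ e))
    B≤ : ∀ x → B ≤ binom (∣ C ∣ ∸ (1 + boolToℕ x)) (k ∸ 1)
    B≤ x = binom-mono (k ∸ 1) (subst (λ z → r ∸ 2 ≤ z ∸ (1 + boolToℕ x)) (sym Cr) (r∸2≤r∸[1+x] r _ (boolToℕ≤1 x)))
    one : ∀ a b → ¬ (a ≡ b) → B * (boolToℕ (lookup C a) + boolToℕ (lookup C b)) ≤ lsum (kSubsetsOf k C) (λ S → boolToℕ (lookup S a xor lookup S b))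
    one a b a≢b = begin
      B * (boolToℕ (lookup C a) + boolToℕ (lookup C b))  ≡⟨ ℕP.*-distribˡ-+ B (boolToℕ (lookup C a)) (boolToℕ (lookup C b)) ⟩
      B * boolToℕ (lookup C a) + B * boolToℕ (lookup C b)  ≡⟨ cong₂ _+_ (ℕP.*-comm B _) (ℕP.*-comm B _) ⟩
      boolToℕ (lookup C a) * B + boolToℕ (lookup C b) * B
        ≤⟨ ℕP.+-mono-≤ (ℕP.*-monoʳ-≤ (boolToℕ (lookup C a)) (B≤ (lookup C b))) (ℕP.*-monoʳ-≤ (boolToℕ (lookup C b)) (B≤ (lookup C a))) ⟩
      boolToℕ (lookup C a) * binom (∣ C ∣ ∸ (1 + boolToℕ (lookup C b))) (k ∸ 1) + boolToℕ (lookup C b) * binom (∣ C ∣ ∸ (1 + boolToℕ (lookup C a))) (k ∸ 1)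
        ≡⟨ sym (#kSubsetsOf-separating k C a b a≢b 1≤k) ⟩
      lsum (kSubsetsOf k C) (λ S → boolToℕ (lookup S a xor lookup S b)) ∎

  lsum-cutSize-all : ∀ {n} (G : Graph n) k → 1 ≤ k → k < n →
         lsum (kSubsetsOf k (⊤ {n})) (cutSize G) ≡ binom (n ∸ 2) (k ∸ 1) * degSum G ⊤
  lsum-cutSize-all {n} G k 1≤k k<n = begin
      lsum (kSubsetsOf k ⊤) (cutSize G)  ≡⟨ lsum-cutSize-swap G k ⊤ ⟩
      lsum (edges G) (λ e → lsum (kSubsetsOf k ⊤) (λ S → boolToℕ (lookup S (proj₁ e) xor lookup S (proj₂ e))))
        ≡⟨ lsum-cong-All (edges G) (All.map (λ {e} → one (proj₁ e) (proj₂ e)) (edges-distinct G)) ⟩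
      lsum (edges G) (λ e → B * (boolToℕ (lookup ⊤ (proj₁ e)) + boolToℕ (lookup ⊤ (proj₂ e))))
        ≡⟨ lsum-scale (edges G) B _ ⟩
      B * lsum (edges G) (λ e → boolToℕ (lookup ⊤ (proj₁ e)) + boolToℕ (lookup ⊤ (proj₂ e)))  ≡⟨ cong (B *_) (sym (degSum-handshake G ⊤)) ⟩
      B * degSum G ⊤ ∎
    where
    open ≡-Reasoning
    B = binom (n ∸ 2) (k ∸ 1)
    t : ∀ a → lookup (⊤ {n}) a ≡ true
    t a = VP.lookup-replicate a true
    one : ∀ a b → ¬ (a ≡ b) → lsum (kSubsetsOf k ⊤) (λ S → boolToℕ (lookup S a xor lookup S b)) ≡ B * (boolToℕ (lookup ⊤ a) + boolToℕ (lookup ⊤ b))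
    one a b a≢b rewrite #kSubsetsOf-separating k ⊤ a b a≢b 1≤k | t a | t b | SP.∣⊤∣≡n n =
      trans (cong₂ _+_ (ℕP.+-identityʳ B) (ℕP.+-identityʳ B))
            (sym (trans (ℕP.*-distribˡ-+ B 1 1) (cong₂ _+_ (ℕP.*-identityʳ B) (ℕP.*-identityʳ B))))

  length-kSubsetsOf : ∀ {n} (C : Subset n) r k → ∣ C ∣ ≡ r → length (kSubsetsOf k C) ≡ binom r k
  length-kSubsetsOf C r k Cr = trans (length-kSubsetsOf′ k C) (cong (λ z → binom z k) Cr)

  missedIn : ∀ {n} → Subset n → Subset n → ℕ
  missedIn Y S = ΣF (λ v → boolToℕ (lookup Y v ∧ not (lookup S v)))

  ∣∩∣≡ΣF : ∀ {n} (Y C : Subset n) → ∣ Y ∩ C ∣ ≡ ΣF (λ v → boolToℕ (lookup Y v ∧ lookup C v))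
  ∣∩∣≡ΣF Y C = trans (∣∣≡ΣF (Y ∩ C)) (ΣF-cong (λ v → cong boolToℕ (VP.lookup-zipWith _∧_ v Y C)))

  lsum-missedIn : ∀ {n} (Y C : Subset n) r k → ∣ C ∣ ≡ r →
         lsum (kSubsetsOf k C) (missedIn Y) ≡ ∣ Y ∩ C ∣ * binom (r ∸ 1) k + (∣ Y ∣ ∸ ∣ Y ∩ C ∣) * binom r k
  lsum-missedIn {n} Y C r k Cr = begin
      lsum LC (λ S → ΣF (λ v → boolToℕ (lookup Y v ∧ not (lookup S v))))
        ≡⟨ lsum-swap LC (allFin n) (λ S v → boolToℕ (lookup Y v ∧ not (lookup S v))) ⟩
      ΣF (λ v → lsum LC (λ S → boolToℕ (lookup Y v ∧ not (lookup S v))))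
        ≡⟨ ΣF-cong (λ v → trans (lsum-cong LC (λ S → boolToℕ-∧ (lookup Y v) (not (lookup S v))))
                          (trans (lsum-scale LC (boolToℕ (lookup Y v)) (λ S → boolToℕ (not (lookup S v))))
                             (cong (boolToℕ (lookup Y v) *_) (#kSubsetsOf-avoiding k C v)))) ⟩
      ΣF (λ v → boolToℕ (lookup Y v) * binom (∣ C ∣ ∸ boolToℕ (lookup C v)) k)
        ≡⟨ ΣF-cong (λ v → pw (lookup Y v) (lookup C v)) ⟩
      ΣF (λ v → YC v * binom (r ∸ 1) k + YnC v * binom r k)
        ≡⟨ lsum-+ (allFin n) (λ v → YC v * binom (r ∸ 1) k) (λ v → YnC v * binom r k) ⟩
      ΣF (λ v → YC v * binom (r ∸ 1) k) + ΣF (λ v → YnC v * binom r k)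
        ≡⟨ cong₂ _+_ (trans (ΣF-cong (λ v → ℕP.*-comm (YC v) (binom (r ∸ 1) k))) (trans (lsum-scale (allFin n) (binom (r ∸ 1) k) YC) (ℕP.*-comm (binom (r ∸ 1) k) (ΣF YC))))
                     (trans (ΣF-cong (λ v → ℕP.*-comm (YnC v) (binom r k))) (trans (lsum-scale (allFin n) (binom r k) YnC) (ℕP.*-comm (binom r k) (ΣF YnC)))) ⟩
      ΣF YC * binom (r ∸ 1) k + ΣF YnC * binom r k
        ≡⟨ cong₂ (λ u w → u * binom (r ∸ 1) k + w * binom r k) (sym (∣∩∣≡ΣF Y C)) eYnC ⟩
      ∣ Y ∩ C ∣ * binom (r ∸ 1) k + (∣ Y ∣ ∸ ∣ Y ∩ C ∣) * binom r k ∎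
    where
    open ≡-Reasoning
    LC = kSubsetsOf k C
    YC = λ v → boolToℕ (lookup Y v ∧ lookup C v)
    YnC = λ v → boolToℕ (lookup Y v ∧ not (lookup C v))
    pw : ∀ y c → boolToℕ y * binom (∣ C ∣ ∸ boolToℕ c) k ≡ boolToℕ (y ∧ c) * binom (r ∸ 1) k + boolToℕ (y ∧ not c) * binom r k
    pw true true rewrite Cr = sym (ℕP.+-identityʳ _)
    pw true false rewrite Cr = refl
    pw false c = refl
    eY : ∣ Y ∣ ≡ ΣF YC + ΣF YnC
    eY = trans (∣∣≡ΣF Y) (trans (ΣF-cong (λ v → sp (lookup Y v) (lookup C v))) (lsum-+ (allFin n) YC YnC))
      where
      sp : ∀ y c → boolToℕ y ≡ boolToℕ (y ∧ c) + boolToℕ (y ∧ not c)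
      sp true true = refl
      sp true false = refl
      sp false c = refl
    eYnC : ΣF YnC ≡ ∣ Y ∣ ∸ ∣ Y ∩ C ∣
    eYnC = sym (trans (cong₂ _∸_ eY (∣∩∣≡ΣF Y C)) (ℕP.m+n∸m≡n (ΣF YC) (ΣF YnC)))

  kSubsetsOf-size : ∀ {n} k (C : Subset n) → All (λ S → ∣ S ∣ ≡ k) (kSubsetsOf k C)
  kSubsetsOf-size {n} k C = go (kSubsetsOf k C) (all-filter (λ S → (∣ S ∣ ℕ.≡ᵇ k) ∧ (S ⊆ᵇ C)) (allSubsets n))
    where
    go : ∀ L → All (λ S → ((∣ S ∣ ℕ.≡ᵇ k) ∧ (S ⊆ᵇ C)) ≡ true) L → All (λ S → ∣ S ∣ ≡ k) L
    go [] [] = []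
    go (S ∷ L) (h ∷ hs) = ℕP.≡ᵇ⇒≡ ∣ S ∣ k (l h) ∷ go L hs
      where
      l : ∀ {x y} → x ∧ y ≡ true → Data.Bool.T x
      l {true} _ = _


module Reachability where

  open import Data.Nat as ℕ using (ℕ; zero; suc; _+_; _≤_; z≤n; s≤s)
  import Data.Nat.Properties as ℕP
  open import Data.Bool using (Bool; true; false; not; _∧_; _∨_; if_then_else_)
  open import Data.Fin as Fin using (Fin)
  open import Data.Fin.Subset using (Subset; ∣_∣)
  import Data.Fin.Subset.Properties as SP
  open import Data.Vec using ([]; _∷_; lookup)
  import Data.Vec.Properties as VP
  open import Data.List as List using (List; []; _∷_; allFin)
  open import Data.List.Membership.Propositional using (_∈_)
  open import Data.List.Membership.Propositional.Properties using (∈-allFin)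
  open import Data.List.Relation.Unary.Any using (here; there)
  open import Data.Bool.ListAction using (any; all)
  open import Data.Product using (_,_; _×_; proj₁; proj₂; ∃)
  open import Data.Sum using (_⊎_; inj₁; inj₂)
  open import Data.Empty using (⊥; ⊥-elim)
  open import Relation.Nullary using (¬_)
  open import Relation.Binary.PropositionalEquality
  open import Defs hiding (sym)
  open NatSums
  open SubsetCounting

  any-true : ∀ {X : Set} (p : X → Bool) (L : List X) {x} → x ∈ L → p x ≡ true → any p L ≡ true
  any-true p (y ∷ L) (here refl) e rewrite e = refl
  any-true p (y ∷ L) (there m) e with p y
  ... | true = refl
  ... | false = any-true p L m e

  any-elim : ∀ {X : Set} (p : X → Bool) (L : List X) → any p L ≡ true → ∃ λ x → x ∈ L × p x ≡ true
  any-elim p (y ∷ L) e with p y in ey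
  ... | true = y , here refl , ey
  ... | false = let (x , m , ex) = any-elim p L e in x , there m , ex

  any-false : ∀ {X : Set} (p : X → Bool) (L : List X) → (∀ x → x ∈ L → p x ≡ false) → any p L ≡ false
  any-false p [] h = refl
  any-false p (y ∷ L) h rewrite h y (here refl) = any-false p L (λ x m → h x (there m))

  all-wit : ∀ {X : Set} (p : X → Bool) (L : List X) → all p L ≡ false → ∃ λ x → p x ≡ false
  all-wit p (y ∷ L) e with p y in ey
  ... | true = all-wit p L e
  ... | false = y , ey

  ∨-l : ∀ {a b} → a ≡ true → a ∨ b ≡ true
  ∨-l {true} _ = refl
  ∨-r : ∀ {a b} → b ≡ true → a ∨ b ≡ true
  ∨-r {true} _ = refl
  ∨-r {false} e = e
  ∨-elim : ∀ {a b} → a ∨ b ≡ true → a ≡ true ⊎ b ≡ true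
  ∨-elim {true} _ = inj₁ refl
  ∨-elim {false} e = inj₂ e
  ∧-intro : ∀ {a b} → a ≡ true → b ≡ true → a ∧ b ≡ true
  ∧-intro refl refl = refl
  ∧-elim₁ : ∀ {a b} → a ∧ b ≡ true → a ≡ true
  ∧-elim₁ {true} _ = refl
  ∧-elim₂ : ∀ {a b} → a ∧ b ≡ true → b ≡ true
  ∧-elim₂ {true} e = e

  true≢false : true ≡ false → ⊥
  true≢false ()

  Sub : ∀ {n} → Subset n → Subset n → Set
  Sub A B = ∀ v → lookup A v ≡ true → lookup B v ≡ true

  card-mono : ∀ {n} (A B : Subset n) → Sub A B → ∣ A ∣ ≤ ∣ B ∣
  card-mono {n} A B h = subst₂ _≤_ (sym (∣∣≡ΣF A)) (sym (∣∣≡ΣF B)) (lsum-mono (allFin n) (λ v → pw v))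
    where
    pw : ∀ v → boolToℕ (lookup A v) ≤ boolToℕ (lookup B v)
    pw v with lookup A v in e
    ... | false = z≤n
    ... | true rewrite h v e = ℕP.≤-refl

  card-strict : ∀ {n} (A B : Subset n) → Sub A B → ∀ v → lookup B v ≡ true → lookup A v ≡ false → suc ∣ A ∣ ≤ ∣ B ∣
  card-strict {n} A B h v eB eA = subst₂ _≤_ (cong suc (sym (trans (∣∣≡ΣF A) (trans (ΣF-extract (λ i → boolToℕ (lookup A i)) v) (cong (_+ RA) (cong boolToℕ eA))))))
                                     (sym (trans (∣∣≡ΣF B) (trans (ΣF-extract (λ i → boolToℕ (lookup B i)) v) (cong (_+ RB) (cong boolToℕ eB)))))
                                     (s≤s (lsum-mono (allFin n) (λ i → pw i)))
    where
    RA = ΣF (λ i → if eqᵇ i v then 0 else boolToℕ (lookup A i))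
    RB = ΣF (λ i → if eqᵇ i v then 0 else boolToℕ (lookup B i))
    pw : ∀ i → (if eqᵇ i v then 0 else boolToℕ (lookup A i)) ≤ (if eqᵇ i v then 0 else boolToℕ (lookup B i))
    pw i with eqᵇ i v
    ... | true = z≤n
    ... | false with lookup A i in e
    ... | false = z≤n
    ... | true rewrite h i e = ℕP.≤-refl

  nonempty-member : ∀ {n} (S : Subset n) → 1 ≤ ∣ S ∣ → ∃ λ s → lookup S s ≡ true
  nonempty-member {n} S h with allF (λ s → not (lookup S s)) in e
  ... | false = let (s , es) = all-wit (λ s → not (lookup S s)) (allFin n) e in s , nn es
    where
    nn : ∀ {a} → not a ≡ false → a ≡ true
    nn {true} _ = refl
  ... | true = ⊥-elim (ℕP.<-irrefl refl (ℕP.<-≤-trans h (ℕP.≤-reflexive (trans (∣∣≡ΣF S) (trans (ΣF-cong z) (ΣF-zero {n}))))))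
    where
    z : ∀ i → boolToℕ (lookup S i) ≡ 0
    z i with lookup S i in ei
    ... | false = refl
    ... | true = ⊥-elim (true≢false (sym (trans (cong not (sym ei)) (allF-elim (λ s → not (lookup S s)) e i))))

  ∃-member-≢ : ∀ {n} (S : Subset n) → 2 ≤ ∣ S ∣ → ∀ w → ∃ λ s → lookup S s ≡ true × ¬ (s ≡ w)
  ∃-member-≢ {n} S h w with allF (λ s → not (lookup S s) ∨ eqᵇ s w) in e
  ... | false = let (s , es) = all-wit (λ s → not (lookup S s) ∨ eqᵇ s w) (allFin n) e in s , nn es
    where
    nn : ∀ {s} → not (lookup S s) ∨ eqᵇ s w ≡ false → lookup S s ≡ true × ¬ (s ≡ w)
    nn {s} ee with lookup S s | eqᵇ s w in eq
    ... | true | false = refl , (λ s≡w → true≢false (trans (sym (subst (λ z → eqᵇ s z ≡ true) s≡w (eqᵇ-refl s))) eq))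
    nn {s} () | false | _
    nn {s} () | true | true
  ... | true = ⊥-elim (ℕP.<-irrefl refl (ℕP.<-≤-trans h (ℕP.≤-trans (ℕP.≤-reflexive (∣∣≡ΣF S))
                          (ℕP.≤-trans (lsum-mono (allFin n) pw) (ℕP.≤-reflexive (ΣF-indicator w))))))
    where
    pw : ∀ i → boolToℕ (lookup S i) ≤ (if eqᵇ i w then 1 else 0)
    pw i with lookup S i in ei | allF-elim (λ s → not (lookup S s) ∨ eqᵇ s w) e i
    ... | false | _ = z≤n
    ... | true | ew rewrite ew = ℕP.≤-refl

  module Closure {n : ℕ} (G : Graph n) (F : List (Fin n × Fin n)) where
    extend : Subset n → Subset n
    extend = grow G F

    Closed : Subset n → Set
    Closed T = ∀ u v → lookup T u ≡ true → keptAdj G F u v ≡ true → lookup T v ≡ true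

    lookup-extend : ∀ R v → lookup (extend R) v ≡ lookup R v ∨ any (λ u → lookup R u ∧ keptAdj G F u v) (allFin n)
    lookup-extend R v = VP.lookup∘tabulate _ v

    extend-⊇ : ∀ R → Sub R (extend R)
    extend-⊇ R v e = trans (lookup-extend R v) (∨-l e)

    extend-step : ∀ R u v → lookup R u ≡ true → keptAdj G F u v ≡ true → lookup (extend R) v ≡ true
    extend-step R u v eu ek = trans (lookup-extend R v) (∨-r (any-true _ (allFin n) (∈-allFin u) (∧-intro eu ek)))

    extend-elim : ∀ R v → lookup (extend R) v ≡ true → lookup R v ≡ true ⊎ ∃ λ u → lookup R u ≡ true × keptAdj G F u v ≡ true
    extend-elim R v e with ∨-elim (trans (sym (lookup-extend R v)) e)
    ... | inj₁ x = inj₁ x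
    ... | inj₂ y = let (u , _ , eu) = any-elim _ (allFin n) y in inj₂ (u , ∧-elim₁ eu , ∧-elim₂ eu)

    extend-mono : ∀ A B → Sub A B → Sub (extend A) (extend B)
    extend-mono A B h v e with extend-elim A v e
    ... | inj₁ x = extend-⊇ B v (h v x)
    ... | inj₂ (u , eu , ek) = extend-step B u v (h u eu) ek

    extendⁿ : ℕ → Subset n → Subset n
    extendⁿ m S = iter G m extend S

    extendⁿ-⊇ : ∀ m S → Sub S (extendⁿ m S)
    extendⁿ-⊇ zero S v e = e
    extendⁿ-⊇ (suc m) S v e = extend-⊇ (extendⁿ m S) v (extendⁿ-⊇ m S v e)

    extend⊆extendⁿ : ∀ m S → Sub (extend S) (extendⁿ (suc m) S)
    extend⊆extendⁿ m S = extend-mono S (extendⁿ m S) (extendⁿ-⊇ m S)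

    extendⁿ⊆closed : ∀ m S T → Sub S T → Closed T → Sub (extendⁿ m S) T
    extendⁿ⊆closed zero S T h c = h
    extendⁿ⊆closed (suc m) S T h c v e with extend-elim (extendⁿ m S) v e
    ... | inj₁ x = extendⁿ⊆closed m S T h c v x
    ... | inj₂ (u , eu , ek) = c u v (extendⁿ⊆closed m S T h c u eu) ek

    extend-closed : ∀ R → Closed R → Closed (extend R)
    extend-closed R c u v eu ek with extend-elim R u eu
    ... | inj₁ x = extend-⊇ R v (c u v x ek)
    ... | inj₂ (w , ew , ek') = extend-⊇ R v (c u v (c w u ew ek') ek)

    stable⇒closed : ∀ R → Sub (extend R) R → Closed R
    stable⇒closed R h u v eu ek = h v (extend-step R u v eu ek)

    closed-or-growing : ∀ S → 1 ≤ ∣ S ∣ → ∀ i → Closed (extendⁿ i S) ⊎ suc i ≤ ∣ extendⁿ i S ∣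
    closed-or-growing S h zero = inj₂ h
    closed-or-growing S h (suc i) with closed-or-growing S h i
    ... | inj₁ c = inj₁ (extend-closed (extendⁿ i S) c)
    ... | inj₂ big with allF (λ v → if lookup (extend (extendⁿ i S)) v then lookup (extendⁿ i S) v else true) in e
    ... | true = inj₁ (extend-closed (extendⁿ i S) (stable⇒closed (extendⁿ i S) st))
      where
      st : Sub (extend (extendⁿ i S)) (extendⁿ i S)
      st v ev = subst (λ z → (if z then lookup (extendⁿ i S) v else true) ≡ true) ev
                  (allF-elim (λ v → if lookup (extend (extendⁿ i S)) v then lookup (extendⁿ i S) v else true) e v)
    ... | false = inj₂ (ℕP.≤-trans (s≤s big) (card-strict (extendⁿ i S) (extend (extendⁿ i S)) (extend-⊇ (extendⁿ i S)) v (proj₁ vv) (proj₂ vv)))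
      where
      w = all-wit (λ v → if lookup (extend (extendⁿ i S)) v then lookup (extendⁿ i S) v else true) (allFin n) e
      v = proj₁ w
      vv : lookup (extend (extendⁿ i S)) v ≡ true × lookup (extendⁿ i S) v ≡ false
      vv with lookup (extend (extendⁿ i S)) v | proj₂ w
      ... | true | ee = refl , ee

    -- A set that is not yet closed gains a vertex at every step, and it has at most n of them.
    reachFrom-closed : ∀ S → 1 ≤ ∣ S ∣ → Closed (reachFrom G F S)
    reachFrom-closed S h with closed-or-growing S h n
    ... | inj₁ c = c
    ... | inj₂ big = ⊥-elim (ℕP.<-irrefl refl (ℕP.<-≤-trans big (SP.∣p∣≤n (extendⁿ n S))))


module SmallEdgeProbability where

  open import Data.Nat as ℕ using (ℕ; zero; suc; _+_; _*_; _≤_; z≤n; s≤s)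
  import Data.Nat.Properties as ℕP
  open import Data.Bool using (Bool; true; false; _∧_; _∨_; if_then_else_)
  open import Data.Fin as Fin using (Fin)
  import Data.Fin.Properties as FP
  open import Data.Fin.Subset using (Subset; ∣_∣)
  import Data.Fin.Subset.Properties as SP
  open import Data.Vec using ([]; _∷_; lookup; tabulate)
  import Data.Vec.Properties as VP
  open import Data.List as List using (List; []; _∷_; length; allFin)
  open import Data.Product using (_,_; _×_; proj₁; proj₂)
  open import Data.Sum using (_⊎_; inj₁; inj₂)
  open import Data.Empty using (⊥-elim)
  open import Relation.Binary.PropositionalEquality
  open import Data.Rational as Q using (ℚ; 0ℚ; 1ℚ) renaming (_≤_ to _≤ℚ_)
  open import Defs hiding (sym)
  open NatSums
  open SubsetCounting
  open Reachability
  open Percolation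
  open NatCast

  expectedClusterSize≡𝔼 : ∀ {n} (G : Graph n) β S → expectedClusterSize G β S ≡ 𝔼 β (edges G) (λ F → ℕ→ℚ ∣ reachFrom G F S ∣)
  expectedClusterSize≡𝔼 G β S = expectationOverSublists≡𝔼 β (edges G) (λ F → ℕ→ℚ ∣ reachFrom G F S ∣)

  countᵇ≤length : ∀ {X : Set} (p : X → Bool) L → countᵇ p L ≤ length L
  countᵇ≤length p [] = z≤n
  countᵇ≤length p (x ∷ L) with p x
  ... | true = s≤s (countᵇ≤length p L)
  ... | false = ℕP.m≤n⇒m≤1+n (countᵇ≤length p L)

  module Reached {n : ℕ} (G : Graph n) (S : Subset n) where
    crossing : Fin n × Fin n → Bool
    crossing e = crosses G S (proj₁ e) (proj₂ e)
    #crossing : List (Fin n × Fin n) → ℕ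
    #crossing F = countᵇ crossing F
    reached : List (Fin n × Fin n) → Subset n
    reached F = reachFrom G F S

    reached-[] : ∣ reached [] ∣ ≡ ∣ S ∣
    reached-[] = ℕP.≤-antisym (card-mono (reached []) S (Closure.extendⁿ⊆closed G [] n S S (λ v e → e) (λ u v _ ())))
                             (card-mono S (reached []) (Closure.extendⁿ-⊇ G [] n S))

    keptAdj-single : ∀ a b u v → keptAdj G ((a , b) ∷ []) u v ≡ true → (u ≡ a × v ≡ b) ⊎ (u ≡ b × v ≡ a)
    keptAdj-single a b u v e with ∨-elim e
    ... | inj₂ ()
    ... | inj₁ e' with ∨-elim e'
    ... | inj₁ h = inj₁ (sym (eqᵇ⇒≡ a u (∧-elim₁ h)) , sym (eqᵇ⇒≡ b v (∧-elim₂ h)))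
    ... | inj₂ h = inj₂ (sym (eqᵇ⇒≡ b u (∧-elim₂ h)) , sym (eqᵇ⇒≡ a v (∧-elim₁ h)))

    keptAdj-single-ab : ∀ a b → keptAdj G ((a , b) ∷ []) a b ≡ true
    keptAdj-single-ab a b = ∨-l {b = false} (∨-l {b = eqᵇ a b ∧ eqᵇ b a} (∧-intro (eqᵇ-refl a) (eqᵇ-refl b)))

    keptAdj-single-ba : ∀ a b → keptAdj G ((a , b) ∷ []) b a ≡ true
    keptAdj-single-ba a b = ∨-l {b = false} (∨-r {a = eqᵇ a b ∧ eqᵇ b a} (∧-intro (eqᵇ-refl a) (eqᵇ-refl b)))

    seed⊆reached : ∀ F → Sub S (reached F)
    seed⊆reached F = Closure.extendⁿ-⊇ G F n S

    grow⊆reached : ∀ F → Sub (grow G F S) (reached F)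
    grow⊆reached F v = go n refl v
      where
      go : ∀ k → k ≡ n → Sub (grow G F S) (reached F)
      go zero e = ⊥-elim (FP.¬Fin0 (subst Fin (sym e) v))
      go (suc m) e = subst (λ k → Sub (grow G F S) (iter G k (grow G F) S)) e (Closure.extend⊆extendⁿ G F m S)

    reached-single-lower : ∀ a b → ∣ S ∣ + boolToℕ (crosses G S a b) ≤ ∣ reached ((a , b) ∷ []) ∣
    reached-single-lower a b with lookup S a in ea | lookup S b in eb
    ... | true | true = subst (_≤ ∣ reached ((a , b) ∷ []) ∣) (sym (ℕP.+-identityʳ ∣ S ∣)) (card-mono S (reached ((a , b) ∷ [])) (seed⊆reached ((a , b) ∷ [])))
    ... | false | false = subst (_≤ ∣ reached ((a , b) ∷ []) ∣) (sym (ℕP.+-identityʳ ∣ S ∣)) (card-mono S (reached ((a , b) ∷ [])) (seed⊆reached ((a , b) ∷ [])))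
    ... | true | false = subst (_≤ ∣ reached ((a , b) ∷ []) ∣) (ℕP.+-comm 1 ∣ S ∣)
          (card-strict S (reached ((a , b) ∷ [])) (seed⊆reached ((a , b) ∷ [])) b (grow⊆reached ((a , b) ∷ []) b (Closure.extend-step G ((a , b) ∷ []) S a b ea (keptAdj-single-ab a b))) eb)
    ... | false | true = subst (_≤ ∣ reached ((a , b) ∷ []) ∣) (ℕP.+-comm 1 ∣ S ∣)
          (card-strict S (reached ((a , b) ∷ [])) (seed⊆reached ((a , b) ∷ [])) a (grow⊆reached ((a , b) ∷ []) a (Closure.extend-step G ((a , b) ∷ []) S b a eb (keptAdj-single-ba a b))) ea)

    insert : Fin n → Subset n
    insert w = tabulate (λ i → lookup S i ∨ eqᵇ i w)

    insert-card : ∀ w → ∣ insert w ∣ ≤ ∣ S ∣ + 1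
    insert-card w = subst₂ _≤_ (sym (∣∣≡ΣF (insert w))) (cong₂ _+_ (sym (∣∣≡ΣF S)) (ΣF-indicator w))
       (ℕP.≤-trans (lsum-mono (allFin n) pw) (ℕP.≤-reflexive (lsum-+ (allFin n) (λ i → boolToℕ (lookup S i)) (λ i → if eqᵇ i w then 1 else 0))))
      where
      pw : ∀ i → boolToℕ (lookup (insert w) i) ≤ boolToℕ (lookup S i) + (if eqᵇ i w then 1 else 0)
      pw i rewrite VP.lookup∘tabulate (λ i → lookup S i ∨ eqᵇ i w) i with lookup S i | eqᵇ i w
      ... | true | _ = s≤s z≤n
      ... | false | true = s≤s z≤n
      ... | false | false = z≤n

    insert-⊇ : ∀ w → Sub S (insert w)
    insert-⊇ w v e = trans (VP.lookup∘tabulate _ v) (∨-l e)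

    insert-∋ : ∀ w → lookup (insert w) w ≡ true
    insert-∋ w = trans (VP.lookup∘tabulate _ w) (∨-r (eqᵇ-refl w))

    reached-single-upper : ∀ a b → ∣ reached ((a , b) ∷ []) ∣ ≤ ∣ S ∣ + boolToℕ (crosses G S a b)
    reached-single-upper a b with lookup S a in ea | lookup S b in eb
    ... | true | true = subst (∣ reached F1 ∣ ≤_) (sym (ℕP.+-identityʳ ∣ S ∣)) (card-mono (reached F1) S (Closure.extendⁿ⊆closed G F1 n S S (λ v e → e) cS))
      where
      F1 = (a , b) ∷ []
      cS : Closure.Closed G F1 S
      cS u v eu ek with keptAdj-single a b u v ek
      ... | inj₁ (refl , refl) = eb
      ... | inj₂ (refl , refl) = ea
    ... | false | false = subst (∣ reached F1 ∣ ≤_) (sym (ℕP.+-identityʳ ∣ S ∣)) (card-mono (reached F1) S (Closure.extendⁿ⊆closed G F1 n S S (λ v e → e) cS))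
      where
      F1 = (a , b) ∷ []
      cS : Closure.Closed G F1 S
      cS u v eu ek with keptAdj-single a b u v ek
      ... | inj₁ (refl , refl) = ⊥-elim (true≢false (trans (sym eu) ea))
      ... | inj₂ (refl , refl) = ⊥-elim (true≢false (trans (sym eu) eb))
    ... | true | false = ℕP.≤-trans (card-mono (reached F1) (insert b) (Closure.extendⁿ⊆closed G F1 n S (insert b) (insert-⊇ b) cT)) (insert-card b)
      where
      F1 = (a , b) ∷ []
      cT : Closure.Closed G F1 (insert b)
      cT u v eu ek with keptAdj-single a b u v ek
      ... | inj₁ (refl , refl) = insert-∋ b
      ... | inj₂ (refl , refl) = insert-⊇ b a ea
    ... | false | true = ℕP.≤-trans (card-mono (reached F1) (insert a) (Closure.extendⁿ⊆closed G F1 n S (insert a) (insert-⊇ a) cT)) (insert-card a)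
      where
      F1 = (a , b) ∷ []
      cT : Closure.Closed G F1 (insert a)
      cT u v eu ek with keptAdj-single a b u v ek
      ... | inj₁ (refl , refl) = insert-⊇ a b eb
      ... | inj₂ (refl , refl) = insert-∋ a

    #crossing-single : ∀ e → #crossing (e ∷ []) ≡ boolToℕ (crossing e)
    #crossing-single e with crossing e
    ... | true = refl
    ... | false = refl

    length≤orderedPairs : ∀ l → 2 ≤ l → l ≤ orderedPairs l
    length≤orderedPairs (suc zero) (s≤s ())
    length≤orderedPairs (suc (suc l)) _ = subst (_≤ orderedPairs (suc (suc l))) (ℕP.*-identityʳ (suc (suc l))) (ℕP.*-monoʳ-≤ (suc (suc l)) (s≤s z≤n))

    -- Exact when at most one edge is kept; otherwise orderedPairs (length F) ≥ max 2 (length F) absorbs the error.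
    reached-lower : ∀ F → ∣ S ∣ + #crossing F ≤ ∣ reached F ∣ + orderedPairs (length F)
    reached-lower [] = ℕP.+-monoˡ-≤ 0 (card-mono S (reached []) (seed⊆reached []))
    reached-lower ((a , b) ∷ []) = subst₂ _≤_ (cong (∣ S ∣ +_) (sym (#crossing-single (a , b)))) (sym (ℕP.+-identityʳ _)) (reached-single-lower a b)
    reached-lower (e1 ∷ e2 ∷ F) = ℕP.+-mono-≤ (card-mono S (reached (e1 ∷ e2 ∷ F)) (seed⊆reached (e1 ∷ e2 ∷ F)))
                                 (ℕP.≤-trans (countᵇ≤length crossing (e1 ∷ e2 ∷ F)) (length≤orderedPairs (length (e1 ∷ e2 ∷ F)) (s≤s (s≤s z≤n))))

    reached-upper : ∀ F → ∣ reached F ∣ ≤ ∣ S ∣ + #crossing F + n * orderedPairs (length F)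
    reached-upper [] = ℕP.≤-trans (ℕP.≤-reflexive reached-[]) (ℕP.≤-trans (ℕP.m≤m+n ∣ S ∣ 0) (ℕP.m≤m+n (∣ S ∣ + 0) (n * 0)))
    reached-upper ((a , b) ∷ []) = ℕP.≤-trans (reached-single-upper a b) (ℕP.≤-trans (ℕP.≤-reflexive (cong (∣ S ∣ +_) (sym (#crossing-single (a , b))))) (ℕP.m≤m+n _ _))
    reached-upper (e1 ∷ e2 ∷ F) = ℕP.≤-trans (SP.∣p∣≤n (reached (e1 ∷ e2 ∷ F)))
                             (ℕP.≤-trans (ℕP.m≤m*n n (orderedPairs (length (e1 ∷ e2 ∷ F))) {{nz}}) (ℕP.m≤n+m _ _))
      where
      nz : ℕ.NonZero (orderedPairs (length (e1 ∷ e2 ∷ F)))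
      nz = ℕ.>-nonZero (ℕP.<-≤-trans (s≤s (z≤n {suc (length F)})) (length≤orderedPairs (length (e1 ∷ e2 ∷ F)) (s≤s (s≤s z≤n))))

  open import Data.Rational.Properties as QP using ()
  open import Data.Rational.Solver using (module +-*-Solver)
  open +-*-Solver

  ≤+⇒-≤ : ∀ a b c → a ≤ℚ b Q.+ c → a Q.- c ≤ℚ b
  ≤+⇒-≤ a b c h = 0≤q-p⇒p≤q (a Q.- c) b (subst (0ℚ ≤ℚ_) (solve 3 (λ a' b' c' → (b' :+ c') :- a' := b' :- (a' :- c')) refl a b c) (p≤q⇒0≤q-p a (b Q.+ c) h))

  expectedClusterSize-≥-cut : ∀ {n} (G : Graph n) β → 0ℚ ≤ℚ β → β ≤ℚ 1ℚ → ∀ k (S : Subset n) → ∣ S ∣ ≡ k →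
         (ℕ→ℚ k Q.- β Q.* β Q.* ℕ→ℚ (orderedPairs (length (edges G)))) Q.+ β Q.* ℕ→ℚ (cutSize G S) ≤ℚ expectedClusterSize G β S
  expectedClusterSize-≥-cut {n} G β 0≤β β≤1 k S Sk = subst₂ _≤ℚ_ eqL (sym (expectedClusterSize≡𝔼 G β S)) (𝔼-mono (edges G) le)
    where
    open Reached G S
    open Monotone {A = Fin n × Fin n} β 0≤β β≤1
    g : List (Fin n × Fin n) → ℚ
    g F = ℕ→ℚ (∣ S ∣ + #crossing F) Q.- ℕ→ℚ (orderedPairs (length F))
    le : ∀ F → g F ≤ℚ ℕ→ℚ ∣ reached F ∣
    le F = ≤+⇒-≤ _ _ _ (subst (ℕ→ℚ (∣ S ∣ + #crossing F) ≤ℚ_) (ℕ→ℚ-+ ∣ reached F ∣ (orderedPairs (length F))) (ℕ→ℚ-mono-≤ (reached-lower F)))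
    C = ℕ→ℚ (cutSize G S)
    P = ℕ→ℚ (orderedPairs (length (edges G)))
    eqL : 𝔼 β (edges G) g ≡ (ℕ→ℚ k Q.- β Q.* β Q.* P) Q.+ β Q.* C
    eqL = begin
      𝔼 β (edges G) g  ≡⟨ 𝔼-sub β (edges G) (λ F → ℕ→ℚ (∣ S ∣ + #crossing F)) (λ F → ℕ→ℚ (orderedPairs (length F))) ⟩
      𝔼 β (edges G) (λ F → ℕ→ℚ (∣ S ∣ + #crossing F)) Q.- 𝔼 β (edges G) (λ F → ℕ→ℚ (orderedPairs (length F)))
        ≡⟨ cong₂ Q._-_ (trans (𝔼-cong β (edges G) (λ F → ℕ→ℚ-+ ∣ S ∣ (#crossing F)))
                         (trans (𝔼-+ β (edges G) (λ _ → ℕ→ℚ ∣ S ∣) (λ F → ℕ→ℚ (#crossing F)))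
                            (cong₂ Q._+_ (𝔼-const β (edges G) (ℕ→ℚ ∣ S ∣)) (𝔼-countᵇ β crossing (edges G)))))
                       (𝔼-orderedPairs β (edges G)) ⟩
      (ℕ→ℚ ∣ S ∣ Q.+ β Q.* C) Q.- β Q.* β Q.* P
        ≡⟨ cong (λ z → (ℕ→ℚ z Q.+ β Q.* C) Q.- β Q.* β Q.* P) Sk ⟩
      (ℕ→ℚ k Q.+ β Q.* C) Q.- β Q.* β Q.* P
        ≡⟨ solve 4 (λ K b c p → (K :+ b :* c) :- b :* b :* p := (K :- b :* b :* p) :+ b :* c) refl (ℕ→ℚ k) β C P ⟩
      (ℕ→ℚ k Q.- β Q.* β Q.* P) Q.+ β Q.* C ∎
      where open ≡-Reasoning

  expectedClusterSize-≤-cut : ∀ {n} (G : Graph n) β → 0ℚ ≤ℚ β → β ≤ℚ 1ℚ → ∀ k (S : Subset n) → ∣ S ∣ ≡ k →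
         expectedClusterSize G β S ≤ℚ (ℕ→ℚ k Q.+ ℕ→ℚ n Q.* (β Q.* β Q.* ℕ→ℚ (orderedPairs (length (edges G))))) Q.+ β Q.* ℕ→ℚ (cutSize G S)
  expectedClusterSize-≤-cut {n} G β 0≤β β≤1 k S Sk = subst₂ _≤ℚ_ (sym (expectedClusterSize≡𝔼 G β S)) eqR (𝔼-mono (edges G) le)
    where
    open Reached G S
    open Monotone {A = Fin n × Fin n} β 0≤β β≤1
    h : List (Fin n × Fin n) → ℚ
    h F = (ℕ→ℚ ∣ S ∣ Q.+ ℕ→ℚ (#crossing F)) Q.+ ℕ→ℚ n Q.* ℕ→ℚ (orderedPairs (length F))
    le : ∀ F → ℕ→ℚ ∣ reached F ∣ ≤ℚ h F
    le F = subst (ℕ→ℚ ∣ reached F ∣ ≤ℚ_)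
             (trans (ℕ→ℚ-+ (∣ S ∣ + #crossing F) (n * orderedPairs (length F)))
                    (cong₂ Q._+_ (ℕ→ℚ-+ ∣ S ∣ (#crossing F)) (ℕ→ℚ-* n (orderedPairs (length F)))))
             (ℕ→ℚ-mono-≤ (reached-upper F))
    C = ℕ→ℚ (cutSize G S)
    P = ℕ→ℚ (orderedPairs (length (edges G)))
    N = ℕ→ℚ n
    eqR : 𝔼 β (edges G) h ≡ (ℕ→ℚ k Q.+ N Q.* (β Q.* β Q.* P)) Q.+ β Q.* C
    eqR = begin
      𝔼 β (edges G) h  ≡⟨ 𝔼-+ β (edges G) (λ F → ℕ→ℚ ∣ S ∣ Q.+ ℕ→ℚ (#crossing F)) (λ F → N Q.* ℕ→ℚ (orderedPairs (length F))) ⟩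
      𝔼 β (edges G) (λ F → ℕ→ℚ ∣ S ∣ Q.+ ℕ→ℚ (#crossing F)) Q.+ 𝔼 β (edges G) (λ F → N Q.* ℕ→ℚ (orderedPairs (length F)))
        ≡⟨ cong₂ Q._+_ (trans (𝔼-+ β (edges G) (λ _ → ℕ→ℚ ∣ S ∣) (λ F → ℕ→ℚ (#crossing F)))
                            (cong₂ Q._+_ (𝔼-const β (edges G) (ℕ→ℚ ∣ S ∣)) (𝔼-countᵇ β crossing (edges G))))
                       (trans (𝔼-scale β (edges G) N (λ F → ℕ→ℚ (orderedPairs (length F)))) (cong (N Q.*_) (𝔼-orderedPairs β (edges G)))) ⟩
      (ℕ→ℚ ∣ S ∣ Q.+ β Q.* C) Q.+ N Q.* (β Q.* β Q.* P)
        ≡⟨ cong (λ z → (ℕ→ℚ z Q.+ β Q.* C) Q.+ N Q.* (β Q.* β Q.* P)) Sk ⟩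
      (ℕ→ℚ k Q.+ β Q.* C) Q.+ N Q.* (β Q.* β Q.* P)
        ≡⟨ solve 5 (λ K b c p nn → (K :+ b :* c) :+ nn :* (b :* b :* p) := (K :+ nn :* (b :* b :* p)) :+ b :* c) refl (ℕ→ℚ k) β C P N ⟩
      (ℕ→ℚ k Q.+ N Q.* (β Q.* β Q.* P)) Q.+ β Q.* C ∎
      where open ≡-Reasoning


module LargeEdgeProbability where

  open import Data.Nat as ℕ using (ℕ; zero; suc; _+_; _*_; _≤_; z≤n; s≤s; _^_)
  import Data.Nat.Properties as ℕP
  open import Data.Bool using (Bool; true; false; not; _∧_; _∨_; _xor_; if_then_else_)
  open import Data.Fin as Fin using (Fin; _≟_)
  open import Data.Fin.Subset using (Subset; ∣_∣; ∁)
  open import Data.Vec using ([]; _∷_; lookup; tabulate)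
  import Data.Vec.Properties as VP
  open import Data.List as List using (List; []; _∷_; map; length; allFin; concatMap)
  import Data.List.Properties as LP
  open import Data.List.Relation.Unary.All as All using (All; []; _∷_)
  open import Data.List.Membership.Propositional using (_∈_)
  open import Data.List.Relation.Unary.Any using (here; there)
  open import Data.List.Membership.Propositional.Properties using (∈-allFin)
  open import Data.Bool.ListAction using (any)
  open import Data.Product using (_,_; _×_; proj₁; proj₂)
  open import Data.Sum using (_⊎_; inj₁; inj₂)
  open import Data.Empty using (⊥-elim)
  open import Relation.Nullary using (yes; no; ¬_)
  import Data.Bool.Properties as BP
  open import Relation.Binary.PropositionalEquality
  open import Relation.Binary.Construct.Closure.ReflexiveTransitive using (Star; ε; _◅_)
  open import Data.Rational as Q using (ℚ; 0ℚ; 1ℚ) renaming (_≤_ to _≤ℚ_)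
  import Data.Rational.Properties as QP
  open import Data.Rational.Solver using (module +-*-Solver)
  open import Defs hiding (sym)
  open NatSums
  open SubsetCounting
  open Handshake
  open Reachability
  open Percolation
  open NatCast
  open SmallEdgeProbability using (expectedClusterSize≡𝔼)
  open SeedAverages using (missedIn)
  open FractionArithmetic using (nonNeg*nonNeg; *-monoˡ-≤-nonNeg′)
  open MeansAndGaps using (sumℚ-mono-All)
  open +-*-Solver

  ℕ→ℚ-boolToℕ : ∀ b → ℕ→ℚ (boolToℕ b) ≡ boolToℚ b
  ℕ→ℚ-boolToℕ true = refl
  ℕ→ℚ-boolToℕ false = refl

  ℕ→ℚ-*-boolToℕ : ∀ x b → ℕ→ℚ (x * boolToℕ b) ≡ ℕ→ℚ x Q.* boolToℚ b
  ℕ→ℚ-*-boolToℕ x b = trans (ℕ→ℚ-* x (boolToℕ b)) (cong (ℕ→ℚ x Q.*_) (ℕ→ℚ-boolToℕ b))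

  sumℚ-scale : ∀ {X : Set} (L : List X) c (f : X → ℚ) → sumℚ (map (λ x → c Q.* f x) L) ≡ c Q.* sumℚ (map f L)
  sumℚ-scale [] c f = sym (QP.*-zeroʳ c)
  sumℚ-scale (x ∷ L) c f = trans (cong (c Q.* f x Q.+_) (sumℚ-scale L c f)) (sym (QP.*-distribˡ-+ c (f x) (sumℚ (map f L))))

  sumℚ-const : ∀ {X : Set} (L : List X) c → sumℚ (map (λ _ → c) L) ≡ ℕ→ℚ (length L) Q.* c
  sumℚ-const [] c = sym (QP.*-zeroˡ c)
  sumℚ-const (x ∷ L) c = trans (cong (c Q.+_) (sumℚ-const L c))
    (trans (solve 2 (λ c' l → c' :+ l :* c' := (con 1ℚ :+ l) :* c') refl c (ℕ→ℚ (length L))) (cong (Q._* c) (sym (ℕ→ℚ-suc (length L)))))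

  sumℚ-+ : ∀ {X : Set} (L : List X) (f g : X → ℚ) → sumℚ (map (λ x → f x Q.+ g x) L) ≡ sumℚ (map f L) Q.+ sumℚ (map g L)
  sumℚ-+ [] f g = refl
  sumℚ-+ (x ∷ L) f g = trans (cong ((f x Q.+ g x) Q.+_) (sumℚ-+ L f g))
    (solve 4 (λ a b c d → (a :+ b) :+ (c :+ d) := (a :+ c) :+ (b :+ d)) refl (f x) (g x) (sumℚ (map f L)) (sumℚ (map g L)))

  ΣF-1 : ∀ n → ΣF {n} (λ _ → 1) ≡ n
  ΣF-1 n = trans (lsum-const (allFin n) 1) (trans (ℕP.*-identityʳ _) (LP.length-tabulate (λ i → i)))

  card+missed : ∀ {n} (R : Subset n) → ∣ R ∣ + ΣF (λ v → boolToℕ (not (lookup R v))) ≡ n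
  card+missed {n} R = trans (cong (_+ ΣF (λ v → boolToℕ (not (lookup R v)))) (∣∣≡ΣF R))
     (trans (sym (lsum-+ (allFin n) (λ v → boolToℕ (lookup R v)) (λ v → boolToℕ (not (lookup R v)))))
       (trans (ΣF-cong (λ v → f (lookup R v))) (ΣF-1 n)))
    where
    f : ∀ b → boolToℕ b + boolToℕ (not b) ≡ 1
    f true = refl
    f false = refl

  module Missed {n : ℕ} (G : Graph n) (β : ℚ) (S : Subset n) where
    RR : List (Fin n × Fin n) → Subset n
    RR F = reachFrom G F S
    miss : Fin n → List (Fin n × Fin n) → ℚ
    miss v F = ℕ→ℚ (boolToℕ (not (lookup (RR F) v)))

    ∣reached∣≡n-missed : ∀ F → ℕ→ℚ ∣ RR F ∣ ≡ ℕ→ℚ n Q.- sumℚ (map (λ v → miss v F) (allFin n))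
    ∣reached∣≡n-missed F = begin
        ℕ→ℚ ∣ RR F ∣  ≡⟨ solve 2 (λ a b → a := (a :+ b) :- b) refl (ℕ→ℚ ∣ RR F ∣) (ℕ→ℚ (ΣF (λ v → boolToℕ (not (lookup (RR F) v))))) ⟩
        (ℕ→ℚ ∣ RR F ∣ Q.+ M) Q.- M  ≡⟨ cong (Q._- M) (trans (sym (ℕ→ℚ-+ ∣ RR F ∣ (ΣF (λ v → boolToℕ (not (lookup (RR F) v)))))) (cong ℕ→ℚ (card+missed (RR F)))) ⟩
        ℕ→ℚ n Q.- M  ≡⟨ cong (λ z → ℕ→ℚ n Q.- z) (ℕ→ℚ-lsum (allFin n) (λ v → boolToℕ (not (lookup (RR F) v)))) ⟩
        ℕ→ℚ n Q.- sumℚ (map (λ v → miss v F) (allFin n)) ∎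
      where
      open ≡-Reasoning
      M = ℕ→ℚ (ΣF (λ v → boolToℕ (not (lookup (RR F) v))))

    expectedClusterSize-missed : expectedClusterSize G β S ≡ ℕ→ℚ n Q.- sumℚ (map (λ v → 𝔼 β (edges G) (miss v)) (allFin n))
    expectedClusterSize-missed = begin
        expectedClusterSize G β S  ≡⟨ expectedClusterSize≡𝔼 G β S ⟩
        𝔼 β (edges G) (λ F → ℕ→ℚ ∣ RR F ∣)  ≡⟨ 𝔼-cong β (edges G) ∣reached∣≡n-missed ⟩
        𝔼 β (edges G) (λ F → ℕ→ℚ n Q.- sumℚ (map (λ v → miss v F) (allFin n)))
          ≡⟨ 𝔼-sub β (edges G) (λ _ → ℕ→ℚ n) (λ F → sumℚ (map (λ v → miss v F) (allFin n))) ⟩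
        𝔼 β (edges G) (λ _ → ℕ→ℚ n) Q.- 𝔼 β (edges G) (λ F → sumℚ (map (λ v → miss v F) (allFin n)))
          ≡⟨ cong₂ Q._-_ (𝔼-const β (edges G) (ℕ→ℚ n)) (𝔼-sumℚ β (edges G) miss (allFin n)) ⟩
        ℕ→ℚ n Q.- sumℚ (map (λ v → 𝔼 β (edges G) (miss v)) (allFin n)) ∎
      where open ≡-Reasoning

  module Incidence {n : ℕ} (G : Graph n) where
    incidentᵇ : Fin n → Fin n × Fin n → Bool
    incidentᵇ w e = incident G w (proj₁ e) (proj₂ e)


    count-incident : ∀ v → countᵇ (incidentᵇ v) (edges G) ≡ deg G v
    count-incident v = sym (begin
        deg G v  ≡⟨ sym (ℕP.+-identityʳ (deg G v)) ⟩
        deg G v + 0  ≡⟨ cong₂ _+_ (sym (ℕP.+-identityʳ (deg G v))) (sym (trans (ΣF-cong z) (ΣF-zero {n}))) ⟩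
        boolToℕ true * deg G v + ΣF (λ u → if eqᵇ u v then 0 else boolToℕ (eqᵇ u v) * deg G u)
          ≡⟨ cong (λ t → boolToℕ t * deg G v + ΣF (λ u → if eqᵇ u v then 0 else boolToℕ (eqᵇ u v) * deg G u)) (sym (eqᵇ-refl v)) ⟩
        boolToℕ (eqᵇ v v) * deg G v + ΣF (λ u → if eqᵇ u v then 0 else boolToℕ (eqᵇ u v) * deg G u)
          ≡⟨ sym (ΣF-extract (λ u → boolToℕ (eqᵇ u v) * deg G u) v) ⟩
        ΣF (λ u → boolToℕ (eqᵇ u v) * deg G u)  ≡⟨ handshake G (λ u → eqᵇ u v) ⟩
        lsum (edges G) (λ e → boolToℕ (eqᵇ (proj₁ e) v) + boolToℕ (eqᵇ (proj₂ e) v))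
          ≡⟨ lsum-cong-All (edges G) (All.map (λ {e} → one (proj₁ e) (proj₂ e)) (edges-distinct G)) ⟩
        lsum (edges G) (λ e → boolToℕ (incidentᵇ v e))  ≡⟨ sym (countᵇ-lsum (incidentᵇ v) (edges G)) ⟩
        countᵇ (incidentᵇ v) (edges G) ∎)
      where
      open ≡-Reasoning
      z : ∀ u → (if eqᵇ u v then 0 else boolToℕ (eqᵇ u v) * deg G u) ≡ 0
      z u with eqᵇ u v
      ... | true = refl
      ... | false = refl
      one : ∀ a b → ¬ (a ≡ b) → boolToℕ (eqᵇ a v) + boolToℕ (eqᵇ b v) ≡ boolToℕ (eqᵇ a v ∨ eqᵇ b v)
      one a b a≢b with eqᵇ a v in ea | eqᵇ b v in eb
      ... | true | true = ⊥-elim (a≢b (trans (eqᵇ⇒≡ a v ea) (sym (eqᵇ⇒≡ b v eb))))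
      ... | true | false = refl
      ... | false | true = refl
      ... | false | false = refl

    count-∧-adj : ∀ (p : Fin n × Fin n → Bool) → countᵇ (λ e → p e ∧ adj G (proj₁ e) (proj₂ e)) (edges G) ≡ countᵇ p (edges G)
    count-∧-adj p = trans (countᵇ-lsum _ (edges G)) (trans (lsum-cong-All (edges G) (go (edges G) (edges-listed G))) (sym (countᵇ-lsum p (edges G))))
      where
      one : ∀ x y → y ≡ true → boolToℕ (x ∧ y) ≡ boolToℕ x
      one x true refl with x
      ... | true = refl
      ... | false = refl
      go : ∀ L → All (λ e → listed G (proj₁ e) (proj₂ e) ≡ true) L → All (λ e → boolToℕ (p e ∧ adj G (proj₁ e) (proj₂ e)) ≡ boolToℕ (p e)) L
      go [] [] = []
      go (e ∷ L) (h ∷ hs) = one (p e) (adj G (proj₁ e) (proj₂ e)) (∧-elim₂ h) ∷ go L hs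

    keptAdj⇒incident : ∀ F u w → keptAdj G F u w ≡ true → any (incidentᵇ w) F ≡ true
    keptAdj⇒incident F u w ek with any-elim _ F ek
    ... | (a , b) , m , h = any-true (incidentᵇ w) F m (pf (∨-elim h))
      where
      pf : (eqᵇ a u ∧ eqᵇ b w ≡ true) ⊎ (eqᵇ a w ∧ eqᵇ b u ≡ true) → incidentᵇ w (a , b) ≡ true
      pf (inj₁ x) = ∨-r {eqᵇ a w} (∧-elim₂ x)
      pf (inj₂ y) = ∨-l {eqᵇ a w} (∧-elim₁ y)

    keptAdj-∈ : ∀ F {a b} → (a , b) ∈ F → keptAdj G F a b ≡ true × keptAdj G F b a ≡ true
    keptAdj-∈ F {a} {b} m = any-true _ F m (∨-l {b = eqᵇ a b ∧ eqᵇ b a} (∧-intro (eqᵇ-refl a) (eqᵇ-refl b))) ,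
                   any-true _ F m (∨-r {eqᵇ a b ∧ eqᵇ b a} (∧-intro (eqᵇ-refl a) (eqᵇ-refl b)))

    deg-minDegSet : ∀ d v → lookup (minDegSet G d) v ≡ true → deg G v ≡ d
    deg-minDegSet d v e = ℕP.≡ᵇ⇒≡ (deg G v) d (subst Data.Bool.T (sym (trans (sym (VP.lookup∘tabulate (λ v → deg G v ℕ.≡ᵇ d) v)) e)) _)

  module MissedLower {n : ℕ} (G : Graph n) (S : Subset n) where
    open Incidence G
    touched : List (Fin n × Fin n) → Subset n
    touched F = tabulate (λ w → lookup S w ∨ any (incidentᵇ w) F)

    reached⊆touched : ∀ F → Sub (reachFrom G F S) (touched F)
    reached⊆touched F = Closure.extendⁿ⊆closed G F n S (touched F) (λ v e → trans (VP.lookup∘tabulate _ v) (∨-l e)) cl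
      where
      cl : Closure.Closed G F (touched F)
      cl u w eu ek = trans (VP.lookup∘tabulate _ w) (∨-r {lookup S w} (keptAdj⇒incident F u w ek))

    pw : ∀ (y : Bool) v F → boolToℕ (y ∧ not (lookup S v)) * boolToℕ (not (any (incidentᵇ v) F)) ≤ boolToℕ (not (lookup (reachFrom G F S) v))
    pw y v F with lookup (reachFrom G F S) v in eR
    ... | false = ℕP.≤-trans (ℕP.*-monoˡ-≤ _ (b2n≤1' (y ∧ not (lookup S v)))) (ℕP.≤-trans (ℕP.≤-reflexive (ℕP.*-identityˡ _)) (b2n≤1' _))
      where
      b2n≤1' : ∀ b → boolToℕ b ≤ 1
      b2n≤1' true = ℕP.≤-refl
      b2n≤1' false = z≤n
    ... | true with reached⊆touched F v eR
    ... | et with lookup S v | any (incidentᵇ v) F | VP.lookup∘tabulate (λ w → lookup S w ∨ any (incidentᵇ w) F) v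
    ... | true | w | _ = subst (_≤ 0) (sym (cong (λ z → z * boolToℕ (not w)) (b2n-∧' y))) z≤n
      where
      b2n-∧' : ∀ y → boolToℕ (y ∧ false) ≡ 0
      b2n-∧' true = refl
      b2n-∧' false = refl
    ... | false | true | _ = ℕP.≤-reflexive (ℕP.*-zeroʳ (boolToℕ (y ∧ true)))
    ... | false | false | elt = ⊥-elim (true≢false (trans (sym et) elt))

  expectedClusterSize-≤-missed : ∀ {n} (G : Graph n) β → 0ℚ ≤ℚ β → β ≤ℚ 1ℚ → ∀ d (S : Subset n) →
         expectedClusterSize G β S ≤ℚ ℕ→ℚ n Q.+ (Q.- (closedProb β ^ℚ d)) Q.* ℕ→ℚ (missedIn (minDegSet G d) S)
  expectedClusterSize-≤-missed {n} G β 0≤β β≤1 d S = subst₂ _≤ℚ_ (sym (Missed.expectedClusterSize-missed G β S)) fin (QP.+-monoʳ-≤ (ℕ→ℚ n) (QP.neg-antimono-≤ sumle))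
    where
    open Missed G β S
    open Incidence G
    open MissedLower G S
    open Monotone {A = Fin n × Fin n} β 0≤β β≤1
    Y = minDegSet G d
    missedAt : Fin n → ℕ
    missedAt v = boolToℕ (lookup Y v ∧ not (lookup S v))
    qd = closedProb β ^ℚ d
    Ym = ℕ→ℚ (missedIn Y S)
    low : ∀ v → ℕ→ℚ (missedAt v) Q.* qd ≤ℚ 𝔼 β (edges G) (miss v)
    low v = subst (_≤ℚ 𝔼 β (edges G) (miss v)) eq (𝔼-mono (edges G) le)
      where
      g : List (Fin n × Fin n) → ℚ
      g F = ℕ→ℚ (missedAt v) Q.* boolToℚ (not (any (incidentᵇ v) F))
      le : ∀ F → g F ≤ℚ miss v F
      le F = subst (_≤ℚ miss v F) (ℕ→ℚ-*-boolToℕ (missedAt v) (not (any (incidentᵇ v) F))) (ℕ→ℚ-mono-≤ (pw (lookup Y v) v F))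
      eq : 𝔼 β (edges G) g ≡ ℕ→ℚ (missedAt v) Q.* qd
      eq = trans (𝔼-scale β (edges G) (ℕ→ℚ (missedAt v)) (λ F → boolToℚ (not (any (incidentᵇ v) F))))
            (trans (cong (ℕ→ℚ (missedAt v) Q.*_) (trans (𝔼-noneKept β (incidentᵇ v) (edges G)) (cong (closedProb β ^ℚ_) (count-incident v)))) (fixd (lookup Y v) refl))
        where
        fixd : ∀ t → lookup Y v ≡ t → ℕ→ℚ (boolToℕ (t ∧ not (lookup S v))) Q.* (closedProb β ^ℚ deg G v) ≡ ℕ→ℚ (boolToℕ (t ∧ not (lookup S v))) Q.* qd
        fixd true e = cong (λ z → ℕ→ℚ (boolToℕ (not (lookup S v))) Q.* (closedProb β ^ℚ z)) (deg-minDegSet d v e)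
        fixd false e = trans (QP.*-zeroˡ (closedProb β ^ℚ deg G v)) (sym (QP.*-zeroˡ qd))
    sumle : sumℚ (map (λ v → ℕ→ℚ (missedAt v) Q.* qd) (allFin n)) ≤ℚ sumℚ (map (λ v → 𝔼 β (edges G) (miss v)) (allFin n))
    sumle = sumℚ-mono-All (allFin n) _ _ (All.universal low (allFin n))
    fin : ℕ→ℚ n Q.+ Q.- sumℚ (map (λ v → ℕ→ℚ (missedAt v) Q.* qd) (allFin n)) ≡ ℕ→ℚ n Q.+ (Q.- qd) Q.* Ym
    fin = cong (λ z → ℕ→ℚ n Q.+ z) (begin
        Q.- sumℚ (map (λ v → ℕ→ℚ (missedAt v) Q.* qd) (allFin n))
          ≡⟨ cong Q.-_ (trans (cong sumℚ (LP.map-cong (λ v → QP.*-comm (ℕ→ℚ (missedAt v)) qd) (allFin n))) (sumℚ-scale (allFin n) qd (λ v → ℕ→ℚ (missedAt v)))) ⟩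
        Q.- (qd Q.* sumℚ (map (λ v → ℕ→ℚ (missedAt v)) (allFin n)))  ≡⟨ cong (λ z → Q.- (qd Q.* z)) (sym (ℕ→ℚ-lsum (allFin n) missedAt)) ⟩
        Q.- (qd Q.* Ym)  ≡⟨ solve 2 (λ a b → :- (a :* b) := (:- a) :* b) refl qd Ym ⟩
        (Q.- qd) Q.* Ym ∎)
      where open ≡-Reasoning

  ∈-allSubsets : ∀ {n} (T : Subset n) → T ∈ allSubsets n
  ∈-allSubsets [] = here refl
  ∈-allSubsets {suc n} (b ∷ T) = go b (allSubsets n) (∈-allSubsets T)
    where
    go : ∀ c L → T ∈ L → (c ∷ T) ∈ concatMap (λ s → (true ∷ s) ∷ (false ∷ s) ∷ []) L
    go true (y ∷ L) (here refl) = here refl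
    go false (y ∷ L) (here refl) = there (here refl)
    go c (y ∷ L) (there m) = there (there (go c L m))

  length-allSubsets : ∀ n → length (allSubsets n) ≡ 2 ^ n
  length-allSubsets zero = refl
  length-allSubsets (suc n) = trans (go (allSubsets n)) (cong (2 *_) (length-allSubsets n))
    where
    go : ∀ (L : List (Subset n)) → length (concatMap (λ s → (true ∷ s) ∷ (false ∷ s) ∷ []) L) ≡ 2 * length L
    go [] = refl
    go (y ∷ L) = trans (cong (λ z → suc (suc z)) (go L)) (sym (trans (ℕP.*-suc 2 (length L)) refl))

  Star-preserves : ∀ {n} (G : Graph n) (P : Fin n → Set) → (∀ x y → P x → adj G x y ≡ true → P y) → ∀ {x y} → Star (Adj G) x y → P x → P y
  Star-preserves G P st ε px = px
  Star-preserves G P st (axy ◅ rest) px = Star-preserves G P st rest (st _ _ px axy)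

  module MissedPointwise {n : ℕ} (G : Graph n) (S : Subset n) (d : ℕ) (conn : Connected G) (star : PropertyStar G d) (2≤∣S∣ : 2 ≤ ∣ S ∣) where
    open Incidence G
    incidentEdgeᵇ : Fin n → Fin n × Fin n → Bool
    incidentEdgeᵇ v e = incidentᵇ v e ∧ adj G (proj₁ e) (proj₂ e)
    crossingEdgeᵇ : Subset n → Fin n × Fin n → Bool
    crossingEdgeᵇ T e = crosses G T (proj₁ e) (proj₂ e) ∧ adj G (proj₁ e) (proj₂ e)
    nonemptyᵇ : Subset n → Bool
    nonemptyᵇ T = any (λ i → lookup T i) (allFin n)
    isLargeCut : Subset n → Bool
    isLargeCut T = nonemptyᵇ T ∧ (nonemptyᵇ (∁ T) ∧ (d ℕ.<ᵇ cutSize G T))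
    Y = minDegSet G d

    xor≡false⇒≡ : ∀ a b → a xor b ≡ false → a ≡ b
    xor≡false⇒≡ true  true  _ = refl
    xor≡false⇒≡ false false _ = refl

    cut-incident-sameSide : (R : Subset n) (w : Fin n) →
      (∀ x y → Adj G x y → crosses G R x y ≡ incident G w x y) →
      ∀ {x y} → Star (Adj G) x y → lookup R x ≡ lookup R w × ¬ (x ≡ w) → lookup R y ≡ lookup R w × ¬ (y ≡ w)
    cut-incident-sameSide R w cut≡incident = Star-preserves G (λ x → lookup R x ≡ lookup R w × ¬ (x ≡ w)) step
      where
      open ≡-Reasoning
      step : ∀ x y → lookup R x ≡ lookup R w × ¬ (x ≡ w) → adj G x y ≡ true → lookup R y ≡ lookup R w × ¬ (y ≡ w)
      step x y (x∼w , x≢w) x-y with y ≟ w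
      ... | yes refl = ⊥-elim (true≢false (begin
              true                       ≡⟨ ∨-r {eqᵇ x w} (eqᵇ-refl w) ⟨
              incident G w x w           ≡⟨ cut≡incident x w x-y ⟨
              lookup R x xor lookup R w  ≡⟨ cong (_xor lookup R w) x∼w ⟩
              lookup R w xor lookup R w  ≡⟨ BP.xor-same (lookup R w) ⟩
              false                      ∎))
      ... | no y≢w = trans (sym (xor≡false⇒≡ (lookup R x) (lookup R y)
                       (trans (cut≡incident x y x-y) (cong₂ _∨_ (≢⇒eqᵇ-false x w x≢w) (≢⇒eqᵇ-false y w y≢w))))) x∼w , y≢w

    1≤∣S∣ : 1 ≤ ∣ S ∣
    1≤∣S∣ = ℕP.≤-trans (s≤s z≤n) 2≤∣S∣

    #largeCutsClosed : List (Fin n × Fin n) → ℕ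
    #largeCutsClosed F = lsum (allSubsets n) (λ T → boolToℕ (isLargeCut T) * boolToℕ (not (any (crossingEdgeᵇ T) F)))

    module _ (F : List (Fin n × Fin n)) (v : Fin n) where
      RR = reachFrom G F S
      cl : Closure.Closed G F RR
      cl = Closure.reachFrom-closed G F S 1≤∣S∣
      seed⊆reached : Sub S RR
      seed⊆reached = Closure.extendⁿ-⊇ G F n S
      s0 = nonempty-member S 1≤∣S∣

      cross-false : ∀ {a b} → (a , b) ∈ F → crosses G RR a b ≡ false
      cross-false {a} {b} m with lookup RR a in ea | lookup RR b in eb
      ... | true | true = refl
      ... | false | false = refl
      ... | true | false = ⊥-elim (true≢false (trans (sym (cl a b ea (proj₁ (keptAdj-∈ F m)))) eb))
      ... | false | true = ⊥-elim (true≢false (trans (sym (cl b a eb (proj₂ (keptAdj-∈ F m)))) ea))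

      module Unreached (eR : lookup RR v ≡ false) where
        coR : lookup (∁ RR) v ≡ true
        coR = trans (VP.lookup-map v not RR) (cong not eR)

        largeCut-counted : (d ℕ.<ᵇ cutSize G RR) ≡ true → 1 ≤ #largeCutsClosed F
        largeCut-counted ec = ℕP.≤-trans (ℕP.≤-reflexive (cong₂ (λ a b → boolToℕ a * boolToℕ (not b)) (sym isLargeCut-reached) (sym noCrossingKept)))
                     (∈⇒≤lsum (allSubsets n) (λ T → boolToℕ (isLargeCut T) * boolToℕ (not (any (crossingEdgeᵇ T) F))) (∈-allSubsets RR))
          where
          isLargeCut-reached : isLargeCut RR ≡ true
          isLargeCut-reached = ∧-intro (any-true _ (allFin n) (∈-allFin (proj₁ s0)) (seed⊆reached _ (proj₂ s0)))
                 (∧-intro (any-true _ (allFin n) (∈-allFin v) coR) ec)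
          noCrossingKept : any (crossingEdgeᵇ RR) F ≡ false
          noCrossingKept = any-false (crossingEdgeᵇ RR) F (λ { (a , b) m → cong (_∧ adj G a b) (cross-false m) })

        module SmallCut (ec : (d ℕ.<ᵇ cutSize G RR) ≡ false) where
          open ≡-Reasoning
          st = proj₂ (proj₂ star) RR (proj₁ s0 , VP.lookup⇒[]= (proj₁ s0) RR (seed⊆reached _ (proj₂ s0)))
                                    (v , VP.lookup⇒[]= v (∁ RR) coR) (ltᵇ-false d (cutSize G RR) ec)
          w = proj₁ st
          dw : deg G w ≡ d
          dw = proj₁ (proj₂ st)
          H : ∀ x y → Adj G x y → crosses G RR x y ≡ incident G w x y
          H = proj₂ (proj₂ st)

          v≡w : v ≡ w
          v≡w with v ≟ w
          ... | yes v≡w = v≡w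
          ... | no v≢w with lookup RR w in w∈?
          ...   | false = ⊥-elim (true≢false (begin
                    true          ≡⟨ seed⊆reached s s∈S ⟨
                    lookup RR s   ≡⟨ proj₁ (cut-incident-sameSide RR w H (conn v s) (trans eR (sym w∈?) , v≢w)) ⟩
                    lookup RR w   ≡⟨ w∈? ⟩
                    false         ∎))
            where
            s = proj₁ s0
            s∈S = proj₂ s0
          ...   | true = ⊥-elim (true≢false (begin
                    true          ≡⟨ w∈? ⟨
                    lookup RR w   ≡⟨ proj₁ (cut-incident-sameSide RR w H (conn s v) (trans (seed⊆reached s s∈S) (sym w∈?) , s≢w)) ⟨
                    lookup RR v   ≡⟨ eR ⟩
                    false         ∎))
            where
            s = proj₁ (∃-member-≢ S 2≤∣S∣ w)
            s∈S = proj₁ (proj₂ (∃-member-≢ S 2≤∣S∣ w))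
            s≢w = proj₂ (proj₂ (∃-member-≢ S 2≤∣S∣ w))

          T→≡ : ∀ {b} → Data.Bool.T b → b ≡ true
          T→≡ {true} _ = refl

          Yv : lookup Y v ≡ true
          Yv = trans (VP.lookup∘tabulate (λ v → deg G v ℕ.≡ᵇ d) v) (T→≡ (ℕP.≡⇒≡ᵇ (deg G v) d (trans (cong (deg G) v≡w) dw)))

          Sv : lookup S v ≡ false
          Sv with lookup S v in es
          ... | false = refl
          ... | true = ⊥-elim (true≢false (trans (sym (seed⊆reached v es)) eR))

          none : any (incidentEdgeᵇ v) F ≡ false
          none = any-false (incidentEdgeᵇ v) F f
            where
            f : ∀ e → e ∈ F → incidentEdgeᵇ v e ≡ false
            f (a , b) m with adj G a b in ea
            ... | false = BP.∧-zeroʳ (incidentᵇ v (a , b))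
            ... | true = cong (_∧ true) (subst (λ z → incident G z a b ≡ false) (sym v≡w) (trans (sym (H a b ea)) (cross-false m)))

          isolatedMissed-≥1 : 1 ≤ boolToℕ (lookup Y v ∧ not (lookup S v)) * boolToℕ (not (any (incidentEdgeᵇ v) F))
          isolatedMissed-≥1 rewrite Yv | Sv | none = ℕP.≤-refl

    -- An unreached vertex is either cut off by a closed cut with more than d edges or, by property (*),
    -- the reached set's cut is the star of v itself, so v ∈ Y ∖ S has all its edges closed.
    missed≤ : ∀ v F → boolToℕ (not (lookup (reachFrom G F S) v)) ≤ boolToℕ (lookup Y v ∧ not (lookup S v)) * boolToℕ (not (any (incidentEdgeᵇ v) F)) + #largeCutsClosed F
    missed≤ v F with lookup (reachFrom G F S) v in eR
    ... | true = z≤n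
    ... | false with d ℕ.<ᵇ cutSize G (reachFrom G F S) in ec
    ...   | true = ℕP.≤-trans (Unreached.largeCut-counted F v eR ec) (ℕP.m≤n+m (#largeCutsClosed F) _)
    ...   | false = ℕP.≤-trans (Unreached.SmallCut.isolatedMissed-≥1 F v eR ec) (ℕP.m≤m+n _ (#largeCutsClosed F))

  ^ℚ-nonNeg : ∀ q m → 0ℚ ≤ℚ q → 0ℚ ≤ℚ q ^ℚ m
  ^ℚ-nonNeg q zero h = QP.<⇒≤ 0<1
  ^ℚ-nonNeg q (suc m) h = nonNeg*nonNeg h (^ℚ-nonNeg q m h)

  ^ℚ-suc≤ : ∀ q m → 0ℚ ≤ℚ q → q ≤ℚ 1ℚ → q ^ℚ suc m ≤ℚ q ^ℚ m
  ^ℚ-suc≤ q m h0 h1 = subst (q ^ℚ suc m ≤ℚ_) (QP.*-identityˡ (q ^ℚ m)) (*-monoˡ-≤-nonNeg′ (q ^ℚ m) (^ℚ-nonNeg q m h0) h1)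

  ^ℚ-antitone : ∀ q → 0ℚ ≤ℚ q → q ≤ℚ 1ℚ → ∀ a b → a ≤ b → q ^ℚ b ≤ℚ q ^ℚ a
  ^ℚ-antitone q h0 h1 a b a≤b with ℕP.m≤n⇒∃[o]m+o≡n a≤b
  ... | t , refl = go t
    where
    go : ∀ t → q ^ℚ (a + t) ≤ℚ q ^ℚ a
    go zero = QP.≤-reflexive (cong (q ^ℚ_) (ℕP.+-identityʳ a))
    go (suc t) = QP.≤-trans (QP.≤-reflexive (cong (q ^ℚ_) (ℕP.+-suc a t))) (QP.≤-trans (^ℚ-suc≤ q (a + t) h0 h1) (go t))

  module MissedLowerBound {n : ℕ} (G : Graph n) (β : ℚ) (0≤β : 0ℚ ≤ℚ β) (β≤1 : β ≤ℚ 1ℚ) (d : ℕ) (S : Subset n)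
                          (conn : Connected G) (star : PropertyStar G d) (2≤∣S∣ : 2 ≤ ∣ S ∣) where
    open Missed G β S
    open Incidence G
    open MissedPointwise G S d conn star 2≤∣S∣
    open Monotone {A = Fin n × Fin n} β 0≤β β≤1
    q = closedProb β
    q≤1 : q ≤ℚ 1ℚ
    q≤1 = 0≤q-p⇒p≤q q 1ℚ (subst (0ℚ ≤ℚ_) (solve 1 (λ b → b := con 1ℚ :- (con 1ℚ :- b)) refl β) 0≤β)
    qd = q ^ℚ d
    qs = q ^ℚ suc d
    N = ℕ→ℚ n
    P2n = ℕ→ℚ (2 ^ n)
    missedAt : Fin n → ℕ
    missedAt v = boolToℕ (lookup Y v ∧ not (lookup S v))
    Ym = ℕ→ℚ (missedIn Y S)
    isolatedMissed : Fin n → List (Fin n × Fin n) → ℕ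
    isolatedMissed v F = missedAt v * boolToℕ (not (any (incidentEdgeᵇ v) F))
    largeCutClosed : Subset n → List (Fin n × Fin n) → ℚ
    largeCutClosed T F = ℕ→ℚ (boolToℕ (isLargeCut T)) Q.* boolToℚ (not (any (crossingEdgeᵇ T) F))
    ℕ→ℚ-#largeCutsClosed : ∀ F → ℕ→ℚ (#largeCutsClosed F) ≡ sumℚ (map (λ T → largeCutClosed T F) (allSubsets n))
    ℕ→ℚ-#largeCutsClosed F = trans (ℕ→ℚ-lsum (allSubsets n) (λ T → boolToℕ (isLargeCut T) * boolToℕ (not (any (crossingEdgeᵇ T) F))))
             (cong sumℚ (LP.map-cong (λ T → ℕ→ℚ-*-boolToℕ (boolToℕ (isLargeCut T)) (not (any (crossingEdgeᵇ T) F))) (allSubsets n)))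
    𝔼-isolatedMissed : ∀ v → 𝔼 β (edges G) (λ F → ℕ→ℚ (isolatedMissed v F)) ≡ ℕ→ℚ (missedAt v) Q.* qd
    𝔼-isolatedMissed v = trans (𝔼-cong β (edges G) (λ F → ℕ→ℚ-*-boolToℕ (missedAt v) (not (any (incidentEdgeᵇ v) F))))
            (trans (𝔼-scale β (edges G) (ℕ→ℚ (missedAt v)) (λ F → boolToℚ (not (any (incidentEdgeᵇ v) F))))
            (trans (cong (ℕ→ℚ (missedAt v) Q.*_) (trans (𝔼-noneKept β (incidentEdgeᵇ v) (edges G)) (cong (q ^ℚ_) (trans (count-∧-adj (incidentᵇ v)) (count-incident v)))))
              (fixd (lookup Y v) refl)))
      where
      fixd : ∀ t → lookup Y v ≡ t → ℕ→ℚ (boolToℕ (t ∧ not (lookup S v))) Q.* (q ^ℚ deg G v) ≡ ℕ→ℚ (boolToℕ (t ∧ not (lookup S v))) Q.* qd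
      fixd true e = cong (λ z → ℕ→ℚ (boolToℕ (not (lookup S v))) Q.* (q ^ℚ z)) (deg-minDegSet d v e)
      fixd false e = trans (QP.*-zeroˡ (q ^ℚ deg G v)) (sym (QP.*-zeroˡ qd))
    𝔼-largeCutClosed : ∀ T → 𝔼 β (edges G) (largeCutClosed T) ≤ℚ qs
    𝔼-largeCutClosed T = QP.≤-trans (QP.≤-reflexive (trans (𝔼-scale β (edges G) (ℕ→ℚ (boolToℕ (isLargeCut T))) (λ F → boolToℚ (not (any (crossingEdgeᵇ T) F))))
                          (cong (ℕ→ℚ (boolToℕ (isLargeCut T)) Q.*_) (trans (𝔼-noneKept β (crossingEdgeᵇ T) (edges G)) (cong (q ^ℚ_) (count-∧-adj (λ e → crosses G T (proj₁ e) (proj₂ e))))))))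
                      (bnd (isLargeCut T) refl)
      where
      bnd : ∀ g → isLargeCut T ≡ g → ℕ→ℚ (boolToℕ g) Q.* (q ^ℚ cutSize G T) ≤ℚ qs
      bnd false _ = subst (_≤ℚ qs) (sym (QP.*-zeroˡ (q ^ℚ cutSize G T))) (^ℚ-nonNeg q (suc d) 0≤q)
      bnd true e = subst (_≤ℚ qs) (sym (QP.*-identityˡ (q ^ℚ cutSize G T)))
                     (^ℚ-antitone q 0≤q q≤1 (suc d) (cutSize G T) (ltb-true' (∧-elim₂ {nonemptyᵇ (∁ T)} (∧-elim₂ {nonemptyᵇ T} e))))
        where
        ltb-true' : (d ℕ.<ᵇ cutSize G T) ≡ true → suc d ≤ cutSize G T
        ltb-true' e = ℕP.<ᵇ⇒< d (cutSize G T) (subst Data.Bool.T (sym e) _)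
    𝔼-someLargeCutClosed : 𝔼 β (edges G) (λ F → ℕ→ℚ (#largeCutsClosed F)) ≤ℚ P2n Q.* qs
    𝔼-someLargeCutClosed = QP.≤-trans (QP.≤-reflexive (trans (𝔼-cong β (edges G) ℕ→ℚ-#largeCutsClosed) (𝔼-sumℚ β (edges G) largeCutClosed (allSubsets n))))
             (QP.≤-trans (sumℚ-mono-All (allSubsets n) _ _ (All.universal 𝔼-largeCutClosed (allSubsets n)))
                (QP.≤-reflexive (trans (sumℚ-const (allSubsets n) qs) (cong (λ z → ℕ→ℚ z Q.* qs) (length-allSubsets n)))))
    𝔼-miss≤ : ∀ v → 𝔼 β (edges G) (miss v) ≤ℚ ℕ→ℚ (missedAt v) Q.* qd Q.+ P2n Q.* qs
    𝔼-miss≤ v = QP.≤-trans (𝔼-mono (edges G) le)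
             (QP.≤-trans (QP.≤-reflexive (trans (𝔼-+ β (edges G) (λ F → ℕ→ℚ (isolatedMissed v F)) (λ F → ℕ→ℚ (#largeCutsClosed F))) (cong (Q._+ _) (𝔼-isolatedMissed v))))
                (QP.+-monoʳ-≤ (ℕ→ℚ (missedAt v) Q.* qd) 𝔼-someLargeCutClosed))
      where
      le : ∀ F → miss v F ≤ℚ ℕ→ℚ (isolatedMissed v F) Q.+ ℕ→ℚ (#largeCutsClosed F)
      le F = subst (miss v F ≤ℚ_) (ℕ→ℚ-+ (isolatedMissed v F) (#largeCutsClosed F)) (ℕ→ℚ-mono-≤ (missed≤ v F))

  expectedClusterSize-≥-missed : ∀ {n} (G : Graph n) β → 0ℚ ≤ℚ β → β ≤ℚ 1ℚ → ∀ d (S : Subset n) → Connected G → PropertyStar G d → 2 ≤ ∣ S ∣ →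
         (ℕ→ℚ n Q.- ℕ→ℚ n Q.* (ℕ→ℚ (2 ^ n) Q.* (closedProb β ^ℚ suc d))) Q.+ (Q.- (closedProb β ^ℚ d)) Q.* ℕ→ℚ (missedIn (minDegSet G d) S)
           ≤ℚ expectedClusterSize G β S
  expectedClusterSize-≥-missed {n} G β 0≤β β≤1 d S conn star 2≤∣S∣ =
    subst₂ _≤ℚ_ fin (sym (Missed.expectedClusterSize-missed G β S)) (QP.+-monoʳ-≤ (ℕ→ℚ n) (QP.neg-antimono-≤ sumle))
    where
    open Missed G β S
    open MissedLowerBound G β 0≤β β≤1 d S conn star 2≤∣S∣
    sumle : sumℚ (map (λ v → 𝔼 β (edges G) (miss v)) (allFin n)) ≤ℚ sumℚ (map (λ v → ℕ→ℚ (missedAt v) Q.* qd Q.+ P2n Q.* qs) (allFin n))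
    sumle = sumℚ-mono-All (allFin n) _ _ (All.universal 𝔼-miss≤ (allFin n))
    fin : N Q.+ Q.- sumℚ (map (λ v → ℕ→ℚ (missedAt v) Q.* qd Q.+ P2n Q.* qs) (allFin n)) ≡ (N Q.- N Q.* (P2n Q.* qs)) Q.+ (Q.- qd) Q.* Ym
    fin = begin
        N Q.+ Q.- sumℚ (map (λ v → ℕ→ℚ (missedAt v) Q.* qd Q.+ P2n Q.* qs) (allFin n))
          ≡⟨ cong (λ z → N Q.+ Q.- z) (sumℚ-+ (allFin n) (λ v → ℕ→ℚ (missedAt v) Q.* qd) (λ _ → P2n Q.* qs)) ⟩
        N Q.+ Q.- (sumℚ (map (λ v → ℕ→ℚ (missedAt v) Q.* qd) (allFin n)) Q.+ sumℚ (map (λ _ → P2n Q.* qs) (allFin n)))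
          ≡⟨ cong₂ (λ a b → N Q.+ Q.- (a Q.+ b))
               (trans (cong sumℚ (LP.map-cong (λ v → QP.*-comm (ℕ→ℚ (missedAt v)) qd) (allFin n)))
                 (trans (sumℚ-scale (allFin n) qd (λ v → ℕ→ℚ (missedAt v))) (cong (qd Q.*_) (sym (ℕ→ℚ-lsum (allFin n) missedAt)))))
               (trans (sumℚ-const (allFin n) (P2n Q.* qs)) (cong (λ z → ℕ→ℚ z Q.* (P2n Q.* qs)) (LP.length-tabulate {n = n} (λ i → i)))) ⟩
        N Q.+ Q.- (qd Q.* Ym Q.+ N Q.* (P2n Q.* qs))
          ≡⟨ solve 4 (λ nn a y b → nn :+ :- (a :* y :+ nn :* b) := (nn :- nn :* b) :+ (:- a) :* y) refl N qd Ym (P2n Q.* qs) ⟩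
        (N Q.- N Q.* (P2n Q.* qs)) Q.+ (Q.- qd) Q.* Ym ∎
      where open ≡-Reasoning


module Switchover where

  open import Defs hiding (sym)
  open import Data.Nat as ℕ using (ℕ; suc; _≤_; _<_; _∸_; _^_; z≤n)
  import Data.Nat.Properties as ℕP
  open import Data.Fin.Subset using (Subset; ∣_∣; _∩_; ⊤)
  import Data.Fin.Subset.Properties as SP
  open import Data.List using (List; []; _∷_; map; length)
  open import Data.List.Relation.Unary.All as All using (All)
  open import Data.Product using (_,_; _×_; proj₁; proj₂; ∃-syntax)
  open import Data.Empty using (⊥-elim)
  open import Data.Rational using (ℚ; _*_; _+_; _-_; -_; 0ℚ; 1ℚ) renaming (_<_ to _<ℚ_; _≤_ to _≤ℚ_)
  import Data.Rational.Properties as QP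
  open import Relation.Binary.PropositionalEquality
  open NatCast
  open Percolation using (closedProb; orderedPairs)
  open NatSums using (lsum)
  open FractionArithmetic using (frac-cross; frac*frac-cross)
  open MeansAndGaps
  open NatInequalities
  open Binomial
  open SeedAverages
  open SmallEdgeProbability using (expectedClusterSize-≥-cut; expectedClusterSize-≤-cut)
  open LargeEdgeProbability using (expectedClusterSize-≤-missed; expectedClusterSize-≥-missed)

  meanClusterSize : ∀ {n} → Graph n → ℚ → List (Subset n) → ℚ
  meanClusterSize G β L = mean (map (expectedClusterSize G β) L)

  -- β = 1/(N+1) with N so large that the gain β·(cut difference) beats the O(β²) error terms.
  smallβ-separation : ∀ {n} (G : Graph n) k → (LA LB : List (Subset n)) →
    All (λ S → ∣ S ∣ ≡ k) LA → All (λ S → ∣ S ∣ ≡ k) LB →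
    lsum LB (cutSize G) ℕ.* length LA < lsum LA (cutSize G) ℕ.* length LB →
    ∃[ β ] InOpenUnit G β × meanClusterSize G β LB <ℚ meanClusterSize G β LA
  smallβ-separation G k [] LB _ _ gap = ⊥-elim (ℕP.n≮0 gap)
  smallβ-separation G k LA@(_ ∷ _) [] _ _ gap = ⊥-elim (ℕP.n≮0 (subst (0 <_) (ℕP.*-zeroʳ (lsum LA (cutSize G))) gap))
  smallβ-separation {n} G k (A ∷ As) (B ∷ Bs) sizeA sizeB gap =
    β , β∈ , QP.≤-<-trans upperB (QP.<-≤-trans separated lowerA)
    where
    M = orderedPairs (length (edges G))
    SA = lsum (A ∷ As) (cutSize G)
    SB = lsum (B ∷ Bs) (cutSize G)
    scaled = ∃-scaled-gap (SB ℕ.* suc (length As)) (SA ℕ.* suc (length Bs))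
                          (suc n ℕ.* M ℕ.* suc (length As) ℕ.* suc (length Bs)) gap
    N = proj₁ scaled
    β = frac 1 (suc N)
    β∈ : InOpenUnit G β
    β∈ = 1/suc∈01 N (proj₂ (proj₂ scaled))
    0≤β = QP.<⇒≤ (proj₁ β∈)
    β≤1 = QP.<⇒≤ (proj₂ β∈)
    upperB : meanClusterSize G β (B ∷ Bs)
               ≤ℚ (ℕ→ℚ k + ℕ→ℚ n * (β * β * ℕ→ℚ M)) + β * (ℕ→ℚ SB * frac 1 (suc (length Bs)))
    upperB = mean-≤-affine B Bs _ (ℕ→ℚ k + ℕ→ℚ n * (β * β * ℕ→ℚ M)) β (cutSize G) (All.map (expectedClusterSize-≤-cut G β 0≤β β≤1 k _) sizeB)
    lowerA : (ℕ→ℚ k - β * β * ℕ→ℚ M) + β * (ℕ→ℚ SA * frac 1 (suc (length As)))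
               ≤ℚ meanClusterSize G β (A ∷ As)
    lowerA = mean-≥-affine A As _ (ℕ→ℚ k - β * β * ℕ→ℚ M) β (cutSize G) (All.map (expectedClusterSize-≥-cut G β 0≤β β≤1 k _) sizeA)
    separated = smallβ-bounds-separate k n M SA SB (length As) (length Bs) N (proj₁ (proj₂ scaled))

  -- β = 1 − q with q = 1/(N+1): the gain q^d·(missed difference) beats the O(q^(d+1)) error terms.
  largeβ-separation : ∀ {n} (G : Graph n) k d → Connected G → PropertyStar G d → 2 ≤ k →
    (LA LB : List (Subset n)) → All (λ S → ∣ S ∣ ≡ k) LA → All (λ S → ∣ S ∣ ≡ k) LB →
    lsum LB (missedIn (minDegSet G d)) ℕ.* length LA < lsum LA (missedIn (minDegSet G d)) ℕ.* length LB →
    ∃[ β ] InOpenUnit G β × meanClusterSize G β LA <ℚ meanClusterSize G β LB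
  largeβ-separation G k d conn star 2≤k [] LB _ _ gap = ⊥-elim (ℕP.n≮0 gap)
  largeβ-separation G k d conn star 2≤k LA@(_ ∷ _) [] _ _ gap =
    ⊥-elim (ℕP.n≮0 (subst (0 <_) (ℕP.*-zeroʳ (lsum LA (missedIn (minDegSet G d)))) gap))
  largeβ-separation {n} G k d conn star 2≤k (A ∷ As) (B ∷ Bs) sizeA sizeB gap =
    β , β∈ , QP.≤-<-trans upperA (QP.<-≤-trans separated lowerB)
    where
    missed = missedIn (minDegSet G d)
    SA = lsum (A ∷ As) missed
    SB = lsum (B ∷ Bs) missed
    scaled = ∃-scaled-gap (SB ℕ.* suc (length As)) (SA ℕ.* suc (length Bs))
                          (n ℕ.* (2 ^ n) ℕ.* suc (length As) ℕ.* suc (length Bs)) gap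
    N = proj₁ scaled
    q = frac 1 (suc N)
    q∈ = 1/suc∈01 N (proj₂ (proj₂ scaled))
    β = 1ℚ - q
    q≡ : closedProb β ≡ q
    q≡ = closedProb-involutive q
    β∈ : InOpenUnit G β
    β∈ = p<q⇒0<q-p q 1ℚ (proj₂ q∈) , 0<q-p⇒p<q β 1ℚ (subst (0ℚ <ℚ_) (sym q≡) (proj₁ q∈))
    0≤β = QP.<⇒≤ (proj₁ β∈)
    β≤1 = QP.<⇒≤ (proj₂ β∈)
    upperA : meanClusterSize G β (A ∷ As) ≤ℚ ℕ→ℚ n + (- (q ^ℚ d)) * (ℕ→ℚ SA * frac 1 (suc (length As)))
    upperA = mean-≤-affine A As _ (ℕ→ℚ n) (- (q ^ℚ d)) missed (All.map (λ {S} _ →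
               subst (λ z → expectedClusterSize G β S ≤ℚ ℕ→ℚ n + (- (z ^ℚ d)) * ℕ→ℚ (missed S)) q≡
                     (expectedClusterSize-≤-missed G β 0≤β β≤1 d S)) sizeA)
    lowerB : (ℕ→ℚ n - ℕ→ℚ n * (ℕ→ℚ (2 ^ n) * (q ^ℚ suc d))) + (- (q ^ℚ d)) * (ℕ→ℚ SB * frac 1 (suc (length Bs)))
               ≤ℚ meanClusterSize G β (B ∷ Bs)
    lowerB = mean-≥-affine B Bs _ (ℕ→ℚ n - ℕ→ℚ n * (ℕ→ℚ (2 ^ n) * (q ^ℚ suc d))) (- (q ^ℚ d)) missed (All.map (λ {S} ∣S∣≡k →
               subst (λ z → (ℕ→ℚ n - ℕ→ℚ n * (ℕ→ℚ (2 ^ n) * (z ^ℚ suc d))) + (- (z ^ℚ d)) * ℕ→ℚ (missed S)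
                              ≤ℚ expectedClusterSize G β S) q≡
                     (expectedClusterSize-≥-missed G β 0≤β β≤1 d S conn star (subst (2 ≤_) (sym ∣S∣≡k) 2≤k))) sizeB)
    separated = largeβ-bounds-separate n SA SB (length As) (length Bs) N (2 ^ n) (q ^ℚ d)
                  (^ℚ-pos q d (proj₁ q∈)) (proj₁ (proj₂ scaled))

  cut-gap : ∀ {n} (G : Graph n) (C : Subset n) r k → ∣ C ∣ ≡ r → 1 ≤ k → k < r →
    frac (n ∸ k) (n ∸ 1) * avgDeg G ⊤ <ℚ frac (r ∸ k) (r ∸ 1) * avgDeg G C →
    lsum (kSubsetsOf k (⊤ {n})) (cutSize G) ℕ.* length (kSubsetsOf k C)
      < lsum (kSubsetsOf k C) (cutSize G) ℕ.* length (kSubsetsOf k (⊤ {n}))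
  cut-gap {n} G C r k ∣C∣≡r 1≤k k<r h =
    subst₂ (λ a b → SV ℕ.* a < SC ℕ.* b) (sym (length-kSubsetsOf C r k ∣C∣≡r)) (sym (length-kSubsetsOf (⊤ {n}) n k (SP.∣⊤∣≡n n)))
      (averageCut-comparison n r k (degSum G C) (degSum G ⊤) SC SV 1≤k k<r r≤n
         (lsum-cutSize-all G k 1≤k k<n) (binom*degSum≤lsum-cutSize G C r k ∣C∣≡r 1≤k k<r) cleared)
    where
    SC = lsum (kSubsetsOf k C) (cutSize G)
    SV = lsum (kSubsetsOf k (⊤ {n})) (cutSize G)
    r≤n = subst (_≤ n) ∣C∣≡r (SP.∣p∣≤n C)
    k<n = ℕP.<-≤-trans k<r r≤n
    cleared = frac*frac-cross (n ∸ k) (n ∸ 1) (degSum G ⊤) n (r ∸ k) (r ∸ 1) (degSum G C) r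
                (ℕP.m<n⇒0<n∸m (ℕP.≤-<-trans 1≤k k<n)) (ℕP.≤-<-trans z≤n k<n)
                (ℕP.m<n⇒0<n∸m (ℕP.≤-<-trans 1≤k k<r)) (ℕP.≤-<-trans z≤n k<r)
                (subst₂ (λ a b → frac (n ∸ k) (n ∸ 1) * frac (degSum G ⊤) a <ℚ frac (r ∸ k) (r ∸ 1) * frac (degSum G C) b)
                        (SP.∣⊤∣≡n n) ∣C∣≡r h)

  missed-gap : ∀ {n} (Y C : Subset n) r k → ∣ C ∣ ≡ r → 1 ≤ k → k < r →
    frac (∣ Y ∩ C ∣) r <ℚ frac (∣ Y ∣) n →
    lsum (kSubsetsOf k (⊤ {n})) (missedIn Y) ℕ.* length (kSubsetsOf k C)
      < lsum (kSubsetsOf k C) (missedIn Y) ℕ.* length (kSubsetsOf k (⊤ {n}))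
  missed-gap {n} Y C r k ∣C∣≡r 1≤k k<r h =
    subst₂ (λ a b → SV ℕ.* a < SC ℕ.* b) (sym (length-kSubsetsOf C r k ∣C∣≡r)) (sym (length-kSubsetsOf (⊤ {n}) n k (SP.∣⊤∣≡n n)))
      (averageMissed-comparison n r k (∣ Y ∣) (∣ Y ∩ C ∣) SC SV 1≤k k<r r≤n (SP.p⊆q⇒∣p∣≤∣q∣ (SP.p∩q⊆p Y C))
         (lsum-missedIn Y C r k ∣C∣≡r) SV≡
         (frac-cross (∣ Y ∩ C ∣) r (∣ Y ∣) n (ℕP.≤-<-trans z≤n k<r) (ℕP.≤-<-trans z≤n k<n) h))
    where
    SC = lsum (kSubsetsOf k C) (missedIn Y)
    SV = lsum (kSubsetsOf k (⊤ {n})) (missedIn Y)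
    r≤n = subst (_≤ n) ∣C∣≡r (SP.∣p∣≤n C)
    k<n = ℕP.<-≤-trans k<r r≤n
    SV≡ : SV ≡ ∣ Y ∣ ℕ.* binom (n ∸ 1) k
    SV≡ = begin
      SV                                                             ≡⟨ lsum-missedIn Y ⊤ n k (SP.∣⊤∣≡n n) ⟩
      ∣ Y ∩ ⊤ ∣ ℕ.* binom (n ∸ 1) k ℕ.+ (∣ Y ∣ ∸ ∣ Y ∩ ⊤ ∣) ℕ.* binom n k ≡⟨ cong (λ z → z ℕ.* binom (n ∸ 1) k ℕ.+ (∣ Y ∣ ∸ z) ℕ.* binom n k) ∣Y∩⊤∣≡∣Y∣ ⟩
      ∣ Y ∣ ℕ.* binom (n ∸ 1) k ℕ.+ (∣ Y ∣ ∸ ∣ Y ∣) ℕ.* binom n k   ≡⟨ cong (λ z → ∣ Y ∣ ℕ.* binom (n ∸ 1) k ℕ.+ z ℕ.* binom n k) (ℕP.n∸n≡0 ∣ Y ∣) ⟩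
      ∣ Y ∣ ℕ.* binom (n ∸ 1) k ℕ.+ 0                                ≡⟨ ℕP.+-identityʳ _ ⟩
      ∣ Y ∣ ℕ.* binom (n ∸ 1) k                                      ∎
      where
      open ≡-Reasoning
      ∣Y∩⊤∣≡∣Y∣ : ∣ Y ∩ ⊤ ∣ ≡ ∣ Y ∣
      ∣Y∩⊤∣≡∣Y∣ = cong ∣_∣ (SP.∩-identityʳ Y)


open import Defs
open import Data.Nat using (ℕ; _≤_; _<_; _∸_; s≤s; z≤n)
open import Data.Fin.Subset using (Subset; ∣_∣; _∩_; ⊤)
open import Data.Rational using (_*_) renaming (_<_ to _<ℚ_)
open import Relation.Binary.PropositionalEquality using (_≡_)
open import Data.Nat.Properties using (≤-trans)
open import Data.Product using (_,_)
open SeedAverages using (kSubsetsOf-size)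
open Switchover

corollary2p6 : ∀ {n : ℕ} (G : Graph n) → Connected G →
    (C : Subset n) (r k : ℕ) → ∣ C ∣ ≡ r → 2 ≤ k → k < r →
    frac (n ∸ k) (n ∸ 1) * avgDeg G ⊤ <ℚ frac (r ∸ k) (r ∸ 1) * avgDeg G C →
    (d : ℕ) → PropertyStar G d →
    frac (∣ minDegSet G d ∩ C ∣) r <ℚ frac (∣ minDegSet G d ∣) n →
    WeakSwitchover G C k
corollary2p6 {n} G conn C r k ∣C∣≡r 2≤k k<r moreDegreeInC d star fewerMinDegInC =
  let β₁ , β₁∈ , C-wins = smallβ-separation G k LC LV (kSubsetsOf-size k C) (kSubsetsOf-size k (⊤ {n}))
                            (cut-gap G C r k ∣C∣≡r 1≤k k<r moreDegreeInC)
      β₂ , β₂∈ , V-wins = largeβ-separation G k d conn star 2≤k LC LV (kSubsetsOf-size k C) (kSubsetsOf-size k (⊤ {n}))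
                            (missed-gap (minDegSet G d) C r k ∣C∣≡r 1≤k k<r fewerMinDegInC)
  in β₁ , β₂ , β₁∈ , β₂∈ , C-wins , V-wins
  where
  LC = kSubsetsOf k C
  LV = kSubsetsOf k (⊤ {n})
  1≤k = ≤-trans (s≤s z≤n) 2≤k
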